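{- The theory $\mathrm{RCA}_0^{\Omega}$ proves the equivalences $$(\exists^{2})\leftrightarrow \Pi^0_1\text{ -TRANS}\leftrightarrow \mathrm{WKL}^{*}\leftrightarrow \mathrm{UWKL}.$$
   Context: BASE THEORY. Finite types: $0$ (natural numbers), $\sigma\to\tau$, and $\sigma^{*}$ (finite sequences of objects of type $\sigma$); $1=0\to 0$, $2=1\to 0$, $3=2\to 0$. Superscripts indicate types; tuples are coded as single objects where convenient. Equality $=_0$ is primitive; for $\tau=\tau_1\to\dots\to\tau_k\to 0$, $x=_\tau y$ means $(\forall z_1\dots z_k)(xz_1\dots z_k=_0 yz_1\dots z_k)$. $\mathrm{RCA}_0^{\omega}$ is Kohlenbach's higher-order base theory: classical arithmetic in all finite types with combinators, zero, successor, the recursor $R_0$ (primitive recursion with type $0$ values), quantifier-free induction, extensionality $x=_\rho y\to\varphi(x)=_\tau\varphi(y)$ for all $\varphi^{\rho\to\tau}$, and $\mathrm{QF\text{ - }AC}^{1,0}$, where $\mathrm{QF\text{ - }AC}^{\sigma,\tau}$ is $(\forall x^\sigma)(\exists y^\tau)A_0(x,y)\to(\exists F^{\sigma\to\tau})(\forall x)A_0(x,F(x))$ for quantifier-free $A_0$. $\mathrm{RCA}_0^{\Omega}$ extends $\mathrm{RCA}_0^{\omega}$ (with the types $\sigma^*$) by a predicate $\mathrm{st}$ ("is standard") for each type. A formula is internal if it does not contain $\mathrm{st}$; $(\forall^{\mathrm{st}}x)A$ is $(\forall x)(\mathrm{st}(x)\to A)$, $(\exists^{\mathrm{st}}x)A$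 is $(\exists x)(\mathrm{st}(x)\wedge A)$; $N\in\Omega$ means $\neg\mathrm{st}(N^0)$; $A^{\mathrm{st}}$ is $A$ with all quantifiers (except bounded number quantifiers) relativised to $\mathrm{st}$. Axioms: (i) standardness respects equality, closed terms are standard, a standard functional applied to a standard object is standard, and numbers below a standard number are standard; (ii) Idealization: $(\forall^{\mathrm{st}}x^{\sigma^*})(\exists y^\tau)(\forall z\in x)\varphi(z,y)\to(\exists y)(\forall^{\mathrm{st}}z^{\sigma})\varphi(z,y)$ for internal $\varphi$; (iii) $\mathrm{HAC}_{\mathrm{int}}$: $(\forall^{\mathrm{st}}x^{\rho})(\exists^{\mathrm{st}}y^{\tau})\varphi(x,y)\to(\exists^{\mathrm{st}}\Phi^{\rho\to\tau^*})(\forall^{\mathrm{st}}x)(\exists y\in\Phi(x))\varphi(x,y)$ for internal $\varphi$; (iv) $\mathrm{PF\text{ - }TP}_\forall$: $(\forall^{\mathrm{st}}x^\tau)\varphi(x)\to(\forall x^\tau)\varphi(x)$ for internal $\varphi(x)$ with no parameters other than $x$; (v) for certain functionals uniquely specified by a parameter-free internal formula $D$ (e.g. the one in $(\exists^2)$), a constant $\Xi_0$ with the axiom $\mathrm{st}(\Xi_0)\wedge(\forall^{\mathrm{st}}\Xi)[D^{\mathrm{st}}(\Xi)\to \Xi_0$ and $\Xi$ agree on all standard inputs$]$; these constants do not count as parameters in (iv). NOTATION. $\overline{\beta}n$ is the (code of the) initial segment of $\beta^1$ of length $n$. "$T^1\leq_1 1$" means that $T$ represents a binary tree. PRINCIPLES.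 $(\exists^2)$: $(\exists\varphi^2)(\forall g^1)[(\exists x^0)g(x)=0\leftrightarrow\varphi(g)=0]$. $\Pi^0_1\text{ -TRANS}$: $(\forall^{\mathrm{st}}f^1)[(\forall^{\mathrm{st}}n^0)f(n)=0\to(\forall n^0)f(n)=0]$. $\mathrm{WKL}^*$: $(\forall^{\mathrm{st}}T^1\leq_1 1)[(\forall^{\mathrm{st}}n^0)(\exists^{\mathrm{st}}\beta^1)(\overline{\beta}n\in T)\to(\exists^{\mathrm{st}}\alpha^1)(\forall m^0)(\overline{\alpha}m\in T)]$. $\mathrm{UWKL}$: $(\exists\Phi^{1\to1})(\forall T^1\leq_1 1)[(\forall n^0)(\exists\beta^1)(\overline{\beta}n\in T)\to(\forall x^0)(\overline{\Phi(T)}x\in T)]$. -}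

-- The theory RCA₀^Ω as a formal system: syntax, natural deduction, axioms.
-- Terms and formulas are intrinsically typed, variables are de Bruijn indices.

module Defs where

open import Data.Bool using (Bool; true; false; T) renaming (_∧_ to _&&_)
open import Data.Empty using (⊥)
open import Data.List using (List; []; _∷_; map)
open import Data.List.Membership.Propositional using (_∈_)
open import Data.List.Relation.Unary.Any using (here; there)
open import Data.Maybe using (Maybe; just; nothing)
open import Relation.Binary.PropositionalEquality using (refl)

------------------------------------------------------------------------
-- Types and terms

infixr 30 _⇒_
infix  40 _*

data Ty : Set where
  o   : Ty
  _⇒_ : Ty → Ty → Ty
  _*  : Ty → Ty

𝟏 𝟐 : Ty
𝟏 = o ⇒ o
𝟐 = 𝟏 ⇒ o

Ctx : Set
Ctx = List Ty

-- A signature of additional constants.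
Sig : Set₁
Sig = Ty → Set

None : Sig
None _ = ⊥

infixl 25 _·_

data Tm (C : Sig) (Γ : Ctx) : Ty → Set where
  var  : ∀ {τ} → τ ∈ Γ → Tm C Γ τ
  con  : ∀ {τ} → C τ → Tm C Γ τ
  _·_  : ∀ {σ τ} → Tm C Γ (σ ⇒ τ) → Tm C Γ σ → Tm C Γ τ
  K    : ∀ {σ τ} → Tm C Γ (σ ⇒ τ ⇒ σ)
  S    : ∀ {ρ σ τ} → Tm C Γ ((ρ ⇒ σ ⇒ τ) ⇒ (ρ ⇒ σ) ⇒ ρ ⇒ τ)
  zero : Tm C Γ o
  suc  : Tm C Γ (o ⇒ o)
  R₀   : Tm C Γ (o ⇒ o ⇒ (o ⇒ o ⇒ o) ⇒ o)
  -- Finite sequences: length, i-th entry (unspecified for i out of range),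
  -- and seg f n = ⟨f 0, …, f (n-1)⟩.
  len  : ∀ {σ} → Tm C Γ (σ * ⇒ o)
  at   : ∀ {σ} → Tm C Γ (σ * ⇒ o ⇒ σ)
  seg  : ∀ {σ} → Tm C Γ ((o ⇒ σ) ⇒ o ⇒ σ *)

Sub : Sig → Ctx → Ctx → Set
Sub C Γ Δ = ∀ {σ} → σ ∈ Γ → Tm C Δ σ

subT : ∀ {C Γ Δ τ} → Sub C Γ Δ → Tm C Γ τ → Tm C Δ τ
subT θ (var x) = θ x
subT θ (con c) = con c
subT θ (t · u) = subT θ t · subT θ u
subT θ K       = K
subT θ S       = S
subT θ zero    = zero
subT θ suc     = suc
subT θ R₀      = R₀
subT θ len     = len
subT θ at      = at
subT θ seg     = seg

shift : ∀ {C Γ σ} → Sub C Γ (σ ∷ Γ)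
shift x = var (there x)

lift : ∀ {C Γ Δ σ} → Sub C Γ Δ → Sub C (σ ∷ Γ) (σ ∷ Δ)
lift θ (here refl) = var (here refl)
lift θ (there x)   = subT shift (θ x)

single : ∀ {C Γ σ} → Tm C Γ σ → Sub C (σ ∷ Γ) Γ
single t (here refl) = t
single t (there x)   = var x

closed : ∀ {C Γ} → Sub C [] Γ
closed ()

wkT : ∀ {C Γ σ τ} → Tm C Γ τ → Tm C (σ ∷ Γ) τ
wkT = subT shift

v0 : ∀ {C Γ σ} → Tm C (σ ∷ Γ) σ
v0 = var (here refl)

v1 : ∀ {C Γ σ ρ} → Tm C (ρ ∷ σ ∷ Γ) σ
v1 = var (there (here refl))

-- Bracket abstraction.
lam : ∀ {C Γ σ τ} → Tm C (σ ∷ Γ) τ → Tm C Γ (σ ⇒ τ)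
lam {σ = σ} (var (here refl)) = S {σ = σ ⇒ σ} · K · K
lam (var (there x)) = K · var x
lam (con c)         = K · con c
lam (t · u)         = S · lam t · lam u
lam K               = K · K
lam S               = K · S
lam zero            = K · zero
lam suc             = K · suc
lam R₀              = K · R₀
lam len             = K · len
lam at              = K · at
lam seg             = K · seg

embedT : ∀ {C Γ τ} → Tm None Γ τ → Tm C Γ τ
embedT (var x) = var x
embedT (con ())
embedT (t · u) = embedT t · embedT u
embedT K       = K
embedT S       = S
embedT zero    = zero
embedT suc     = suc
embedT R₀      = R₀
embedT len     = len
embedT at      = at
embedT seg     = seg

infixl 27 _+̇_ _∸̇_

_+̇_ : ∀ {C Γ} → Tm C Γ o → Tm C Γ o → Tm C Γ o
s +̇ t = R₀ · t · s · lam (lam (suc · v1))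

pred : ∀ {C Γ} → Tm C Γ o → Tm C Γ o
pred s = R₀ · s · zero · lam (lam v0)

_∸̇_ : ∀ {C Γ} → Tm C Γ o → Tm C Γ o → Tm C Γ o
s ∸̇ t = R₀ · t · s · lam (lam (pred v1))

-- Cantor pairing (a + b)(a + b + 1)/2 + b.
triangle : ∀ {C Γ} → Tm C Γ o → Tm C Γ o
triangle s = R₀ · s · zero · lam (lam (v1 +̇ (suc · v0)))

pair : ∀ {C Γ} → Tm C Γ o → Tm C Γ o → Tm C Γ o
pair s t = triangle (s +̇ t) +̇ t

-- The bijective coding of finite sequences of numbers with
-- code ⟨⟩ = 0 and code (s ⌢ ⟨x⟩) = 1 + pair (code s) x.
code : ∀ {C Γ} → Tm C Γ (o * ⇒ o)
code = lam (R₀ · (len · v0) · zero · lam (lam (suc · pair v1 (at · wkT v1 · v0))))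

-- Code of the initial segment of β of length n.
initSeg : ∀ {C Γ} → Tm C Γ 𝟏 → Tm C Γ o → Tm C Γ o
initSeg β n = code · (seg · β · n)

------------------------------------------------------------------------
-- Formulas

infix  20 _≐_ _≤̇_ _<̇_ _∈̇_
infixr 18 _∧_
infixr 17 _∨_
infixr 16 _⟶_
infix  15 _⟷_

data Fm (C : Sig) (Γ : Ctx) : Set where
  _≐_  : Tm C Γ o → Tm C Γ o → Fm C Γ
  st   : ∀ {τ} → Tm C Γ τ → Fm C Γ
  ⊥̇    : Fm C Γ
  _∧_  : Fm C Γ → Fm C Γ → Fm C Γ
  _∨_  : Fm C Γ → Fm C Γ → Fm C Γ
  _⟶_  : Fm C Γ → Fm C Γ → Fm C Γ
  ∀̇    : ∀ τ → Fm C (τ ∷ Γ) → Fm C Γ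
  ∃̇    : ∀ τ → Fm C (τ ∷ Γ) → Fm C Γ
  -- Bounded number quantifiers (∀ i < t) and (∃ i < t). They are part of the
  -- syntax only because relativisation to st leaves them alone.
  ∀<   : Tm C Γ o → Fm C (o ∷ Γ) → Fm C Γ
  ∃<   : Tm C Γ o → Fm C (o ∷ Γ) → Fm C Γ

¬̇_ : ∀ {C Γ} → Fm C Γ → Fm C Γ
¬̇ A = A ⟶ ⊥̇

_⟷_ : ∀ {C Γ} → Fm C Γ → Fm C Γ → Fm C Γ
A ⟷ B = (A ⟶ B) ∧ (B ⟶ A)

sub : ∀ {C Γ Δ} → Sub C Γ Δ → Fm C Γ → Fm C Δ
sub θ (s ≐ t)  = subT θ s ≐ subT θ t
sub θ (st t)   = st (subT θ t)
sub θ ⊥̇        = ⊥̇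
sub θ (A ∧ B)  = sub θ A ∧ sub θ B
sub θ (A ∨ B)  = sub θ A ∨ sub θ B
sub θ (A ⟶ B)  = sub θ A ⟶ sub θ B
sub θ (∀̇ τ A)  = ∀̇ τ (sub (lift θ) A)
sub θ (∃̇ τ A)  = ∃̇ τ (sub (lift θ) A)
sub θ (∀< t A) = ∀< (subT θ t) (sub (lift θ) A)
sub θ (∃< t A) = ∃< (subT θ t) (sub (lift θ) A)

wk : ∀ {C Γ σ} → Fm C Γ → Fm C (σ ∷ Γ)
wk = sub shift

_[_] : ∀ {C Γ σ} → Fm C (σ ∷ Γ) → Tm C Γ σ → Fm C Γ
A [ t ] = sub (single t) A

embed : ∀ {C Γ} → Fm None Γ → Fm C Γ
embed (s ≐ t)  = embedT s ≐ embedT t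
embed (st t)   = st (embedT t)
embed ⊥̇        = ⊥̇
embed (A ∧ B)  = embed A ∧ embed B
embed (A ∨ B)  = embed A ∨ embed B
embed (A ⟶ B)  = embed A ⟶ embed B
embed (∀̇ τ A)  = ∀̇ τ (embed A)
embed (∃̇ τ A)  = ∃̇ τ (embed A)
embed (∀< t A) = ∀< (embedT t) (embed A)
embed (∃< t A) = ∃< (embedT t) (embed A)

internal : ∀ {C Γ} → Fm C Γ → Bool
internal (s ≐ t)  = true
internal (st t)   = false
internal ⊥̇        = true
internal (A ∧ B)  = internal A && internal B
internal (A ∨ B)  = internal A && internal B
internal (A ⟶ B)  = internal A && internal B
internal (∀̇ τ A)  = internal A
internal (∃̇ τ A)  = internal A
internal (∀< t A) = internal A
internal (∃< t A) = internal A

-- Quantifier-free formulas of the language of RCA₀^ω, hence without st.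
quantifierFree : ∀ {C Γ} → Fm C Γ → Bool
quantifierFree (s ≐ t)  = true
quantifierFree (st t)   = false
quantifierFree ⊥̇        = true
quantifierFree (A ∧ B)  = quantifierFree A && quantifierFree B
quantifierFree (A ∨ B)  = quantifierFree A && quantifierFree B
quantifierFree (A ⟶ B)  = quantifierFree A && quantifierFree B
quantifierFree (∀̇ τ A)  = false
quantifierFree (∃̇ τ A)  = false
quantifierFree (∀< t A) = false
quantifierFree (∃< t A) = false

∀ˢᵗ ∃ˢᵗ : ∀ {C Γ} τ → Fm C (τ ∷ Γ) → Fm C Γ
∀ˢᵗ τ A = ∀̇ τ (st v0 ⟶ A)
∃ˢᵗ τ A = ∃̇ τ (st v0 ∧ A)

_ˢᵗ : ∀ {C Γ} → Fm C Γ → Fm C Γ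
(s ≐ t) ˢᵗ  = s ≐ t
(st t) ˢᵗ   = st t
⊥̇ ˢᵗ        = ⊥̇
(A ∧ B) ˢᵗ  = A ˢᵗ ∧ B ˢᵗ
(A ∨ B) ˢᵗ  = A ˢᵗ ∨ B ˢᵗ
(A ⟶ B) ˢᵗ  = A ˢᵗ ⟶ B ˢᵗ
(∀̇ τ A) ˢᵗ  = ∀ˢᵗ τ (A ˢᵗ)
(∃̇ τ A) ˢᵗ  = ∃ˢᵗ τ (A ˢᵗ)
(∀< t A) ˢᵗ = ∀< t (A ˢᵗ)
(∃< t A) ˢᵗ = ∃< t (A ˢᵗ)

_≤̇_ _<̇_ : ∀ {C Γ} → Tm C Γ o → Tm C Γ o → Fm C Γ
s ≤̇ t = s ∸̇ t ≐ zero
s <̇ t = (suc · s) ≤̇ t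

Eq : ∀ {C Γ} τ → Tm C Γ τ → Tm C Γ τ → Fm C Γ
Eq o       s t = s ≐ t
Eq (σ ⇒ τ) s t = ∀̇ σ (Eq τ (wkT s · v0) (wkT t · v0))
Eq (σ *)   s t = len · s ≐ len · t
               ∧ ∀< (len · s) (Eq σ (at · wkT s · v0) (at · wkT t · v0))

-- x ∈ s for a finite sequence s.
Elem : ∀ {C Γ} σ → Tm C Γ σ → Tm C Γ (σ *) → Fm C Γ
Elem σ x s = ∃< (len · s) (Eq σ (wkT x) (at · wkT s · v0))

------------------------------------------------------------------------
-- Classical natural deduction over a set of axioms

Theory : Sig → Set₁
Theory C = ∀ {Γ} → Fm C Γ → Set

infix 10 _⨟_⊢_

data _⨟_⊢_ {C : Sig} (Ax : Theory C) {Γ : Ctx} (Δ : List (Fm C Γ)) : Fm C Γ → Set where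
  ax  : ∀ {A} → Ax A → Ax ⨟ Δ ⊢ A
  hyp : ∀ {A} → A ∈ Δ → Ax ⨟ Δ ⊢ A
  ∧I  : ∀ {A B} → Ax ⨟ Δ ⊢ A → Ax ⨟ Δ ⊢ B → Ax ⨟ Δ ⊢ A ∧ B
  ∧E₁ : ∀ {A B} → Ax ⨟ Δ ⊢ A ∧ B → Ax ⨟ Δ ⊢ A
  ∧E₂ : ∀ {A B} → Ax ⨟ Δ ⊢ A ∧ B → Ax ⨟ Δ ⊢ B
  ∨I₁ : ∀ {A B} → Ax ⨟ Δ ⊢ A → Ax ⨟ Δ ⊢ A ∨ B
  ∨I₂ : ∀ {A B} → Ax ⨟ Δ ⊢ B → Ax ⨟ Δ ⊢ A ∨ B
  ∨E  : ∀ {A B D} → Ax ⨟ Δ ⊢ A ∨ B → Ax ⨟ A ∷ Δ ⊢ D → Ax ⨟ B ∷ Δ ⊢ D → Ax ⨟ Δ ⊢ D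
  ⟶I  : ∀ {A B} → Ax ⨟ A ∷ Δ ⊢ B → Ax ⨟ Δ ⊢ A ⟶ B
  ⟶E  : ∀ {A B} → Ax ⨟ Δ ⊢ A ⟶ B → Ax ⨟ Δ ⊢ A → Ax ⨟ Δ ⊢ B
  raa : ∀ {A} → Ax ⨟ (¬̇ A) ∷ Δ ⊢ ⊥̇ → Ax ⨟ Δ ⊢ A
  ∀I  : ∀ {τ A} → Ax ⨟ map wk Δ ⊢ A → Ax ⨟ Δ ⊢ ∀̇ τ A
  ∀E  : ∀ {τ A} → Ax ⨟ Δ ⊢ ∀̇ τ A → (t : Tm C Γ τ) → Ax ⨟ Δ ⊢ A [ t ]
  ∃I  : ∀ {τ A} (t : Tm C Γ τ) → Ax ⨟ Δ ⊢ A [ t ] → Ax ⨟ Δ ⊢ ∃̇ τ A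
  ∃E  : ∀ {τ A D} → Ax ⨟ Δ ⊢ ∃̇ τ A → Ax ⨟ A ∷ map wk Δ ⊢ wk D → Ax ⨟ Δ ⊢ D

infix 10 _⊢_

_⊢_ : ∀ {C} → Theory C → Fm C [] → Set
Ax ⊢ A = Ax ⨟ [] ⊢ A

------------------------------------------------------------------------
-- RCA₀^ω. Formulas in schemata may contain parameters (the context Γ).

-- From A(x, y), with y the last variable, to A(x, F x) in a context Γ, F, x.
choose : ∀ {C Γ σ τ} → Sub C (τ ∷ σ ∷ Γ) (σ ∷ (σ ⇒ τ) ∷ Γ)
choose (here refl)         = v1 · v0
choose (there (here refl)) = v0
choose (there (there x))   = var (there (there x))

QF-AC : ∀ {C Γ} σ τ → Fm C (τ ∷ σ ∷ Γ) → Fm C Γ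
QF-AC σ τ A = ∀̇ σ (∃̇ τ A) ⟶ ∃̇ (σ ⇒ τ) (∀̇ σ (sub choose A))

-- From A(x) to A(x + 1).
next : ∀ {C Γ} → Sub C (o ∷ Γ) (o ∷ Γ)
next (here refl) = suc · v0
next (there x)   = var (there x)

data RCA₀ω {C : Sig} {Γ : Ctx} : Fm C Γ → Set where
  ≐-refl  : ∀ s → RCA₀ω (s ≐ s)
  ≐-sym   : ∀ s t → RCA₀ω (s ≐ t ⟶ t ≐ s)
  ≐-trans : ∀ s t u → RCA₀ω (s ≐ t ⟶ t ≐ u ⟶ s ≐ u)
  ext     : ∀ {ρ τ} (φ : Tm C Γ (ρ ⇒ τ)) s t → RCA₀ω (Eq ρ s t ⟶ Eq τ (φ · s) (φ · t))

  K-eq    : ∀ {σ τ} (s : Tm C Γ σ) (t : Tm C Γ τ) → RCA₀ω (Eq σ (K · s · t) s)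
  S-eq    : ∀ {ρ σ τ} (s : Tm C Γ (ρ ⇒ σ ⇒ τ)) (t : Tm C Γ (ρ ⇒ σ)) (u : Tm C Γ ρ) →
            RCA₀ω (Eq τ (S · s · t · u) (s · u · (t · u)))
  R₀-zero : ∀ s f → RCA₀ω (R₀ · zero · s · f ≐ s)
  R₀-suc  : ∀ n s f → RCA₀ω (R₀ · (suc · n) · s · f ≐ f · (R₀ · n · s · f) · n)
  len-seg : ∀ {σ} (f : Tm C Γ (o ⇒ σ)) n → RCA₀ω (len · (seg · f · n) ≐ n)
  at-seg  : ∀ {σ} (f : Tm C Γ (o ⇒ σ)) n i →
            RCA₀ω (i <̇ n ⟶ Eq σ (at · (seg · f · n) · i) (f · i))

  suc≢0   : ∀ n → RCA₀ω (¬̇ (suc · n ≐ zero))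
  suc-inj : ∀ m n → RCA₀ω (suc · m ≐ suc · n ⟶ m ≐ n)
  ∀<-def  : ∀ t A → RCA₀ω (∀< t A ⟷ ∀̇ o (v0 <̇ wkT t ⟶ A))
  ∃<-def  : ∀ t A → RCA₀ω (∃< t A ⟷ ∃̇ o (v0 <̇ wkT t ∧ A))

  qf-ind  : ∀ A → T (quantifierFree A) →
            RCA₀ω (A [ zero ] ∧ ∀̇ o (A ⟶ sub next A) ⟶ ∀̇ o A)
  qf-ac   : ∀ A → T (quantifierFree A) → RCA₀ω (QF-AC 𝟏 o A)

------------------------------------------------------------------------
-- Functionals uniquely specified by a parameter-free internal formula

record Specification : Set where
  field
    type         : Ty
    formula      : Fm None (type ∷ [])
    is-internal  : T (internal formula)
    is-unique    : RCA₀ω ⊢ ∀̇ type (∀̇ type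
                     (sub (single v0) (sub (lift closed) formula)
                       ⟶ sub (single v1) (sub (lift closed) formula)
                       ⟶ Eq type v0 v1))

open Specification public

-- (∃²) by itself only fixes where φ vanishes; specifying φ uniquely requires
-- fixing its nonzero value as well.
D-∃² : ∀ {C} → Fm C (𝟐 ∷ [])
D-∃² = ∀̇ 𝟏 ((∃̇ o (v1 · v0 ≐ zero) ⟷ v1 · v0 ≐ zero)
           ∧ (v1 · v0 ≐ zero ∨ v1 · v0 ≐ suc · zero))

spec-∃² : Specification
spec-∃² = record
  { type = 𝟐 ; formula = D-∃² ; is-internal = _
  ; is-unique = ∀I (∀I (⟶I (⟶I (∀I
      (∨E (∧E₂ (inst (there (here refl))))
        (≐-join (hyp (here refl))
          (≐-flip (⟶E (∧E₁ (∧E₁ (inst (there (here refl)))))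
                 (⟶E (∧E₂ (∧E₁ (inst (there (there (here refl)))))) (hyp (here refl))))))
        (∨E (∧E₂ (inst (there (here refl))))
          (≐-join (⟶E (∧E₁ (∧E₁ (inst (there (there (there (here refl)))))))
                (⟶E (∧E₂ (∧E₁ (inst (there (there (here refl)))))) (hyp (here refl))))
            (≐-flip (hyp (here refl))))
          (≐-join (hyp (there (here refl))) (≐-flip (hyp (here refl))))))))))
  }
  where
  inst : ∀ {Γ} {Δ : List (Fm None (𝟏 ∷ Γ))} {A} → ∀̇ 𝟏 A ∈ Δ → RCA₀ω ⨟ Δ ⊢ A [ v0 ]
  inst p = ∀E (hyp p) v0

  ≐-join : ∀ {Γ} {Δ : List (Fm None Γ)} {s t u} →
       RCA₀ω ⨟ Δ ⊢ s ≐ t → RCA₀ω ⨟ Δ ⊢ t ≐ u → RCA₀ω ⨟ Δ ⊢ s ≐ u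
  ≐-join p q = ⟶E (⟶E (ax (≐-trans _ _ _)) p) q

  ≐-flip : ∀ {Γ} {Δ : List (Fm None Γ)} {s t} → RCA₀ω ⨟ Δ ⊢ s ≐ t → RCA₀ω ⨟ Δ ⊢ t ≐ s
  ≐-flip p = ⟶E (ax (≐-sym _ _)) p

-- A family 𝒮 of further specifications, always extended by spec-∃².
spec : {I : Set} → (I → Specification) → Maybe I → Specification
spec 𝒮 nothing  = spec-∃²
spec 𝒮 (just i) = 𝒮 i

data Const {I : Set} (𝒮 : I → Specification) : Sig where
  Ξ₀ : ∀ i → Const 𝒮 (type (spec 𝒮 i))

------------------------------------------------------------------------
-- RCA₀^Ω

-- (∀ˢᵗ x^σ*)(∃ y^τ)(∀ z ∈ x) φ(z, y) → (∃ y)(∀ˢᵗ z^σ) φ(z, y)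
Idealization : ∀ {C Γ} σ τ → Fm C (σ ∷ τ ∷ Γ) → Fm C Γ
Idealization σ τ φ =
  ∀ˢᵗ (σ *) (∃̇ τ (∀̇ σ (Elem σ v0 (wkT v1) ⟶ sub (lift (lift shift)) φ)))
  ⟶ ∃̇ τ (∀ˢᵗ σ φ)

-- (∀ˢᵗ x^ρ)(∃ˢᵗ y^τ) φ(x, y) → (∃ˢᵗ Φ)(∀ˢᵗ x)(∃ y ∈ Φ x) φ(x, y)
HACint : ∀ {C Γ} ρ τ → Fm C (τ ∷ ρ ∷ Γ) → Fm C Γ
HACint ρ τ φ =
  ∀ˢᵗ ρ (∃ˢᵗ τ φ)
  ⟶ ∃ˢᵗ (ρ ⇒ τ *) (∀ˢᵗ ρ (∃̇ τ (Elem τ v0 (wkT (v1 · v0)) ∧ sub (lift (lift shift)) φ)))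

data RCA₀Ω {I : Set} (𝒮 : I → Specification) {Γ : Ctx} : Fm (Const 𝒮) Γ → Set where
  rca₀ω     : ∀ {A} → RCA₀ω A → RCA₀Ω 𝒮 A

  st-eq     : ∀ {τ} (s t : Tm (Const 𝒮) Γ τ) → RCA₀Ω 𝒮 (Eq τ s t ⟶ st s ⟶ st t)
  st-closed : ∀ {τ} (t : Tm (Const 𝒮) [] τ) → RCA₀Ω 𝒮 (st (subT closed t))
  st-app    : ∀ {σ τ} (f : Tm (Const 𝒮) Γ (σ ⇒ τ)) x → RCA₀Ω 𝒮 (st f ⟶ st x ⟶ st (f · x))
  st-below  : ∀ m n → RCA₀Ω 𝒮 (m ≤̇ n ⟶ st n ⟶ st m)

  ideal     : ∀ σ τ φ → T (internal φ) → RCA₀Ω 𝒮 (Idealization σ τ φ)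
  hac-int   : ∀ ρ τ φ → T (internal φ) → RCA₀Ω 𝒮 (HACint ρ τ φ)

  -- φ has no free variable but x; the constants Ξ₀ may occur in it.
  pf-tp     : ∀ τ (φ : Fm (Const 𝒮) (τ ∷ [])) → T (internal φ) →
              RCA₀Ω 𝒮 (∀ˢᵗ τ (sub (lift closed) φ) ⟶ ∀̇ τ (sub (lift closed) φ))

  -- (Eq …) ˢᵗ is agreement on all standard arguments.
  Ξ₀-spec   : ∀ i → let τ = type (spec 𝒮 i) ; D = embed (formula (spec 𝒮 i)) in
              RCA₀Ω 𝒮 (st (con (Ξ₀ i))
                ∧ ∀ˢᵗ τ (sub (lift closed) (D ˢᵗ) ⟶ (Eq τ (con (Ξ₀ i)) v0) ˢᵗ))

------------------------------------------------------------------------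
-- The principles

v2 : ∀ {C Γ σ ρ τ} → Tm C (τ ∷ ρ ∷ σ ∷ Γ) σ
v2 = var (there (there (here refl)))

-- A set of numbers is given by its characteristic function.
_∈̇_ : ∀ {C Γ} → Tm C Γ o → Tm C Γ 𝟏 → Fm C Γ
n ∈̇ X = X · n ≐ suc · zero

-- T is the characteristic function of a set of codes of 0-1-sequences that is
-- closed under initial segments.
BinaryTree : ∀ {C Γ} → Tm C Γ 𝟏 → Fm C Γ
BinaryTree T =
  ∀̇ o (wkT T · v0 ≤̇ suc · zero)
  ∧ ∀̇ (o *) (code · v0 ∈̇ wkT T ⟶
      ∀< (len · v0) (at · v1 · v0 ≤̇ suc · zero
                     ∧ initSeg (at · v1) v0 ∈̇ wkT (wkT T)))

E² : ∀ {C} → Fm C []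
E² = ∃̇ 𝟐 (∀̇ 𝟏 (∃̇ o (v1 · v0 ≐ zero) ⟷ v1 · v0 ≐ zero))

Π⁰₁-TRANS : ∀ {C} → Fm C []
Π⁰₁-TRANS = ∀ˢᵗ 𝟏 (∀ˢᵗ o (v1 · v0 ≐ zero) ⟶ ∀̇ o (v1 · v0 ≐ zero))

WKL* : ∀ {C} → Fm C []
WKL* = ∀ˢᵗ 𝟏 (BinaryTree v0 ⟶
         ∀ˢᵗ o (∃ˢᵗ 𝟏 (initSeg v0 v1 ∈̇ v2))
         ⟶ ∃ˢᵗ 𝟏 (∀̇ o (initSeg v1 v0 ∈̇ v2)))

UWKL : ∀ {C} → Fm C []
UWKL = ∃̇ (𝟏 ⇒ 𝟏) (∀̇ 𝟏 (BinaryTree v0 ⟶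
         ∀̇ o (∃̇ 𝟏 (initSeg v0 v1 ∈̇ v2))
         ⟶ ∀̇ o (initSeg (v2 · v1) v0 ∈̇ v1)))

{-# OPTIONS --safe #-}
module Submission where

open import Defs
open import Data.Bool using (T)
open import Data.List using (List; []; _∷_; _++_; map)
open import Data.List.Membership.Propositional using (_∈_)
open import Data.List.Relation.Binary.Subset.Propositional.Properties using (∷⁺ʳ; map⁺)
open import Data.List.Relation.Unary.Any using (here; there)
open import Data.Maybe using (nothing)
open import Data.Nat using (ℕ) renaming (suc to ℕsuc)
open import Relation.Binary.PropositionalEquality using (_≡_; refl; sym; trans; cong; cong₂; subst; subst₂)

-- From (∃²), QF-AC yields a functional μ with g(μ g) = 0 whenever g has a zero. This property of μ has no
-- parameters, so by PF-TP there is a standard such μ; it maps standard functions to standard numbers, whence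
-- Π⁰₁-TRANS. Conversely, by Π⁰₁-TRANS a standard g with a zero has a standard one, HAC_int collects finitely
-- many candidates Φ(g), and searching through them defines a standard φ satisfying (∃²) relativised to st.
-- Hence Ξ₀ agrees with φ on standard arguments, and PF-TP removes the restriction to standard arguments.
--
-- With μ it is decidable whether a node of a tree has extensions of all lengths, since quantifiers over finite
-- sequences can be replaced by number quantifiers; following the leftmost such nodes gives UWKL. A standard Φ as
-- in UWKL yields WKL*, because Π⁰₁-TRANS turns nodes of every standard length into nodes of every length.
-- WKL* for the tree of all 0ⁿ such that f vanishes below n gives Π⁰₁-TRANS.
--
-- For UWKL → (∃²) consider the tree consisting of the branches 000… and 111…. If Φ selects the branch of a,
-- cut this branch off at the first zero of g: Φ selects the other branch if g has a zero, whereas by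
-- extensionality the choice remains the same if it has none.

-- Induction is available for quantifier-free formulas only, and functionals are defined by terms.
-- So each notion that enters an induction or a definition is first replaced by an equation between
-- numbers: comparability by an equation with an explicit difference, vanishing below a bound by a
-- sum, extensibility of a node by two nested applications of μ, once a single family of functions
-- covers all finite sequences.
--
-- PF-TP admits no parameters. A functional can be taken standard only if its existence is a closed
-- internal statement that has already been derived; μ, Φ, the covering family and the two-branch
-- functional are made standard in this way.
--
-- Grilliot's trick must not use μ, whose existence it is to establish, so its trees have to be
-- defined by bounded search. The functional that produces them also produces the tree for the step
-- from WKL* to Π⁰₁-TRANS.

v3 : ∀ {C Γ t0 t1 t2 t3} → Tm C (t0 ∷ t1 ∷ t2 ∷ t3 ∷ Γ) t3
v3 = var (there (there (there (here refl))))
v4 : ∀ {C Γ t0 t1 t2 t3 t4} → Tm C (t0 ∷ t1 ∷ t2 ∷ t3 ∷ t4 ∷ Γ) t4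
v4 = var (there (there (there (there (here refl)))))
v5 : ∀ {C Γ t0 t1 t2 t3 t4 t5} → Tm C (t0 ∷ t1 ∷ t2 ∷ t3 ∷ t4 ∷ t5 ∷ Γ) t5
v5 = var (there (there (there (there (there (here refl))))))
v6 : ∀ {C Γ t0 t1 t2 t3 t4 t5 t6} → Tm C (t0 ∷ t1 ∷ t2 ∷ t3 ∷ t4 ∷ t5 ∷ t6 ∷ Γ) t6
v6 = var (there (there (there (there (there (there (here refl)))))))
v7 : ∀ {C Γ t0 t1 t2 t3 t4 t5 t6 t7} → Tm C (t0 ∷ t1 ∷ t2 ∷ t3 ∷ t4 ∷ t5 ∷ t6 ∷ t7 ∷ Γ) t7
v7 = var (there (there (there (there (there (there (there (here refl))))))))
v8 : ∀ {C Γ t0 t1 t2 t3 t4 t5 t6 t7 t8} → Tm C (t0 ∷ t1 ∷ t2 ∷ t3 ∷ t4 ∷ t5 ∷ t6 ∷ t7 ∷ t8 ∷ Γ) t8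
v8 = var (there (there (there (there (there (there (there (there (here refl)))))))))
v9 : ∀ {C Γ t0 t1 t2 t3 t4 t5 t6 t7 t8 t9} → Tm C (t0 ∷ t1 ∷ t2 ∷ t3 ∷ t4 ∷ t5 ∷ t6 ∷ t7 ∷ t8 ∷ t9 ∷ Γ) t9
v9 = var (there (there (there (there (there (there (there (there (there (here refl))))))))))
v10 : ∀ {C Γ t0 t1 t2 t3 t4 t5 t6 t7 t8 t9 t10} → Tm C (t0 ∷ t1 ∷ t2 ∷ t3 ∷ t4 ∷ t5 ∷ t6 ∷ t7 ∷ t8 ∷ t9 ∷ t10 ∷ Γ) t10
v10 = var (there (there (there (there (there (there (there (there (there (there (here refl)))))))))))

-- Substitution and its laws

module _ {C : Sig} where

  subT-cong : ∀ {Γ Δ τ} {θ η : Sub C Γ Δ} → (∀ {σ} (x : σ ∈ Γ) → θ x ≡ η x) →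
              (t : Tm C Γ τ) → subT θ t ≡ subT η t
  subT-cong e (var x) = e x
  subT-cong e (con c) = refl
  subT-cong e (t · u) = cong₂ _·_ (subT-cong e t) (subT-cong e u)
  subT-cong e K    = refl
  subT-cong e S    = refl
  subT-cong e zero = refl
  subT-cong e suc  = refl
  subT-cong e R₀   = refl
  subT-cong e len  = refl
  subT-cong e at   = refl
  subT-cong e seg  = refl

  subT-∘ : ∀ {Γ Δ Θ τ} (θ : Sub C Δ Θ) (η : Sub C Γ Δ) (t : Tm C Γ τ) →
           subT θ (subT η t) ≡ subT (λ x → subT θ (η x)) t
  subT-∘ θ η (var x) = refl
  subT-∘ θ η (con c) = refl
  subT-∘ θ η (t · u) = cong₂ _·_ (subT-∘ θ η t) (subT-∘ θ η u)
  subT-∘ θ η K    = refl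
  subT-∘ θ η S    = refl
  subT-∘ θ η zero = refl
  subT-∘ θ η suc  = refl
  subT-∘ θ η R₀   = refl
  subT-∘ θ η len  = refl
  subT-∘ θ η at   = refl
  subT-∘ θ η seg  = refl

  subT-id : ∀ {Γ τ} (t : Tm C Γ τ) → subT var t ≡ t
  subT-id (var x) = refl
  subT-id (con c) = refl
  subT-id (t · u) = cong₂ _·_ (subT-id t) (subT-id u)
  subT-id K    = refl
  subT-id S    = refl
  subT-id zero = refl
  subT-id suc  = refl
  subT-id R₀   = refl
  subT-id len  = refl
  subT-id at   = refl
  subT-id seg  = refl

  subT-single-wkT : ∀ {Γ σ τ} (u : Tm C Γ σ) (t : Tm C Γ τ) → subT (single u) (wkT t) ≡ t
  subT-single-wkT u t = trans (subT-∘ (single u) shift t) (subT-id t)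

  subT-lift-wkT : ∀ {Γ Δ σ τ} (θ : Sub C Γ Δ) (t : Tm C Γ τ) →
                  subT (lift {σ = σ} θ) (wkT t) ≡ wkT (subT θ t)
  subT-lift-wkT θ t = trans (subT-∘ (lift θ) shift t) (sym (subT-∘ shift θ t))

  lift-cong : ∀ {Γ Δ ρ} {θ η : Sub C Γ Δ} → (∀ {σ} (x : σ ∈ Γ) → θ x ≡ η x) →
              ∀ {σ} (x : σ ∈ ρ ∷ Γ) → lift θ x ≡ lift η x
  lift-cong e (here refl) = refl
  lift-cong e (there x)   = cong wkT (e x)

  sub-cong : ∀ {Γ Δ} {θ η : Sub C Γ Δ} → (∀ {σ} (x : σ ∈ Γ) → θ x ≡ η x) →
             (A : Fm C Γ) → sub θ A ≡ sub η A
  sub-cong e (s ≐ t)  = cong₂ _≐_ (subT-cong e s) (subT-cong e t)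
  sub-cong e (st t)   = cong st (subT-cong e t)
  sub-cong e ⊥̇        = refl
  sub-cong e (A ∧ B)  = cong₂ _∧_ (sub-cong e A) (sub-cong e B)
  sub-cong e (A ∨ B)  = cong₂ _∨_ (sub-cong e A) (sub-cong e B)
  sub-cong e (A ⟶ B)  = cong₂ _⟶_ (sub-cong e A) (sub-cong e B)
  sub-cong e (∀̇ τ A)  = cong (∀̇ τ) (sub-cong (lift-cong e) A)
  sub-cong e (∃̇ τ A)  = cong (∃̇ τ) (sub-cong (lift-cong e) A)
  sub-cong e (∀< t A) = cong₂ ∀< (subT-cong e t) (sub-cong (lift-cong e) A)
  sub-cong e (∃< t A) = cong₂ ∃< (subT-cong e t) (sub-cong (lift-cong e) A)

  lift-∘ : ∀ {Γ Δ Θ ρ} (θ : Sub C Δ Θ) (η : Sub C Γ Δ) {σ} (x : σ ∈ ρ ∷ Γ) →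
           subT (lift θ) (lift η x) ≡ lift (λ y → subT θ (η y)) x
  lift-∘ θ η (here refl) = refl
  lift-∘ θ η (there x)   = subT-lift-wkT θ (η x)

  sub-∘ : ∀ {Γ Δ Θ} (θ : Sub C Δ Θ) (η : Sub C Γ Δ) (A : Fm C Γ) →
          sub θ (sub η A) ≡ sub (λ x → subT θ (η x)) A
  sub-∘-lift : ∀ {Γ Δ Θ ρ} (θ : Sub C Δ Θ) (η : Sub C Γ Δ) (A : Fm C (ρ ∷ Γ)) →
               sub (lift θ) (sub (lift η) A) ≡ sub (lift (λ x → subT θ (η x))) A
  sub-∘ θ η (s ≐ t)  = cong₂ _≐_ (subT-∘ θ η s) (subT-∘ θ η t)
  sub-∘ θ η (st t)   = cong st (subT-∘ θ η t)
  sub-∘ θ η ⊥̇        = refl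
  sub-∘ θ η (A ∧ B)  = cong₂ _∧_ (sub-∘ θ η A) (sub-∘ θ η B)
  sub-∘ θ η (A ∨ B)  = cong₂ _∨_ (sub-∘ θ η A) (sub-∘ θ η B)
  sub-∘ θ η (A ⟶ B)  = cong₂ _⟶_ (sub-∘ θ η A) (sub-∘ θ η B)
  sub-∘ θ η (∀̇ τ A)  = cong (∀̇ τ) (sub-∘-lift θ η A)
  sub-∘ θ η (∃̇ τ A)  = cong (∃̇ τ) (sub-∘-lift θ η A)
  sub-∘ θ η (∀< t A) = cong₂ ∀< (subT-∘ θ η t) (sub-∘-lift θ η A)
  sub-∘ θ η (∃< t A) = cong₂ ∃< (subT-∘ θ η t) (sub-∘-lift θ η A)
  sub-∘-lift θ η A = trans (sub-∘ (lift θ) (lift η) A) (sub-cong (lift-∘ θ η) A)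

  sub-Eq : ∀ τ {Γ Δ} (θ : Sub C Γ Δ) (t u : Tm C Γ τ) →
           sub θ (Eq τ t u) ≡ Eq τ (subT θ t) (subT θ u)
  sub-Eq o       θ t u = refl
  sub-Eq (σ ⇒ τ) θ t u = cong (∀̇ σ) (trans (sub-Eq τ (lift θ) _ _)
    (cong₂ (λ a b → Eq τ (a · v0) (b · v0)) (subT-lift-wkT θ t) (subT-lift-wkT θ u)))
  sub-Eq (σ *)   θ t u = cong (λ A → len · subT θ t ≐ len · subT θ u ∧ ∀< (len · subT θ t) A)
    (trans (sub-Eq σ (lift θ) _ _)
      (cong₂ (λ a b → Eq σ (at · a · v0) (at · b · v0)) (subT-lift-wkT θ t) (subT-lift-wkT θ u)))

  infixl 21 _▹_
  _▹_ : ∀ {Γ Δ σ} → Sub C Γ Δ → Tm C Δ σ → Sub C (σ ∷ Γ) Δ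
  (θ ▹ t) (here refl) = t
  (θ ▹ t) (there x)   = θ x

  ∀* : (Γ : Ctx) → Fm C Γ → Fm C []
  ∀* []      A = A
  ∀* (τ ∷ Γ) A = ∀* Γ (∀̇ τ A)

  -- Combinatory normalisation

  -- Terms that contract when given one more argument, which is why `R₀` occurs with only two.
  data Redex {Γ} : ∀ {σ τ} → Tm C Γ (σ ⇒ τ) → Set where
    K-redex    : ∀ {σ τ} (t : Tm C Γ σ) → Redex (K {σ = σ} {τ} · t)
    S-redex    : ∀ {ρ σ τ} (t : Tm C Γ (ρ ⇒ σ ⇒ τ)) (u : Tm C Γ (ρ ⇒ σ)) → Redex (S · t · u)
    zero-redex : ∀ t → Redex (R₀ · zero · t)
    suc-redex  : ∀ n t → Redex (R₀ · (suc · n) · t)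
    no-redex   : ∀ {σ τ} {t : Tm C Γ (σ ⇒ τ)} → Redex t

  redex : ∀ {Γ σ τ} (t : Tm C Γ (σ ⇒ τ)) → Redex t
  redex (K · t)              = K-redex t
  redex (S · t · u)          = S-redex t u
  redex (R₀ · zero · t)      = zero-redex t
  redex (R₀ · (suc · n) · t) = suc-redex n t
  redex t                    = no-redex

  -- The first argument is fuel; running out of it only yields a term that is not normal.
  apply : ∀ {Γ σ τ} → ℕ → Tm C Γ (σ ⇒ τ) → Tm C Γ σ → Tm C Γ τ
  apply 0      f a = f · a
  apply (ℕsuc k) f a with redex f
  ... | K-redex t    = t
  ... | S-redex t u  = apply k (apply k t a) (apply k u a)
  ... | zero-redex t = t
  ... | suc-redex n t = apply k (apply k a (apply k (R₀ · n · t) a)) n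
  ... | no-redex = f · a

  normalise : ∀ {Γ τ} → Tm C Γ τ → Tm C Γ τ
  normalise (f · a) = apply 200 (normalise f) (normalise a)
  normalise t       = t

  -- Telescopes: iterated abstraction, application and quantification

  infixr 5 _⇛_
  _⇛_ : Ctx → Ty → Ty
  []      ⇛ τ = τ
  (σ ∷ Θ) ⇛ τ = Θ ⇛ (σ ⇒ τ)

  lams : ∀ Θ {Γ τ} → Tm C (Θ ++ Γ) τ → Tm C Γ (Θ ⇛ τ)
  lams []      t = t
  lams (σ ∷ Θ) t = lams Θ (lam t)

  apps : ∀ Θ {Γ τ} → Tm C Γ (Θ ⇛ τ) → Sub C Θ Γ → Tm C Γ τ
  apps []      t η = t
  apps (σ ∷ Θ) t η = apps Θ t (λ x → η (there x)) · η (here refl)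

  alls : ∀ Θ {Γ} → Fm C (Θ ++ Γ) → Fm C Γ
  alls []      A = A
  alls (σ ∷ Θ) A = alls Θ (∀̇ σ A)

  extend : ∀ Θ {Γ Δ} → Sub C Γ Δ → Sub C Θ Δ → Sub C (Θ ++ Γ) Δ
  extend []      θ η = θ
  extend (σ ∷ Θ) θ η = extend Θ θ (λ x → η (there x)) ▹ η (here refl)

  lifts : ∀ Θ {Γ Δ} → Sub C Γ Δ → Sub C (Θ ++ Γ) (Θ ++ Δ)
  lifts []      θ = θ
  lifts (σ ∷ Θ) θ = lift (lifts Θ θ)

  weakens : ∀ Θ {Γ τ} → Tm C Γ τ → Tm C (Θ ++ Γ) τ
  weakens []      t = t
  weakens (σ ∷ Θ) t = wkT (weakens Θ t)

  wks : ∀ Θ {Γ} → List (Fm C Γ) → List (Fm C (Θ ++ Γ))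
  wks []      Δ = Δ
  wks (σ ∷ Θ) Δ = map wk (wks Θ Δ)

  locals : ∀ Θ {Γ} → Sub C Θ (Θ ++ Γ)
  locals (σ ∷ Θ) (here refl) = v0
  locals (σ ∷ Θ) (there x)   = wkT (locals Θ x)

  apps-cong : ∀ Θ {Γ τ} {t u : Tm C Γ (Θ ⇛ τ)} {η ζ : Sub C Θ Γ} → t ≡ u → (∀ {σ} (x : σ ∈ Θ) → η x ≡ ζ x) →
              apps Θ t η ≡ apps Θ u ζ
  apps-cong []      e p = e
  apps-cong (σ ∷ Θ) e p = cong₂ _·_ (apps-cong Θ e (λ x → p (there x))) (p (here refl))

  subT-apps : ∀ Θ {Γ Δ τ} (θ : Sub C Γ Δ) (t : Tm C Γ (Θ ⇛ τ)) (η : Sub C Θ Γ) →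
              subT θ (apps Θ t η) ≡ apps Θ (subT θ t) (λ x → subT θ (η x))
  subT-apps []      θ t η = refl
  subT-apps (σ ∷ Θ) θ t η = cong (_· subT θ (η (here refl))) (subT-apps Θ θ t (λ x → η (there x)))

  sub-alls : ∀ Θ {Γ Δ} (θ : Sub C Γ Δ) (A : Fm C (Θ ++ Γ)) → sub θ (alls Θ A) ≡ alls Θ (sub (lifts Θ θ) A)
  sub-alls []      θ A = refl
  sub-alls (σ ∷ Θ) θ A = sub-alls Θ θ (∀̇ σ A)

  lifts-weakens : ∀ Θ {Γ Δ τ} (θ : Sub C Γ Δ) (t : Tm C Γ τ) → subT (lifts Θ θ) (weakens Θ t) ≡ weakens Θ (subT θ t)
  lifts-weakens []      θ t = refl
  lifts-weakens (σ ∷ Θ) θ t = trans (subT-lift-wkT (lifts Θ θ) (weakens Θ t)) (cong wkT (lifts-weakens Θ θ t))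

  lifts-locals : ∀ Θ {Γ Δ} (θ : Sub C Γ Δ) {σ} (x : σ ∈ Θ) → subT (lifts Θ θ) (locals Θ x) ≡ locals Θ x
  lifts-locals (σ ∷ Θ) θ (here refl) = refl
  lifts-locals (σ ∷ Θ) θ (there x)   = trans (subT-lift-wkT (lifts Θ θ) (locals Θ x)) (cong wkT (lifts-locals Θ θ x))

  weakens-subT : ∀ Θ {Γ τ} (t : Tm C Γ τ) → weakens Θ t ≡ subT (λ x → weakens Θ (var x)) t
  weakens-subT []      t = sym (subT-id t)
  weakens-subT (σ ∷ Θ) t = trans (cong wkT (weakens-subT Θ t)) (subT-∘ shift _ t)

  lifts-single-shift : ∀ Θ {Γ υ} (u : Tm C Γ υ) {σ} (x : σ ∈ Θ ++ Γ) → subT (lifts Θ (single u)) (lifts Θ shift x) ≡ var x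
  lifts-single-shift []      u x           = refl
  lifts-single-shift (σ ∷ Θ) u (here refl) = refl
  lifts-single-shift (σ ∷ Θ) u (there x)   =
    trans (subT-lift-wkT (lifts Θ (single u)) (lifts Θ shift x)) (cong wkT (lifts-single-shift Θ u x))

  extend-wkT : ∀ Θ {Γ Δ ρ} (θ : Sub C Γ Δ) (η : Sub C Θ Δ) {σ} (x : σ ∈ Θ ++ Γ) →
               extend Θ (λ y → wkT {σ = ρ} (θ y)) (λ y → wkT (η y)) x ≡ wkT (extend Θ θ η x)
  extend-wkT []      θ η x           = refl
  extend-wkT (σ ∷ Θ) θ η (here refl) = refl
  extend-wkT (σ ∷ Θ) θ η (there x)   = extend-wkT Θ θ (λ y → η (there y)) x

  extend-locals : ∀ Θ {Γ σ} (x : σ ∈ Θ ++ Γ) → extend Θ (λ y → weakens Θ (var y)) (locals Θ) x ≡ var x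
  extend-locals []      x           = refl
  extend-locals (σ ∷ Θ) (here refl) = refl
  extend-locals (σ ∷ Θ) (there x)   = trans (extend-wkT Θ (λ y → weakens Θ (var y)) (locals Θ) x) (cong wkT (extend-locals Θ x))

  -- The hypothesis is pointwise because a lifted identity substitution is only pointwise equal to
  -- `var`; this form passes under binders.
  sub-id : ∀ {Γ} {θ : Sub C Γ Γ} → (∀ {σ} (x : σ ∈ Γ) → θ x ≡ var x) → (A : Fm C Γ) → sub θ A ≡ A
  sub-id e (s ≐ t)  = cong₂ _≐_ (trans (subT-cong e s) (subT-id s)) (trans (subT-cong e t) (subT-id t))
  sub-id e (st t)   = cong st (trans (subT-cong e t) (subT-id t))
  sub-id e ⊥̇        = refl
  sub-id e (A ∧ B)  = cong₂ _∧_ (sub-id e A) (sub-id e B)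
  sub-id e (A ∨ B)  = cong₂ _∨_ (sub-id e A) (sub-id e B)
  sub-id e (A ⟶ B)  = cong₂ _⟶_ (sub-id e A) (sub-id e B)
  sub-id e (∀̇ τ A)  = cong (∀̇ τ) (sub-id (λ { (here refl) → refl ; (there x) → cong wkT (e x) }) A)
  sub-id e (∃̇ τ A)  = cong (∃̇ τ) (sub-id (λ { (here refl) → refl ; (there x) → cong wkT (e x) }) A)
  sub-id e (∀< t A) = cong₂ ∀< (trans (subT-cong e t) (subT-id t)) (sub-id (λ { (here refl) → refl ; (there x) → cong wkT (e x) }) A)
  sub-id e (∃< t A) = cong₂ ∃< (trans (subT-cong e t) (subT-id t)) (sub-id (λ { (here refl) → refl ; (there x) → cong wkT (e x) }) A)

private variable
  S′ : Sig
  Γ : Ctx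

-- Auxiliary terms, and the notions of the proof as formulas

ifz : ∀ {C Γ} → Tm C Γ o → Tm C Γ o → Tm C Γ o → Tm C Γ o
ifz x a b = R₀ · x · a · (K · (K · b))

-- Truth values are numbers, zero being true.
not : ∀ {C Γ} → Tm C Γ o → Tm C Γ o
not x = ifz x (suc · zero) zero

distance : ∀ {C Γ} → Tm C Γ o → Tm C Γ o → Tm C Γ o
distance x y = x ∸̇ y +̇ (y ∸̇ x)

-- The candidate `v1` is kept if it is a zero and replaced by the current index `v0` otherwise. The
-- result is a zero if there is one below the bound, and carries no information if there is none.
search : ∀ {C Γ} → Tm C Γ (𝟏 ⇒ o ⇒ o)
search = lam (lam (R₀ · v0 · zero · lam (lam (ifz (v3 · v1) v1 v0))))

𝐏 𝐂 : Ty
𝐏 = o ⇒ o ⇒ o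
𝐂 = o * ⇒ o

prefix : Tm S′ Γ (o * ⇒ o) → Tm S′ Γ 𝟏 → Tm S′ Γ o → Tm S′ Γ o
prefix c β n = c · (seg · β · n)

-- The bound on the first component makes the code of a sequence at least as large as its length.
Pairing : Tm S′ Γ (o ⇒ o ⇒ o) → Fm S′ Γ
Pairing p = ∀̇ o (∀̇ o (∀̇ o (∀̇ o (w p · v3 · v2 ≐ w p · v1 · v0 ⟶ v3 ≐ v1 ∧ v2 ≐ v0))))
          ∧ ∀̇ o (∀̇ o (v1 ≤̇ wkT (wkT p) · v1 · v0))
  where w : ∀ {α β γ δ τ} → Tm S′ Γ τ → Tm S′ (α ∷ β ∷ γ ∷ δ ∷ Γ) τ
        w t = wkT (wkT (wkT (wkT t)))

-- All that the arguments about trees know of `code`. They are carried out for variables `c` and `p`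
-- with these properties, so the large term `code` is never normalised in them.
Coding : Tm S′ Γ (o * ⇒ o) → Tm S′ Γ (o ⇒ o ⇒ o) → Fm S′ Γ
Coding c p = ∀̇ 𝟏 (prefix (wkT c) v0 zero ≐ zero)
           ∧ ∀̇ 𝟏 (∀̇ o (prefix (wkT (wkT c)) v1 (suc · v0)
                        ≐ suc · (wkT (wkT p) · (prefix (wkT (wkT c)) v1 v0) · (v1 · v0))))
           ∧ ∀̇ (o *) (wkT c · v0 ≐ prefix (wkT c) (at · v0) (len · v0))
           ∧ Pairing p

pairing : Tm S′ Γ (o ⇒ o ⇒ o)
pairing = lam (lam (pair v1 v0))

Searches : Tm S′ Γ 𝟐 → Fm S′ Γ
Searches μ = ∀̇ 𝟏 (∀̇ o (v1 · v0 ≐ zero ⟶ v1 · (wkT (wkT μ) · v1) ≐ zero))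

DecidesZeros : Tm S′ Γ 𝟐 → Fm S′ Γ
DecidesZeros φ = ∀̇ 𝟏 (∃̇ o (v1 · v0 ≐ zero) ⟷ wkT φ · v0 ≐ zero)

IsDistance : Tm S′ Γ 𝐏 → Fm S′ Γ
IsDistance d = ∀̇ o (∀̇ o (wkT (wkT d) · v1 · v0 ≐ zero ⟶ v1 ≐ v0)) ∧ ∀̇ o (wkT d · v0 · v0 ≐ zero)

Iterates : Tm S′ Γ 𝟏 → Tm S′ Γ 𝐏 → Fm S′ Γ
Iterates f i = ∀̇ o (wkT i · zero · v0 ≐ v0)
             ∧ ∀̇ o (∀̇ o (wkT (wkT i) · (suc · v1) · v0 ≐ wkT (wkT f) · (wkT (wkT i) · v1 · v0)))

Stacks : Tm S′ Γ 𝐏 → Tm S′ Γ (𝟏 ⇒ o ⇒ o) → Fm S′ Γ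
Stacks p s = ∀̇ 𝟏 (∀̇ o (wkT (wkT s) · v1 · (suc · v0) ≐ wkT (wkT p) · (wkT (wkT s) · v1 · v0) · (v1 · v0)))

Projections : Tm S′ Γ 𝐏 → Tm S′ Γ 𝟏 → Tm S′ Γ 𝟏 → Fm S′ Γ
Projections p f s = ∀̇ o (∀̇ o (wkT (wkT f) · (wkT (wkT p) · v1 · v0) ≐ v1 ∧ wkT (wkT s) · (wkT (wkT p) · v1 · v0) ≐ v0))

-- Allows a number quantifier over indices of `e` to replace a function quantifier whenever only a
-- finite part of the function matters.
Covers : Tm S′ Γ 𝐏 → Fm S′ Γ
Covers e = ∀̇ 𝟏 (∀̇ o (∃̇ o (∀̇ o (v0 <̇ v2 ⟶ wkT (wkT (wkT (wkT e))) · v1 · v0 ≐ v3 · v0))))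

-- The length `n` accompanies the code `x`, so that it never has to be decoded from `x`.
Reaches : Tm S′ Γ 𝐂 → Tm S′ Γ 𝟏 → (x n m : Tm S′ Γ o) → Fm S′ Γ
Reaches c t x n m = ∃̇ 𝟏 (prefix (wkT c) v0 (wkT n) ≐ wkT x ∧ prefix (wkT c) v0 (wkT m) ∈̇ wkT t)

TestsReach : Tm S′ Γ 𝐂 → Tm S′ Γ (𝟏 ⇒ o ⇒ o ⇒ o ⇒ 𝟏) → Fm S′ Γ
TestsReach c p = ∀̇ 𝟏 (∀̇ o (∀̇ o (∀̇ o (∃̇ o (wkT (w p) · v4 · v3 · v2 · v1 · v0 ≐ zero) ⟷ Reaches (w c) v3 v2 v1 v0))))
  where w : ∀ {α β γ δ τ} → Tm S′ Γ τ → Tm S′ (α ∷ β ∷ γ ∷ δ ∷ Γ) τ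
        w t = wkT (wkT (wkT (wkT t)))

Extensible : Tm S′ Γ 𝐂 → Tm S′ Γ 𝟏 → Tm S′ Γ o → Tm S′ Γ o → Fm S′ Γ
Extensible c t x n = ∀̇ o (Reaches (wkT c) (wkT t) (wkT x) (wkT n) v0)

TestsExtensible : Tm S′ Γ 𝐂 → Tm S′ Γ (𝟏 ⇒ 𝐏) → Fm S′ Γ
TestsExtensible c g = ∀̇ 𝟏 (∀̇ o (∀̇ o (w g · v2 · v1 · v0 ≐ zero ⟷ Extensible (w c) v2 v1 v0)))
  where w : ∀ {α β γ τ} → Tm S′ Γ τ → Tm S′ (α ∷ β ∷ γ ∷ Γ) τ
        w t = wkT (wkT (wkT t))

Tree : Tm S′ Γ 𝐂 → Tm S′ Γ 𝟏 → Fm S′ Γ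
Tree c t = ∀̇ o (wkT t · v0 ≤̇ suc · zero)
         ∧ ∀̇ (o *) (wkT c · v0 ∈̇ wkT t ⟶
             ∀< (len · v0) (at · v1 · v0 ≤̇ suc · zero ∧ prefix (wkT (wkT c)) (at · v1) v0 ∈̇ wkT (wkT t)))

Infinite : Tm S′ Γ 𝐂 → Tm S′ Γ 𝟏 → Fm S′ Γ
Infinite c t = ∀̇ o (∃̇ 𝟏 (prefix (wkT (wkT c)) v0 v1 ∈̇ wkT (wkT t)))

Path : Tm S′ Γ 𝐂 → Tm S′ Γ 𝟏 → Tm S′ Γ 𝟏 → Fm S′ Γ
Path c t α = ∀̇ o (prefix (wkT c) (wkT α) v0 ∈̇ wkT t)

Selects : Tm S′ Γ 𝐂 → Tm S′ Γ (𝟏 ⇒ 𝟏) → Fm S′ Γ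
Selects c Φ = ∀̇ 𝟏 (Tree (wkT c) v0 ⟶ Infinite (wkT c) v0 ⟶ Path (wkT c) v0 (wkT Φ · v0))

-- Φ t is the leftmost path through extensible nodes of t, and ν t enumerates the nodes on it.
Follows : Tm S′ Γ (𝟏 ⇒ 𝐏) → Tm S′ Γ 𝐏 → Tm S′ Γ (𝟏 ⇒ 𝟏) → Tm S′ Γ (𝟏 ⇒ 𝟏) → Fm S′ Γ
Follows g p Φ ν = ∀̇ 𝟏 (wkT ν · v0 · zero ≐ zero)
                ∧ ∀̇ 𝟏 (∀̇ o (w ν · v1 · (suc · v0) ≐ suc · (w p · (w ν · v1 · v0) · (w Φ · v1 · v0))
                           ∧ w Φ · v1 · v0 ≐ ifz (w g · v1 · (suc · (w p · (w ν · v1 · v0) · zero)) · (suc · v0)) zero (suc · zero)))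
  where w : ∀ {α β τ} → Tm S′ Γ τ → Tm S′ (α ∷ β ∷ Γ) τ
        w t = wkT (wkT t)

Vanishes : Tm S′ Γ 𝟏 → Tm S′ Γ o → Fm S′ Γ
Vanishes g n = ∀̇ o (v0 <̇ wkT n ⟶ wkT g · v0 ≐ zero)

-- K · b is the constant function with value b.
Branch : Tm S′ Γ 𝐂 → Tm S′ Γ o → Tm S′ Γ 𝟏 → Tm S′ Γ o → Fm S′ Γ
Branch c b g x = ∃̇ o (wkT x ≐ prefix (wkT c) (K · wkT b) v0 ∧ Vanishes (wkT g) v0)

-- The two arguments of `Θ` act as shears: a nonzero value of the first one cuts off 000..., a
-- nonzero value of the second one cuts off 111....
TwoBranches : Tm S′ Γ 𝐂 → Tm S′ Γ (𝟏 ⇒ 𝟏 ⇒ 𝟏) → Fm S′ Γ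
TwoBranches c Θ = ∀̇ 𝟏 (∀̇ 𝟏 (∀̇ o
    ((v0 ∈̇ (w Θ · v2 · v1) ⟷ Branch (w c) zero v2 v0 ∨ Branch (w c) (suc · zero) v1 v0)
    ∧ w Θ · v2 · v1 · v0 ≤̇ suc · zero)))
  where w : ∀ {α β γ τ} → Tm S′ Γ τ → Tm S′ (α ∷ β ∷ γ ∷ Γ) τ
        w t = wkT (wkT (wkT t))

SearchesBelow : Tm S′ Γ (𝟏 ⇒ o ⇒ o) → Fm S′ Γ
SearchesBelow w = ∀̇ 𝟏 (∀̇ o (∀̇ o (v0 <̇ v1 ⟶ v2 · v0 ≐ zero ⟶ v2 · (wkT (wkT (wkT w)) · v2 · v1) ≐ zero)))

TestsVanishing : Tm S′ Γ (𝟏 ⇒ o ⇒ o) → Fm S′ Γ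
TestsVanishing σ = ∀̇ 𝟏 (∀̇ o (wkT (wkT σ) · v1 · v0 ≐ zero ⟷ Vanishes v1 v0))

-- One of u g and v g vanishes identically, depending on a; the other one vanishes where g does not.
Switch : Tm S′ Γ o → Tm S′ Γ (𝟏 ⇒ 𝟏) → Tm S′ Γ (𝟏 ⇒ 𝟏) → Fm S′ Γ
Switch a u v = ∀̇ 𝟏 (∀̇ o (w u · v1 · v0 ≐ ifz (w a) (not (v1 · v0)) zero ∧ w v · v1 · v0 ≐ ifz (w a) zero (not (v1 · v0))))
  where w : ∀ {α β τ} → Tm S′ Γ τ → Tm S′ (α ∷ β ∷ Γ) τ
        w t = wkT (wkT t)

-- The principles WKL* and Π⁰₁-TRANS in an arbitrary context, with c in place of code.
WeakKönig : Tm S′ Γ 𝐂 → Fm S′ Γ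
WeakKönig c = ∀ˢᵗ 𝟏 (Tree (wkT c) v0 ⟶
    ∀ˢᵗ o (∃ˢᵗ 𝟏 (prefix (wkT (wkT (wkT c))) v0 v1 ∈̇ v2))
    ⟶ ∃ˢᵗ 𝟏 (∀̇ o (prefix (wkT (wkT (wkT c))) v1 v0 ∈̇ v2)))

Transfer : Fm S′ Γ
Transfer = ∀ˢᵗ 𝟏 (∀ˢᵗ o (v1 · v0 ≐ zero) ⟶ ∀̇ o (v1 · v0 ≐ zero))

-- Derived rules and equality at higher types

module Rules {C : Sig} (Ax : Theory C) (rca : ∀ {Γ} {A : Fm C Γ} → RCA₀ω A → Ax A) where

  infix 4 _⊩_
  _⊩_ : ∀ {Γ} → List (Fm C Γ) → Fm C Γ → Set
  Δ ⊩ A = Ax ⨟ Δ ⊢ A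

  axiom : ∀ {Γ} {Δ : List (Fm C Γ)} {A} → RCA₀ω A → Δ ⊩ A
  axiom a = ax (rca a)

  all : ∀ Θ {Γ} {Δ : List (Fm C Γ)} {A : Fm C (Θ ++ Γ)} → Δ ⊩ alls Θ A → (η : Sub C Θ Γ) → Δ ⊩ sub (extend Θ var η) A
  all []      {Δ = Δ} {A} p η = subst (Δ ⊩_) (sym (sub-id (λ x → refl) A)) p
  all (σ ∷ Θ) {Δ = Δ} {A} p η = subst (Δ ⊩_)
    (trans (sub-∘ _ _ A) (sub-cong (λ { (here refl) → refl ; (there x) → subT-single-wkT _ _ }) A))
    (∀E (all Θ p (λ x → η (there x))) (η (here refl)))

  module _ {Γ} {Δ : List (Fm C Γ)} where
    h0 : ∀ {A} → A ∷ Δ ⊩ A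
    h0 = hyp (here refl)
    h1 : ∀ {A B} → B ∷ A ∷ Δ ⊩ A
    h1 = hyp (there (here refl))
    h2 : ∀ {A B D} → D ∷ B ∷ A ∷ Δ ⊩ A
    h2 = hyp (there (there (here refl)))
    ≐r : ∀ {s} → Δ ⊩ s ≐ s
    ≐r = axiom (≐-refl _)
    ≐s : ∀ {s t} → Δ ⊩ s ≐ t → Δ ⊩ t ≐ s
    ≐s p = ⟶E (axiom (≐-sym _ _)) p
    ≐t : ∀ {s t u} → Δ ⊩ s ≐ t → Δ ⊩ t ≐ u → Δ ⊩ s ≐ u
    ≐t p q = ⟶E (⟶E (axiom (≐-trans _ _ _)) p) q

  weaken-⊆ : ∀ {Γ} {Δ Δ′ : List (Fm C Γ)} {A} → (∀ {B} → B ∈ Δ → B ∈ Δ′) → Δ ⊩ A → Δ′ ⊩ A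
  weaken-⊆ {Γ} i (ax a)     = ax a
  weaken-⊆ i (hyp x)    = hyp (i x)
  weaken-⊆ i (∧I p q)   = ∧I (weaken-⊆ i p) (weaken-⊆ i q)
  weaken-⊆ i (∧E₁ p)    = ∧E₁ (weaken-⊆ i p)
  weaken-⊆ i (∧E₂ p)    = ∧E₂ (weaken-⊆ i p)
  weaken-⊆ i (∨I₁ p)    = ∨I₁ (weaken-⊆ i p)
  weaken-⊆ i (∨I₂ p)    = ∨I₂ (weaken-⊆ i p)
  weaken-⊆ i (∨E p q r) = ∨E (weaken-⊆ i p) (weaken-⊆ (∷⁺ʳ _ i) q) (weaken-⊆ (∷⁺ʳ _ i) r)
  weaken-⊆ i (⟶I p)     = ⟶I (weaken-⊆ (∷⁺ʳ _ i) p)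
  weaken-⊆ i (⟶E p q)   = ⟶E (weaken-⊆ i p) (weaken-⊆ i q)
  weaken-⊆ i (raa p)    = raa (weaken-⊆ (∷⁺ʳ _ i) p)
  weaken-⊆ i (∀I p)     = ∀I (weaken-⊆ (map⁺ wk i) p)
  weaken-⊆ i (∀E p t)   = ∀E (weaken-⊆ i p) t
  weaken-⊆ i (∃I t p)   = ∃I t (weaken-⊆ i p)
  weaken-⊆ i (∃E p q)   = ∃E (weaken-⊆ i p) (weaken-⊆ (∷⁺ʳ _ (map⁺ wk i)) q)

  weaken : ∀ {Γ} {Δ : List (Fm C Γ)} {A B} → Δ ⊩ A → B ∷ Δ ⊩ A
  weaken = weaken-⊆ there

  -- Equality at higher types

  Eq-refl : ∀ τ {Γ} {Δ : List (Fm C Γ)} (t : Tm C Γ τ) → Δ ⊩ Eq τ t t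
  Eq-refl o       t = ≐r
  Eq-refl (σ ⇒ τ) t = ∀I (Eq-refl τ _)
  Eq-refl (σ *)   t = ∧I ≐r (⟶E (∧E₂ (axiom (∀<-def _ _))) (∀I (⟶I (Eq-refl σ _))))

  Eq-app : ∀ {σ τ Γ} {Δ : List (Fm C Γ)} {f g : Tm C Γ (σ ⇒ τ)} →
           Δ ⊩ Eq (σ ⇒ τ) f g → (t : Tm C Γ σ) → Δ ⊩ Eq τ (f · t) (g · t)
  Eq-app {τ = τ} {Δ = Δ} {f} {g} p t = subst (Δ ⊩_)
    (trans (sub-Eq τ _ _ _) (cong₂ (λ a b → Eq τ (a · t) (b · t)) (subT-single-wkT t f) (subT-single-wkT t g)))
    (∀E p t)

  Eq-arg : ∀ {σ τ Γ} {Δ : List (Fm C Γ)} (f : Tm C Γ (σ ⇒ τ)) {t u} →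
           Δ ⊩ Eq σ t u → Δ ⊩ Eq τ (f · t) (f · u)
  Eq-arg f p = ⟶E (axiom (ext f _ _)) p

  R₀-cong : ∀ {Γ} {Δ : List (Fm C Γ)} {m n s t f} → Δ ⊩ m ≐ n → Δ ⊩ s ≐ t → Δ ⊩ R₀ · m · s · f ≐ R₀ · n · t · f
  R₀-cong {Γ} {Δ} {m} {n} {s} {t} {f} p q = ≐t
    (Eq-app {f = R₀ · m · s} {R₀ · n · s} (Eq-app {f = R₀ · m} {R₀ · n} (Eq-arg R₀ p) s) f)
    (Eq-app {f = R₀ · n · s} {R₀ · n · t} (Eq-arg (R₀ · n) q) f)

  -- An implication inside the calculus, so that the induction on types can be applied below the
  -- quantifier in `Eq`: the hypotheses are weakened there by `∀I`, whereas given derivations could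
  -- not be moved into the larger context.
  Eq-trans⟶ : ∀ τ {Γ} {Δ : List (Fm C Γ)} (s t u : Tm C Γ τ) → Δ ⊩ Eq τ s t ⟶ Eq τ t u ⟶ Eq τ s u
  Eq-trans⟶ o       s t u = axiom (≐-trans s t u)
  Eq-trans⟶ (σ ⇒ τ) {Γ} s t u = ⟶I (⟶I (∀I (⟶E (⟶E (Eq-trans⟶ τ _ _ _)
      (app s t (hyp (there (here refl))))) (app t u (hyp (here refl))))))
    where
    app : ∀ {Δ : List (Fm C (σ ∷ Γ))} s t → Δ ⊩ wk (Eq (σ ⇒ τ) s t) → Δ ⊩ Eq τ (wkT s · v0) (wkT t · v0)
    app {Δ} s t p = Eq-app (subst (Δ ⊩_) (sub-Eq (σ ⇒ τ) shift s t) p) v0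
  Eq-trans⟶ (σ *) {Γ} s t u = ⟶I (⟶I (∧I (≐t (∧E₁ h1) (∧E₁ h0))
      (⟶E (∧E₂ (axiom (∀<-def _ _))) (∀I (⟶I (⟶E (⟶E (Eq-trans⟶ σ _ _ _)
        (entry s t h2 h0))
        -- The index is bounded by the length of `s`; equality of the lengths turns this into a
        -- bound by the length of `t`.
        (entry t u h1 (≐t (R₀-cong (≐s (proj s t h2)) ≐r) h0))))))))
    where
    star : ∀ {Δ : List (Fm C (o ∷ Γ))} s t → Δ ⊩ wk (Eq (σ *) s t) → Δ ⊩ Eq (σ *) (wkT s) (wkT t)
    star {Δ} s t p = subst (Δ ⊩_) (sub-Eq (σ *) shift s t) p
    proj : ∀ {Δ : List (Fm C (o ∷ Γ))} s t → Δ ⊩ wk (Eq (σ *) s t) → Δ ⊩ len · wkT s ≐ len · wkT t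
    proj s t p = ∧E₁ p
    entry : ∀ {Δ : List (Fm C (o ∷ Γ))} s t → Δ ⊩ wk (Eq (σ *) s t) → Δ ⊩ v0 <̇ len · wkT s →
            Δ ⊩ Eq σ (at · wkT s · v0) (at · wkT t · v0)
    entry {Δ} s t p q = subst (Δ ⊩_)
      (trans (sub-Eq σ _ _ _) (cong₂ (λ a b → Eq σ (at · a · v0) (at · b · v0)) (subT-single-wkT v0 _) (subT-single-wkT v0 _)))
      (⟶E (∀E (⟶E (∧E₁ (axiom (∀<-def _ _))) (∧E₂ (star s t p))) v0)
        (subst (λ a → Δ ⊩ (suc · v0) ∸̇ (len · a) ≐ zero) (sym (subT-single-wkT v0 (wkT s))) q))

  Eq-trans : ∀ {τ Γ} {Δ : List (Fm C Γ)} {s t u : Tm C Γ τ} → Δ ⊩ Eq τ s t → Δ ⊩ Eq τ t u → Δ ⊩ Eq τ s u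
  Eq-trans {τ} {s = s} {t} {u} p q = ⟶E (⟶E (Eq-trans⟶ τ s t u) p) q

  Eq-cong : ∀ {σ τ Γ} {Δ : List (Fm C Γ)} {f g : Tm C Γ (σ ⇒ τ)} {t u} → Δ ⊩ Eq (σ ⇒ τ) f g → Δ ⊩ Eq σ t u →
            Δ ⊩ Eq τ (f · t) (g · u)
  Eq-cong {f = f} {g} {t} {u} p q = Eq-trans {s = f · t} {g · t} {g · u} (Eq-app {f = f} {g} p t) (Eq-arg g q)

-- A language of derivations and its translation into natural deduction

module Internal {C : Sig} (Ax : Theory C) (rca : ∀ {Γ} {A : Fm C Γ} → RCA₀ω A → Ax A) where

  private module R = Rules Ax rca

  nth : ∀ {Γ} → List (Fm C Γ) → ℕ → Fm C Γ
  -- A provable default, so that `assume n` is sound for every `n`.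
  nth []      n        = ⊥̇ ⟶ ⊥̇
  nth (A ∷ Δ) 0        = A
  nth (A ∷ Δ) (ℕsuc n) = nth Δ n

  infix  4  _⊩_ _⊩_≈_
  infixl 8  _$_
  infixl 9  _∙_
  infixl 25 _⊙_
  infixr 2  _≐⟨_⟩_
  infix  3  _∎

  -- Derivations with the derived rules as constructors. The parameters Γ and Δ are not stored in the
  -- constructors, which keeps the elaborated derivations small.
  data _⊩_ {Γ : Ctx} (Δ : List (Fm C Γ)) : Fm C Γ → Set
  -- Eq computes on its type, so its sides can only be inferred once it is wrapped.
  data _⊩_≈_ {Γ : Ctx} (Δ : List (Fm C Γ)) : ∀ {τ} → Tm C Γ τ → Tm C Γ τ → Set

  data _⊩_ {Γ} Δ where
    ax      : ∀ {A} → Ax A → Δ ⊩ A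
    axiom   : ∀ {A} → RCA₀ω A → Δ ⊩ A
    assume  : ∀ n → Δ ⊩ nth Δ n
    ∧I      : ∀ {A B} → Δ ⊩ A → Δ ⊩ B → Δ ⊩ A ∧ B
    ∧E₁     : ∀ {A B} → Δ ⊩ A ∧ B → Δ ⊩ A
    ∧E₂     : ∀ {A B} → Δ ⊩ A ∧ B → Δ ⊩ B
    ∨I₁     : ∀ {A B} → Δ ⊩ A → Δ ⊩ A ∨ B
    ∨I₂     : ∀ {A B} → Δ ⊩ B → Δ ⊩ A ∨ B
    ∨E      : ∀ {A B D} → Δ ⊩ A ∨ B → A ∷ Δ ⊩ D → B ∷ Δ ⊩ D → Δ ⊩ D
    ⟶I      : ∀ {A B} → A ∷ Δ ⊩ B → Δ ⊩ A ⟶ B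
    _$_     : ∀ {A B} → Δ ⊩ A ⟶ B → Δ ⊩ A → Δ ⊩ B
    raa     : ∀ {A} → ¬̇ A ∷ Δ ⊩ ⊥̇ → Δ ⊩ A
    ∀I      : ∀ {τ A} → map wk Δ ⊩ A → Δ ⊩ ∀̇ τ A
    _∙_     : ∀ {τ A} → Δ ⊩ ∀̇ τ A → (t : Tm C Γ τ) → Δ ⊩ A [ t ]
    all     : ∀ Θ {A} → Δ ⊩ alls Θ A → (η : Sub C Θ Γ) → Δ ⊩ sub (extend Θ var η) A
    all₂    : ∀ {ρ σ A} → Δ ⊩ ∀̇ ρ (∀̇ σ A) → ∀ s t → Δ ⊩ sub (var ▹ s ▹ t) A
    all₃    : ∀ {π ρ σ A} → Δ ⊩ ∀̇ π (∀̇ ρ (∀̇ σ A)) → ∀ s t u → Δ ⊩ sub (var ▹ s ▹ t ▹ u) A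
    ∃I      : ∀ {τ A} (t : Tm C Γ τ) → Δ ⊩ A [ t ] → Δ ⊩ ∃̇ τ A
    ∃E      : ∀ {τ A D} → Δ ⊩ ∃̇ τ A → A ∷ map wk Δ ⊩ wk D → Δ ⊩ D
    cut     : ∀ {A B} → Δ ⊩ A → A ∷ Δ ⊩ B → Δ ⊩ B
    ⌈_⌉     : ∀ {A} → Ax ⨟ Δ ⊢ A → Δ ⊩ A
    ind     : ∀ {A} {_ : T (quantifierFree A)} → Δ ⊩ A [ zero ] → A ∷ map wk Δ ⊩ sub next A → Δ ⊩ ∀̇ o A
    ≐r      : ∀ {s} → Δ ⊩ s ≐ s
    ≐s      : ∀ {s t} → Δ ⊩ s ≐ t → Δ ⊩ t ≐ s
    ≐t      : ∀ {s t u} → Δ ⊩ s ≐ t → Δ ⊩ t ≐ u → Δ ⊩ s ≐ u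
    _≐⟨_⟩_  : ∀ s {t u} → Δ ⊩ s ≐ t → Δ ⊩ t ≐ u → Δ ⊩ s ≐ u
    _∎      : ∀ s → Δ ⊩ s ≐ s
    Eq-arg  : ∀ {σ τ} (f : Tm C Γ (σ ⇒ τ)) {t u} → Δ ⊩ Eq σ t u → Δ ⊩ Eq τ (f · t) (f · u)
    derivation : ∀ {s t} → Δ ⊩ s ≈ t → Δ ⊩ s ≐ t

  data _⊩_≈_ {Γ} Δ where
    equal   : ∀ {τ} {s t : Tm C Γ τ} → Δ ⊩ Eq τ s t → Δ ⊩ s ≈ t
    ≈-refl  : ∀ {τ} {t : Tm C Γ τ} → Δ ⊩ t ≈ t
    ≈-trans : ∀ {τ} {s t u : Tm C Γ τ} → Δ ⊩ s ≈ t → Δ ⊩ t ≈ u → Δ ⊩ s ≈ u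
    _⊙_     : ∀ {σ τ} {f g : Tm C Γ (σ ⇒ τ)} {t u} → Δ ⊩ f ≈ g → Δ ⊩ t ≈ u → Δ ⊩ f · t ≈ g · u

  hypothesis : ∀ {Γ} (Δ : List (Fm C Γ)) n → Ax ⨟ Δ ⊢ nth Δ n
  hypothesis []      n        = ⟶I (hyp (here refl))
  hypothesis (A ∷ Δ) 0        = hyp (here refl)
  hypothesis (A ∷ Δ) (ℕsuc n) = R.weaken (hypothesis Δ n)

  ⌊_⌋ : ∀ {Γ} {Δ : List (Fm C Γ)} {A} → Δ ⊩ A → Ax ⨟ Δ ⊢ A
  ⌊_⌋≈ : ∀ {Γ τ} {Δ : List (Fm C Γ)} {s t : Tm C Γ τ} → Δ ⊩ s ≈ t → Ax ⨟ Δ ⊢ Eq τ s t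
  ⌊ ax a ⌋         = ax a
  ⌊ axiom a ⌋      = ax (rca a)
  ⌊ assume n ⌋     = hypothesis _ n
  ⌊ ∧I p q ⌋       = ∧I ⌊ p ⌋ ⌊ q ⌋
  ⌊ ∧E₁ p ⌋        = ∧E₁ ⌊ p ⌋
  ⌊ ∧E₂ p ⌋        = ∧E₂ ⌊ p ⌋
  ⌊ ∨I₁ p ⌋        = ∨I₁ ⌊ p ⌋
  ⌊ ∨I₂ p ⌋        = ∨I₂ ⌊ p ⌋
  ⌊ ∨E p q r ⌋     = ∨E ⌊ p ⌋ ⌊ q ⌋ ⌊ r ⌋
  ⌊ ⟶I p ⌋         = ⟶I ⌊ p ⌋
  ⌊ p $ q ⌋        = ⟶E ⌊ p ⌋ ⌊ q ⌋
  ⌊ raa p ⌋        = raa ⌊ p ⌋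
  ⌊ ∀I p ⌋         = ∀I ⌊ p ⌋
  ⌊ p ∙ t ⌋        = ∀E ⌊ p ⌋ t
  ⌊ all Θ p η ⌋    = R.all Θ ⌊ p ⌋ η
  ⌊ all₂ p s t ⌋   = R.all (_ ∷ _ ∷ []) ⌊ p ⌋ (closed ▹ s ▹ t)
  ⌊ all₃ p s t u ⌋ = R.all (_ ∷ _ ∷ _ ∷ []) ⌊ p ⌋ (closed ▹ s ▹ t ▹ u)
  ⌊ ∃I t p ⌋       = ∃I t ⌊ p ⌋
  ⌊ ∃E p q ⌋       = ∃E ⌊ p ⌋ ⌊ q ⌋
  ⌊ cut p q ⌋      = ⟶E (⟶I ⌊ q ⌋) ⌊ p ⌋
  ⌊ ⌈ p ⌉ ⌋        = p
  ⌊ ind {A} {qf} p q ⌋ = ⟶E (R.axiom (qf-ind A qf)) (∧I ⌊ p ⌋ (∀I (⟶I ⌊ q ⌋)))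
  ⌊ ≐r ⌋           = R.≐r
  ⌊ ≐s p ⌋         = R.≐s ⌊ p ⌋
  ⌊ ≐t p q ⌋       = R.≐t ⌊ p ⌋ ⌊ q ⌋
  ⌊ s ≐⟨ p ⟩ q ⌋   = R.≐t ⌊ p ⌋ ⌊ q ⌋
  ⌊ s ∎ ⌋          = R.≐r
  ⌊ Eq-arg f p ⌋   = R.Eq-arg f ⌊ p ⌋
  ⌊ derivation p ⌋ = ⌊ p ⌋≈
  ⌊ equal p ⌋≈     = ⌊ p ⌋
  ⌊ ≈-refl ⌋≈      = R.Eq-refl _ _
  ⌊ ≈-trans {s = s} {t} {u} p q ⌋≈ = R.Eq-trans {s = s} {t} {u} ⌊ p ⌋≈ ⌊ q ⌋≈
  ⌊ _⊙_ {f = f} {g} p q ⌋≈ = R.Eq-cong {f = f} {g} ⌊ p ⌋≈ ⌊ q ⌋≈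

  pattern h0 = assume 0
  pattern h1 = assume 1
  pattern h2 = assume 2
  pattern h3 = assume 3
  pattern h4 = assume 4
  pattern h5 = assume 5
  pattern h6 = assume 6
  pattern h7 = assume 7
  pattern h8 = assume 8
  pattern h9 = assume 9
  pattern h10 = assume 10

  Valid : (Γ : Ctx) → Fm C Γ → Set
  Valid Γ A = ∀ {Γ′} {Δ : List (Fm C Γ′)} → Δ ⊩ sub closed (∀* Γ A)

  -- Lemmas about arbitrary terms are proved for variables, as closed formulas, and instantiated by
  -- this rule. On variables all substitutions compute; with an abstract term `t`, the weakened
  -- `wkT t` is stuck and each step would need the laws of substitution.
  inst : ∀ {Γ} {A : Fm C Γ} → Valid Γ A → ∀ {Γ′} {Δ : List (Fm C Γ′)} (θ : Sub C Γ Γ′) → Δ ⊩ sub θ A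
  inst {[]}    {A} p {Δ = Δ} θ = subst (Δ ⊩_) (sub-cong (λ ()) A) p
  inst {τ ∷ Γ} {A} p {Δ = Δ} θ =
    subst (Δ ⊩_) (trans (sub-∘ _ _ A) (sub-cong (λ
      { (here refl) → refl
      ; (there x) → subT-single-wkT _ (θ (there x)) }) A))
      (inst {Γ} {∀̇ τ A} p (λ x → θ (there x)) ∙ θ (here refl))

  generalise : ∀ Θ {Γ} {Δ : List (Fm C Γ)} {A : Fm C (Θ ++ Γ)} → wks Θ Δ ⊩ A → Δ ⊩ alls Θ A
  generalise []      p = p
  generalise (σ ∷ Θ) p = generalise Θ (∀I p)

  weaken : ∀ {Γ} {Δ : List (Fm C Γ)} {A B} → Δ ⊩ A → B ∷ Δ ⊩ A
  weaken p = ⌈ R.weaken ⌊ p ⌋ ⌉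

  ⊥E : ∀ {Γ} {Δ : List (Fm C Γ)} {A} → Δ ⊩ ⊥̇ → Δ ⊩ A
  ⊥E p = cut p (raa h1)

  em : ∀ {Γ} {Δ : List (Fm C Γ)} A → Δ ⊩ A ∨ ¬̇ A
  em A = raa (h0 $ ∨I₂ (⟶I (h1 $ ∨I₁ h0)))

  R₀-cong : ∀ {Γ} {Δ : List (Fm C Γ)} {m n s t f} → Δ ⊩ m ≐ n → Δ ⊩ s ≐ t → Δ ⊩ R₀ · m · s · f ≐ R₀ · n · t · f
  R₀-cong p q = derivation (≈-refl {t = R₀} ⊙ equal p ⊙ equal q ⊙ ≈-refl)

  apply-sound : ∀ {Γ σ τ} {Δ : List (Fm C Γ)} k (f : Tm C Γ (σ ⇒ τ)) a → Δ ⊩ f · a ≈ apply k f a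
  apply-sound 0        f a = ≈-refl
  apply-sound (ℕsuc k) f a with redex f
  ... | K-redex t     = equal (axiom (K-eq t a))
  ... | S-redex t u   = ≈-trans (equal (axiom (S-eq t u a)))
                        (≈-trans (apply-sound k t a ⊙ apply-sound k u a) (apply-sound k _ _))
  ... | zero-redex t  = equal (axiom (R₀-zero t a))
  ... | suc-redex n t = ≈-trans (equal (axiom (R₀-suc n t a)))
      (≈-trans (≈-trans (≈-refl ⊙ apply-sound k _ a) (apply-sound k a _) ⊙ ≈-refl) (apply-sound k _ n))
  ... | no-redex = ≈-refl

  normalise-sound : ∀ {Γ τ} {Δ : List (Fm C Γ)} (t : Tm C Γ τ) → Δ ⊩ t ≈ normalise t
  normalise-sound (f · a) = ≈-trans (normalise-sound f ⊙ normalise-sound a) (apply-sound 200 _ _)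
  normalise-sound (var x) = ≈-refl
  normalise-sound (con c) = ≈-refl
  normalise-sound K    = ≈-refl
  normalise-sound S    = ≈-refl
  normalise-sound zero = ≈-refl
  normalise-sound suc  = ≈-refl
  normalise-sound R₀   = ≈-refl
  normalise-sound len  = ≈-refl
  normalise-sound at   = ≈-refl
  normalise-sound seg  = ≈-refl

  -- Proof by reflection: the type checker evaluates both normal forms, so `conv refl` settles
  -- recursion equations whose arguments are concrete enough.
  conv : ∀ {Γ} {Δ : List (Fm C Γ)} {s t} → normalise s ≡ normalise t → Δ ⊩ s ≐ t
  conv {Δ = Δ} {s} {t} e = ≐t (derivation (normalise-sound s))
    (≐s (subst (λ u → Δ ⊩ t ≐ u) (sym e) (derivation (normalise-sound t))))

  subT-≈ : ∀ {Γ₀ Γ τ} {Δ : List (Fm C Γ)} {θ η : Sub C Γ₀ Γ} →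
           (∀ {σ} (x : σ ∈ Γ₀) → Δ ⊩ θ x ≈ η x) → (t : Tm C Γ₀ τ) → Δ ⊩ subT θ t ≈ subT η t
  subT-≈ e (var x) = e x
  subT-≈ e (con c) = ≈-refl
  subT-≈ e (t · u) = subT-≈ e t ⊙ subT-≈ e u
  subT-≈ e K    = ≈-refl
  subT-≈ e S    = ≈-refl
  subT-≈ e zero = ≈-refl
  subT-≈ e suc  = ≈-refl
  subT-≈ e R₀   = ≈-refl
  subT-≈ e len  = ≈-refl
  subT-≈ e at   = ≈-refl
  subT-≈ e seg  = ≈-refl

  module _ {Γ} {Δ : List (Fm C Γ)} where
    single-≈ : ∀ {σ} {s t : Tm C Γ σ} → Δ ⊩ s ≈ t → ∀ {τ} (x : τ ∈ σ ∷ Γ) → Δ ⊩ single s x ≈ single t x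
    single-≈ p (here refl) = p
    single-≈ p (there x)   = ≈-refl

    ≐-cong : ∀ {σ} (b : Tm C (σ ∷ Γ) o) {s t : Tm C Γ σ} → Δ ⊩ Eq σ s t → Δ ⊩ subT (single s) b ≐ subT (single t) b
    ≐-cong b p = derivation (subT-≈ (single-≈ (equal p)) b)

    suc-cong : ∀ {s t} → Δ ⊩ s ≐ t → Δ ⊩ suc · s ≐ suc · t
    suc-cong = Eq-arg suc
    +-cong : ∀ {s t s′ t′} → Δ ⊩ s ≐ s′ → Δ ⊩ t ≐ t′ → Δ ⊩ s +̇ t ≐ s′ +̇ t′
    +-cong p q = R₀-cong q p
    ∸-cong : ∀ {s t s′ t′} → Δ ⊩ s ≐ s′ → Δ ⊩ t ≐ t′ → Δ ⊩ s ∸̇ t ≐ s′ ∸̇ t′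
    ∸-cong p q = R₀-cong q p
    pred-cong : ∀ {s t} → Δ ⊩ s ≐ t → Δ ⊩ pred s ≐ pred t
    pred-cong p = R₀-cong p ≐r
    triangle-cong : ∀ {s t} → Δ ⊩ s ≐ t → Δ ⊩ triangle s ≐ triangle t
    triangle-cong p = R₀-cong p ≐r
    pair-cong : ∀ {s t s′ t′} → Δ ⊩ s ≐ s′ → Δ ⊩ t ≐ t′ → Δ ⊩ pair s t ≐ pair s′ t′
    pair-cong p q = +-cong (triangle-cong (+-cong p q)) q

  -- Arithmetic

  ε : ∀ {Γ} → Sub C [] Γ
  ε = closed

  module _ {Γ} {Δ : List (Fm C Γ)} where
    +-identityˡ : ∀ t → Δ ⊩ zero +̇ t ≐ t
    +-identityˡ t = inst {o ∷ []} {zero +̇ v0 ≐ v0}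
      (ind (conv refl) (≐t (conv refl) (suc-cong h0))) (ε ▹ t)

    suc-+ : ∀ s t → Δ ⊩ (suc · s) +̇ t ≐ suc · (s +̇ t)
    suc-+ s t = inst {o ∷ o ∷ []} {(suc · v1) +̇ v0 ≐ suc · (v1 +̇ v0)}
      (∀I (ind (conv refl) (≐t (≐t (conv refl) (suc-cong h0)) (conv refl)))) (ε ▹ s ▹ t)

    +-suc : ∀ s t → Δ ⊩ s +̇ (suc · t) ≐ suc · (s +̇ t)
    +-suc s t = inst {o ∷ o ∷ []} {v1 +̇ (suc · v0) ≐ suc · (v1 +̇ v0)} (∀I (∀I (conv refl))) (ε ▹ s ▹ t)

    +-identityʳ : ∀ t → Δ ⊩ t +̇ zero ≐ t
    +-identityʳ t = inst {o ∷ []} {v0 +̇ zero ≐ v0} (∀I (conv refl)) (ε ▹ t)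

  module _ {Γ} {Δ : List (Fm C Γ)} where
    +-comm : ∀ s t → Δ ⊩ s +̇ t ≐ t +̇ s
    +-comm s t = inst {o ∷ o ∷ []} {v1 +̇ v0 ≐ v0 +̇ v1}
      (∀I (ind (≐t (+-identityʳ _) (≐s (+-identityˡ _)))
               (≐t (+-suc _ _) (≐t (suc-cong h0) (≐s (suc-+ _ _)))))) (ε ▹ s ▹ t)

    +-assoc : ∀ s t u → Δ ⊩ s +̇ t +̇ u ≐ s +̇ (t +̇ u)
    +-assoc s t u = inst {o ∷ o ∷ o ∷ []} {v2 +̇ v1 +̇ v0 ≐ v2 +̇ (v1 +̇ v0)}
      (∀I (∀I (ind (conv refl) (≐t (≐t (conv refl) (suc-cong h0)) (conv refl))))) (ε ▹ s ▹ t ▹ u)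

    +-cancelʳ : ∀ s t u → Δ ⊩ s +̇ u ≐ t +̇ u → Δ ⊩ s ≐ t
    +-cancelʳ s t u p = inst {o ∷ o ∷ o ∷ []} {v2 +̇ v0 ≐ v1 +̇ v0 ⟶ v2 ≐ v1}
      (∀I (∀I (ind (⟶I (≐t (≐s (+-identityʳ _)) (≐t h0 (+-identityʳ _))))
                   (⟶I (h1 $ (axiom (suc-inj _ _) $ ≐t (≐s (+-suc _ _)) (≐t h0 (+-suc _ _)))))))) (ε ▹ s ▹ t ▹ u) $ p

    +-cancelˡ : ∀ s t u → Δ ⊩ s +̇ t ≐ s +̇ u → Δ ⊩ t ≐ u
    +-cancelˡ s t u p = +-cancelʳ t u s (≐t (+-comm _ _) (≐t p (+-comm _ _)))

    zero-or-suc : ∀ t → Δ ⊩ t ≐ zero ∨ t ≐ suc · pred t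
    zero-or-suc t = inst {o ∷ []} {v0 ≐ zero ∨ v0 ≐ suc · pred v0}
      (ind (∨I₁ ≐r) (∨I₂ (suc-cong (conv refl)))) (ε ▹ t)

  -- Bracket abstraction does not commute with substitution: `lam (wkT (f · a))` is an `S`-term and
  -- not `K · (f · a)`. Hence `θ` stays outside of `lam` and is absorbed only by the contraction.
  β-sub : ∀ {Γ₀ Γ σ τ} {Δ : List (Fm C Γ)} (θ : Sub C Γ₀ Γ) (t : Tm C (σ ∷ Γ₀) τ) (u : Tm C Γ σ) →
          Δ ⊩ subT θ (lam t) · u ≈ subT (θ ▹ u) t
  β-sub {σ = σ} θ (var (here refl)) u = ≈-trans (equal (axiom (S-eq {σ = σ ⇒ σ} K K u))) (equal (axiom (K-eq u (K · u))))
  β-sub θ (var (there x)) u = equal (axiom (K-eq (θ x) u))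
  β-sub θ (con c) u = equal (axiom (K-eq (con c) u))
  β-sub θ (t · v) u = ≈-trans (equal (axiom (S-eq (subT θ (lam t)) (subT θ (lam v)) u))) (β-sub θ t u ⊙ β-sub θ v u)
  β-sub θ K    u = equal (axiom (K-eq K u))
  β-sub θ S    u = equal (axiom (K-eq S u))
  β-sub θ zero u = equal (axiom (K-eq zero u))
  β-sub θ suc  u = equal (axiom (K-eq suc u))
  β-sub θ R₀   u = equal (axiom (K-eq R₀ u))
  β-sub θ len  u = equal (axiom (K-eq len u))
  β-sub θ at   u = equal (axiom (K-eq at u))
  β-sub θ seg  u = equal (axiom (K-eq seg u))

  β : ∀ {Γ σ τ} {Δ : List (Fm C Γ)} (t : Tm C (σ ∷ Γ) τ) (u : Tm C Γ σ) → Δ ⊩ lam t · u ≈ subT (single u) t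
  β {Δ = Δ} t u = subst₂ (Δ ⊩_≈_) (cong (_· u) (subT-id (lam t)))
    (subT-cong (λ { (here refl) → refl ; (there x) → refl }) t) (β-sub var t u)

  β* : ∀ Θ {Γ₀ Γ τ} {Δ : List (Fm C Γ)} (θ : Sub C Γ₀ Γ) (η : Sub C Θ Γ) (t : Tm C (Θ ++ Γ₀) τ) →
       Δ ⊩ apps Θ (subT θ (lams Θ t)) η ≈ subT (extend Θ θ η) t
  β* []      θ η t = ≈-refl
  β* (σ ∷ Θ) θ η t = ≈-trans (β* Θ θ (λ x → η (there x)) (lam t) ⊙ ≈-refl)
                             (β-sub (extend Θ θ (λ x → η (there x))) t (η (here refl)))

  -- Explicit definitions. Introducing a variable with a defining equation, instead of substituting the
  -- combinator term for it, keeps later bracket abstractions small.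
  define : ∀ Θ {Γ} {Δ : List (Fm C Γ)} {D : Fm C Γ} (t : Tm C (Θ ++ Γ) o) →
           alls Θ (apps Θ (weakens Θ v0) (locals Θ) ≐ subT (lifts Θ shift) t) ∷ map wk Δ ⊩ wk D → Δ ⊩ D
  define Θ {Γ} {Δ} t = ∃E (∃I f (subst (Δ ⊩_) (sym (sub-alls Θ _ _)) (generalise Θ
    (subst₂ (λ u v → wks Θ Δ ⊩ u ≐ v)
      (trans (apps-cong Θ (sym (weakens-subT Θ f)) (λ x → sym (lifts-locals Θ (single f) x)))
             (trans (cong (λ u → apps Θ u (λ x → subT (lifts Θ (single f)) (locals Θ x))) (sym (lifts-weakens Θ (single f) v0)))
                    (sym (subT-apps Θ (lifts Θ (single f)) (weakens Θ v0) (locals Θ)))))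
      (trans (trans (subT-cong (extend-locals Θ) t) (subT-id t))
             (sym (trans (subT-∘ _ _ t) (trans (subT-cong (lifts-single-shift Θ f) t) (subT-id t)))))
      (derivation (β* Θ (λ x → weakens Θ (var x)) (locals Θ) t))))))
    where f = lams Θ t

  private variable
    Δ : List (Fm C Γ)

  num-cases : ∀ {A} t → t ≐ zero ∷ Δ ⊩ A → t ≐ suc · pred t ∷ Δ ⊩ A → Δ ⊩ A
  num-cases t p q = ∨E (zero-or-suc t) p q

  absurd : ∀ {t A} → Δ ⊩ suc · t ≐ zero → Δ ⊩ A
  absurd p = ⊥E (axiom (suc≢0 _) $ p)

  ∸-zero : ∀ t → Δ ⊩ t ∸̇ zero ≐ t
  ∸-zero t = inst {o ∷ []} {v0 ∸̇ zero ≐ v0} (∀I (conv refl)) (ε ▹ t)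

  ∸-suc : ∀ s t → Δ ⊩ s ∸̇ (suc · t) ≐ pred (s ∸̇ t)
  ∸-suc s t = inst {o ∷ o ∷ []} {v1 ∸̇ (suc · v0) ≐ pred (v1 ∸̇ v0)} (∀I (∀I (conv refl))) (ε ▹ s ▹ t)

  suc-∸-suc : ∀ s t → Δ ⊩ (suc · s) ∸̇ (suc · t) ≐ s ∸̇ t
  suc-∸-suc s t = inst {o ∷ o ∷ []} {(suc · v1) ∸̇ (suc · v0) ≐ v1 ∸̇ v0}
    (∀I (ind (conv refl) (≐t (≐t (conv refl) (pred-cong h0)) (conv refl)))) (ε ▹ s ▹ t)

  +-∸ : ∀ s t → Δ ⊩ s +̇ t ∸̇ t ≐ s
  +-∸ s t = inst {o ∷ o ∷ []} {v1 +̇ v0 ∸̇ v0 ≐ v1}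
    (∀I (ind (conv refl) (≐t (≐t (∸-cong (+-suc _ _) ≐r) (suc-∸-suc _ _)) h0))) (ε ▹ s ▹ t)

  suc-+-comm : ∀ s t → Δ ⊩ s +̇ (suc · t) ≐ (suc · s) +̇ t
  suc-+-comm s t = ≐t (+-suc _ _) (≐s (suc-+ _ _))

  +-∸ˡ : ∀ s t → Δ ⊩ s +̇ t ∸̇ s ≐ t
  +-∸ˡ s t = ≐t (∸-cong (+-comm _ _) ≐r) (+-∸ _ _)

  ∸-+ : ∀ s t → Δ ⊩ s ∸̇ (s +̇ t) ≐ zero
  ∸-+ s t = inst {o ∷ o ∷ []} {v1 ∸̇ (v1 +̇ v0) ≐ zero}
    (∀I (ind (≐t (∸-cong (≐s (+-identityˡ _)) (+-identityʳ _)) (+-∸ _ _))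
             (≐t (∸-cong ≐r (+-suc _ _)) (≐t (∸-suc _ _) (≐t (pred-cong h0) (conv refl)))))) (ε ▹ s ▹ t)

  -- The difference is a term because an existential quantifier would be out of reach of
  -- quantifier-free induction. `≤-elim` and the linearity of the order rest on this.
  ∸-total : ∀ s t → Δ ⊩ s ≐ t +̇ (s ∸̇ t) ∨ t ≐ s +̇ (t ∸̇ s)
  ∸-total s t = inst {o ∷ o ∷ []} {v1 ≐ v0 +̇ (v1 ∸̇ v0) ∨ v0 ≐ v1 +̇ (v0 ∸̇ v1)}
    (∀I (ind (∨I₁ (≐t (≐s (∸-zero _)) (≐s (+-identityˡ _))))
      (∨E h0
        -- Either both numbers are equal and the order is reversed by the successor, or one unit
        -- passes from the difference to `t`.
        (num-cases (v1 ∸̇ v0)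
          (∨I₂ (larger (≐t h1 (+-cong ≐r h0))))
          (∨I₁ (≐t h1 (≐t (+-cong ≐r h0) (≐t (suc-+-comm _ _) (+-cong ≐r (≐s (∸-suc _ _))))))))
        (∨I₂ (below h0))))) (ε ▹ s ▹ t)
    where
    below : ∀ {Γ} {Δ : List (Fm C Γ)} {s t u} → Δ ⊩ t ≐ s +̇ u → Δ ⊩ suc · t ≐ s +̇ ((suc · t) ∸̇ s)
    below p = ≐t q (+-cong ≐r (≐s (≐t (∸-cong q ≐r) (+-∸ˡ _ _))))
      where q = ≐t (suc-cong p) (≐s (+-suc _ _))
    larger : ∀ {Γ} {Δ : List (Fm C Γ)} {s t} → Δ ⊩ s ≐ t +̇ zero → Δ ⊩ suc · t ≐ s +̇ ((suc · t) ∸̇ s)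
    larger p = below (≐t (≐s (+-identityʳ _)) (≐t (≐s p) (≐s (+-identityʳ _))))

  ≤-intro : ∀ {s t} u → Δ ⊩ t ≐ s +̇ u → Δ ⊩ s ≤̇ t
  ≤-intro u p = ≐t (∸-cong ≐r p) (∸-+ _ _)

  ≤-elim : ∀ {s t} → Δ ⊩ s ≤̇ t → Δ ⊩ t ≐ s +̇ (t ∸̇ s)
  ≤-elim {s = s} {t} p = inst {o ∷ o ∷ []} {v1 ≤̇ v0 ⟶ v0 ≐ v1 +̇ (v0 ∸̇ v1)}
    (∀I (∀I (⟶I (∨E (∸-total v1 v0)
      (cut (≐t h0 (≐t (+-cong ≐r h1) (+-identityʳ _)))
        (≐t (≐t (≐s h0) (≐s (+-identityʳ _)))
          (+-cong ≐r (≐s (≐t (∸-cong (≐t (≐s h0) (≐s (+-identityˡ _))) ≐r) (+-∸ _ _))))))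
      h0)))) (ε ▹ s ▹ t) $ p

  ≤-refl : ∀ {s} → Δ ⊩ s ≤̇ s
  ≤-refl = ≤-intro zero (≐s (+-identityʳ _))

  ≤-trans : ∀ {s t u} → Δ ⊩ s ≤̇ t → Δ ⊩ t ≤̇ u → Δ ⊩ s ≤̇ u
  ≤-trans p q = ≤-intro _ (≐t (≤-elim q) (≐t (+-cong (≤-elim p) ≐r) (+-assoc _ _ _)))

  ≤-resp : ∀ {s t s′ t′} → Δ ⊩ s ≐ s′ → Δ ⊩ t ≐ t′ → Δ ⊩ s ≤̇ t → Δ ⊩ s′ ≤̇ t′
  ≤-resp p q r = ≐t (≐s (∸-cong p q)) r

  <-resp : ∀ {s t s′ t′} → Δ ⊩ s ≐ s′ → Δ ⊩ t ≐ t′ → Δ ⊩ s <̇ t → Δ ⊩ s′ <̇ t′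
  <-resp p = ≤-resp (suc-cong p)

  suc-mono : ∀ {s t} → Δ ⊩ s ≤̇ t → Δ ⊩ s <̇ suc · t
  suc-mono p = ≐t (suc-∸-suc _ _) p

  suc-mono⁻¹ : ∀ {s t} → Δ ⊩ s <̇ suc · t → Δ ⊩ s ≤̇ t
  suc-mono⁻¹ p = ≐t (≐s (suc-∸-suc _ _)) p

  m≤m+n : ∀ {s t} → Δ ⊩ s ≤̇ s +̇ t
  m≤m+n = ≤-intro _ ≐r

  m≤n+m : ∀ {s t} → Δ ⊩ s ≤̇ t +̇ s
  m≤n+m = ≤-intro _ (+-comm _ _)

  <⇒≤ : ∀ {s t} → Δ ⊩ s <̇ t → Δ ⊩ s ≤̇ t
  <⇒≤ {s = s} p = ≤-trans (≤-intro (suc · zero) (≐t (suc-cong (≐s (+-identityʳ _))) (≐s (+-suc s zero)))) p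

  ≮zero : ∀ {s A} → Δ ⊩ s <̇ zero → Δ ⊩ A
  ≮zero p = absurd (≐t (≐s (∸-zero _)) p)

  z≤ : ∀ {s} → Δ ⊩ zero ≤̇ s
  z≤ = ≤-intro _ (≐s (+-identityˡ _))

  ≤-cases : ∀ {s t} → Δ ⊩ s ≤̇ t → Δ ⊩ s <̇ t ∨ s ≐ t
  ≤-cases {s = s} {t} p = inst {o ∷ o ∷ []} {v1 ≤̇ v0 ⟶ v1 <̇ v0 ∨ v1 ≐ v0}
    (∀I (∀I (⟶I (num-cases (v0 ∸̇ v1)
       (∨I₂ (≐s (≐t (≤-elim h1) (≐t (+-cong ≐r h0) (+-identityʳ _)))))
       (∨I₁ (≤-intro _ (≐t (≤-elim h1) (≐t (+-cong ≐r h0) (suc-+-comm _ _))))))))) (ε ▹ s ▹ t) $ p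

  <-or-≥ : ∀ s t → Δ ⊩ s <̇ t ∨ t ≤̇ s
  <-or-≥ s t = inst {o ∷ o ∷ []} {v1 <̇ v0 ∨ v0 ≤̇ v1}
    (∀I (∀I (∨E (∸-total v1 v0) (∨I₂ (≤-intro _ h0))
      (∨E (≤-cases (≤-intro _ h0)) (∨I₁ h0) (∨I₂ (≤-resp h0 ≐r ≤-refl)))))) (ε ▹ s ▹ t)

  ifz-zero : ∀ {x a b} → Δ ⊩ x ≐ zero → Δ ⊩ ifz x a b ≐ a
  ifz-zero p = ≐t (R₀-cong p ≐r) (axiom (R₀-zero _ _))

  ifz-suc : ∀ {x y a b} → Δ ⊩ x ≐ suc · y → Δ ⊩ ifz x a b ≐ b
  ifz-suc {x = x} {y} {a} {b} p = inst {o ∷ o ∷ o ∷ o ∷ []} {v3 ≐ suc · v2 ⟶ ifz v3 v1 v0 ≐ v0}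
    (∀I (∀I (∀I (∀I (⟶I (≐t (R₀-cong h0 ≐r) (conv refl))))))) (ε ▹ x ▹ y ▹ a ▹ b) $ p

  nonzero : ∀ {x} → Δ ⊩ ¬̇ (x ≐ zero) → Δ ⊩ x ≐ suc · pred x
  nonzero {x = x} p = inst {o ∷ []} {¬̇ (v0 ≐ zero) ⟶ v0 ≐ suc · pred v0}
    (∀I (⟶I (num-cases v0 (⊥E (h1 $ h0)) h0))) (ε ▹ x) $ p

  ifz-nonzero : ∀ {x a b} → Δ ⊩ ¬̇ (x ≐ zero) → Δ ⊩ ifz x a b ≐ b
  ifz-nonzero p = ifz-suc (nonzero p)

  ≐-dec : ∀ s t → Δ ⊩ s ≐ t ∨ ¬̇ (s ≐ t)
  ≐-dec s t = em (s ≐ t)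

  not-zero : ∀ {x} → Δ ⊩ ¬̇ (x ≐ zero) → Δ ⊩ not x ≐ zero
  not-zero = ifz-nonzero

  not-zero⁻¹ : ∀ {x} → Δ ⊩ not x ≐ zero → Δ ⊩ ¬̇ (x ≐ zero)
  not-zero⁻¹ {x = x} p = inst {o ∷ []} {not v0 ≐ zero ⟶ ¬̇ (v0 ≐ zero)}
    (∀I (⟶I (⟶I (absurd (≐t (≐s (ifz-zero h0)) h1))))) (ε ▹ x) $ p

  +-zeroˡ : ∀ {s t} → Δ ⊩ s +̇ t ≐ zero → Δ ⊩ s ≐ zero
  +-zeroˡ {s = s} {t} p = inst {o ∷ o ∷ []} {v1 +̇ v0 ≐ zero ⟶ v1 ≐ zero}
    (∀I (∀I (⟶I (num-cases v1 h0 (absurd (≐t (≐s (suc-+ _ _)) (≐t (+-cong (≐s h0) ≐r) h1))))))) (ε ▹ s ▹ t) $ p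

  +-zeroʳ : ∀ {s t} → Δ ⊩ s +̇ t ≐ zero → Δ ⊩ t ≐ zero
  +-zeroʳ p = +-zeroˡ (≐t (+-comm _ _) p)

  +-zero : ∀ {s t} → Δ ⊩ s ≐ zero → Δ ⊩ t ≐ zero → Δ ⊩ s +̇ t ≐ zero
  +-zero p q = ≐t (+-cong p q) (+-identityʳ _)

  ∸-self : ∀ {s t} → Δ ⊩ s ≐ t → Δ ⊩ s ∸̇ t ≐ zero
  ∸-self p = ≤-resp ≐r p ≤-refl

  ≤-antisym : ∀ {s t} → Δ ⊩ s ≤̇ t → Δ ⊩ t ≤̇ s → Δ ⊩ s ≐ t
  ≤-antisym p q = ≐s (≐t (≤-elim p) (≐t (+-cong ≐r q) (+-identityʳ _)))

  distance-zero : ∀ {s t} → Δ ⊩ s ≐ t → Δ ⊩ distance s t ≐ zero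
  distance-zero p = +-zero (∸-self p) (∸-self (≐s p))

  distance-zero⁻¹ : ∀ {s t} → Δ ⊩ distance s t ≐ zero → Δ ⊩ s ≐ t
  distance-zero⁻¹ p = ≤-antisym (+-zeroˡ p) (+-zeroʳ p)

  <-suc-cases : ∀ {s t} → Δ ⊩ s <̇ suc · t → Δ ⊩ s <̇ t ∨ s ≐ t
  <-suc-cases p = ≤-cases (suc-mono⁻¹ p)

  search-finds : ∀ {g i n} → Δ ⊩ i <̇ n → Δ ⊩ g · i ≐ zero → Δ ⊩ g · (search · g · n) ≐ zero
  search-finds {g = g} {i} {n} p q = inst {o ∷ o ∷ 𝟏 ∷ []} {v1 <̇ v0 ⟶ v2 · v1 ≐ zero ⟶ v2 · (search · v2 · v0) ≐ zero}
    (∀I (∀I (ind (⟶I (≮zero h0))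
      (⟶I (⟶I (≐t (≐-cong (v3 · v0) next-search)
        (num-cases (v2 · (search · v2 · v0))
          (≐t (≐-cong (v3 · v0) (ifz-zero h0)) h0)
          (≐t (≐-cong (v3 · v0) (ifz-suc h0))
            (∨E (<-suc-cases h2)
              (absurd (≐t (≐s h1) (h4 $ h0 $ h2)))
              (≐t (≐-cong (v3 · v0) (≐s h0)) h2))))))))))
    (ε ▹ g ▹ i ▹ n) $ p $ q
    where
    next-search : ∀ {Γ} {Δ : List (Fm C (o ∷ o ∷ 𝟏 ∷ Γ))} → let n = v0 ; g = v2 in
      Δ ⊩ search · g · (suc · n) ≐ ifz (g · (search · g · n)) (search · g · n) n
    next-search = conv refl

  -- Codes of finite sequences

  triangle-suc : ∀ t → Δ ⊩ triangle (suc · t) ≐ triangle t +̇ (suc · t)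
  triangle-suc t = inst {o ∷ []} {triangle (suc · v0) ≐ triangle v0 +̇ (suc · v0)} (∀I (conv refl)) (ε ▹ t)

  triangle-mono : ∀ {s t} → Δ ⊩ s <̇ t → Δ ⊩ triangle s +̇ (suc · s) ≤̇ triangle t
  triangle-mono {s = s} {t} p = ≤-resp ≐r (triangle-cong (≐s (≤-elim p)))
    (inst {o ∷ o ∷ []} {triangle v1 +̇ (suc · v1) ≤̇ triangle ((suc · v1) +̇ v0)}
      (∀I (ind (≤-resp ≐r (≐t (≐s (triangle-suc _)) (triangle-cong (≐s (+-identityʳ _)))) ≤-refl)
        (≤-trans h0 (≤-resp ≐r (≐t (≐s (triangle-suc _)) (triangle-cong (≐s (+-suc _ _)))) m≤m+n))))
      (ε ▹ s ▹ (t ∸̇ (suc · s))))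

  -- a + b is determined by pair a b since triangle s ≤ pair a b < triangle (s + 1) for s = a + b.
  pair-< : ∀ {a b c d} → Δ ⊩ pair a b ≐ pair c d → Δ ⊩ c +̇ d ≤̇ a +̇ b
  pair-< {a = a} {b} {c} {d} p = inst {o ∷ o ∷ o ∷ o ∷ []} {pair v3 v2 ≐ pair v1 v0 ⟶ v1 +̇ v0 ≤̇ v3 +̇ v2}
    (∀I (∀I (∀I (∀I (⟶I (∨E (<-or-≥ (v3 +̇ v2) (v1 +̇ v0))
      (≮self (≤-resp
         (+-suc (triangle (v3 +̇ v2)) (v3 +̇ v2))
         (≐s h1)
         (≤-trans (triangle-mono h0) m≤m+n)))
      h0)))))) (ε ▹ a ▹ b ▹ c ▹ d) $ p
    where
    ≮self : ∀ {Γ} {Δ : List (Fm C Γ)} {s a b A} → Δ ⊩ suc · (s +̇ (a +̇ b)) ≤̇ s +̇ b → Δ ⊩ A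
    ≮self {s = s} {a} {b} p = absurd (+-cancelʳ (suc · a) zero b (≐t (suc-+ a b)
       (≐t (≤-antisym (≤-cancel (≤-resp (≐s (+-suc s (a +̇ b))) ≐r p)) (≤-trans m≤n+m (<⇒≤ ≤-refl))) (≐s (+-identityˡ b)))))
      where
      ≤-cancel : ∀ {Γ} {Δ : List (Fm C Γ)} {s t u} → Δ ⊩ s +̇ t ≤̇ s +̇ u → Δ ⊩ t ≤̇ u
      ≤-cancel p = ≤-intro _ (+-cancelˡ _ _ _ (≐t (≤-elim p) (+-assoc _ _ _)))

  pair-injective : ∀ {a b c d} → Δ ⊩ pair a b ≐ pair c d ⟶ a ≐ c ∧ b ≐ d
  pair-injective {a = a} {b} {c} {d} = inst {o ∷ o ∷ o ∷ o ∷ []} {pair v3 v2 ≐ pair v1 v0 ⟶ v3 ≐ v1 ∧ v2 ≐ v0}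
    (∀I (∀I (∀I (∀I (⟶I (cut (≤-antisym (pair-< (≐s h0)) (pair-< h0))
      (cut (+-cancelˡ _ _ _ (≐t (+-cong (triangle-cong (≐s h0)) ≐r) h1))
        (∧I (+-cancelʳ _ _ _ (≐t h1 (+-cong ≐r (≐s h0)))) h0)))))))) (ε ▹ a ▹ b ▹ c ▹ d)

  ≤-triangle : ∀ {t} → Δ ⊩ t ≤̇ triangle t
  ≤-triangle {t = t} = inst {o ∷ []} {v0 ≤̇ triangle v0}
    (∀I (num-cases v0 (≤-resp (≐s h0) ≐r z≤)
      (≤-resp ≐r (≐t (≐s (triangle-suc _)) (triangle-cong (≐s h0))) (≤-resp (≐s h0) ≐r m≤n+m)))) (ε ▹ t)

  ≤-pair : ∀ {a b} → Δ ⊩ a ≤̇ pair a b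
  ≤-pair = ≤-trans (≤-trans m≤m+n ≤-triangle) m≤m+n

  -- Extensionality would ask for agreement everywhere, but the entries of `seg · β · n` beyond `n`
  -- are unspecified. The induction therefore carries the bound `v0 ≤̇ v1`.
  R₀-ext : ∀ {n f g} → Δ ⊩ ∀̇ o (∀̇ o (v0 <̇ wkT (wkT n) ⟶ wkT (wkT f) · v1 · v0 ≐ wkT (wkT g) · v1 · v0)) →
           Δ ⊩ R₀ · n · zero · f ≐ R₀ · n · zero · g
  R₀-ext {n = n} {f} {g} p = inst {o ∷ (o ⇒ o ⇒ o) ∷ (o ⇒ o ⇒ o) ∷ []}
    {∀̇ o (∀̇ o (v0 <̇ v2 ⟶ v4 · v1 · v0 ≐ v3 · v1 · v0)) ⟶ R₀ · v0 · zero · v2 ≐ R₀ · v0 · zero · v1}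
    (∀I (∀I (∀I (⟶I
      (ind {A = v0 ≤̇ v1 ⟶ R₀ · v0 · zero · v3 ≐ R₀ · v0 · zero · v2}
        (⟶I (≐t (axiom (R₀-zero _ _)) (≐s (axiom (R₀-zero _ _)))))
        (⟶I (≐t (axiom (R₀-suc _ _ _)) (≐t (≐-cong (v4 · v0 · v1) (h1 $ <⇒≤ h0))
          (≐t (h2 ∙ (R₀ · v0 · zero · v2) ∙ v0 $ h0) (≐s (axiom (R₀-suc _ _ _)))))))
       ∙ v0 $ ≤-refl))))) (ε ▹ f ▹ g ▹ n) $ p

  -- Spelled as contraction leaves it when `code` is applied to `s`, so that `code-rec` is a single
  -- use of `β`.
  code-step : Tm C Γ (o *) → Tm C Γ (o ⇒ o ⇒ o)
  code-step s = subT (single s) (lam (lam (suc · pair v1 (at · v2 · v0))))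

  initSeg-step : Tm C Γ 𝟏 → Tm C Γ (o ⇒ o ⇒ o)
  initSeg-step β = subT (single β) (lam (lam (suc · pair v1 (v2 · v0))))

  code-rec : ∀ {s} → Δ ⊩ code · s ≐ R₀ · (len · s) · zero · code-step s
  code-rec {s = s} = derivation (β (R₀ · (len · v0) · zero · lam (lam (suc · pair v1 (at · v2 · v0)))) s)

  code-step-eq : ∀ {s r i} → Δ ⊩ code-step s · r · i ≐ suc · pair r (at · s · i)
  code-step-eq {s = s} {r} {i} = derivation (≈-trans (β-sub (single s) (lam (suc · pair v1 (at · v2 · v0))) r ⊙ ≈-refl)
    (β-sub (single s ▹ r) (suc · pair v1 (at · v2 · v0)) i))

  initSeg-step-eq : ∀ {β r i} → Δ ⊩ initSeg-step β · r · i ≐ suc · pair r (β · i)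
  initSeg-step-eq {β = b} {r} {i} = derivation (≈-trans (β-sub (single b) (lam (suc · pair v1 (v2 · v0))) r ⊙ ≈-refl)
    (β-sub (single b ▹ r) (suc · pair v1 (v2 · v0)) i))

  code-step-seg : ∀ {β n} → Δ ⊩ R₀ · n · zero · code-step (seg · β · n) ≐ R₀ · n · zero · initSeg-step β
  code-step-seg {β = β} {n} = inst {o ∷ 𝟏 ∷ []} {R₀ · v0 · zero · code-step (seg · v1 · v0) ≐ R₀ · v0 · zero · initSeg-step v1}
    (∀I (∀I (R₀-ext (∀I (∀I (⟶I (≐t (code-step-eq {s = seg · v3 · v2} {v1} {v0})
      (≐t (suc-cong (pair-cong ≐r (axiom (at-seg _ _ _) $ h0))) (≐s (initSeg-step-eq {β = v3} {v1} {v0})))))))))) (ε ▹ β ▹ n)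

  code-step-at : ∀ {s n} → Δ ⊩ R₀ · n · zero · code-step s ≐ R₀ · n · zero · initSeg-step (at · s)
  code-step-at {s = s} {n} = inst {o ∷ (o *) ∷ []} {R₀ · v0 · zero · code-step v1 ≐ R₀ · v0 · zero · initSeg-step (at · v1)}
    (∀I (∀I (R₀-ext (∀I (∀I (⟶I (≐t (code-step-eq {s = v3} {v1} {v0}) (≐s (initSeg-step-eq {β = at · v3} {v1} {v0})))))))))
    (ε ▹ s ▹ n)

  initSeg-rec : ∀ {β n} → Δ ⊩ initSeg β n ≐ R₀ · n · zero · initSeg-step β
  initSeg-rec {β = β} {n} = ≐t code-rec (≐t (R₀-cong (axiom (len-seg β n)) ≐r) code-step-seg)

  code-at : ∀ {s} → Δ ⊩ code · s ≐ initSeg (at · s) (len · s)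
  code-at {s = s} = ≐t code-rec (≐t (code-step-at {s = s}) (≐s initSeg-rec))

  pairing-eq : ∀ {a b} → Δ ⊩ pairing · a · b ≐ pair a b
  pairing-eq {a = a} {b} = derivation (≈-trans (β (lam (pair v1 v0)) a ⊙ ≈-refl) (β-sub (single a) (pair v1 v0) b))

  pairing-pairs : Δ ⊩ Pairing pairing
  pairing-pairs = ∧I
    (∀I (∀I (∀I (∀I (⟶I (pair-injective $ ≐t (≐s (pairing-eq {a = v3} {v2})) (≐t h0 (pairing-eq {a = v1} {v0}))))))))
    (∀I (∀I (≤-resp ≐r (≐s (pairing-eq {a = v1} {v0})) (≤-pair {a = v1} {v0}))))

  -- The term code is large; this is the only place where it has to be unfolded.
  code-closed : ∀ Γ σ → wkT {C} {Γ} {σ} (code {C} {Γ}) ≡ code {C} {σ ∷ Γ}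
  code-closed Γ σ = refl

  code-closed² : ∀ Γ ρ σ → wkT {C} {ρ ∷ Γ} {σ} (wkT {C} {Γ} {ρ} (code {C} {Γ})) ≡ code {C} {σ ∷ ρ ∷ Γ}
  code-closed² Γ ρ σ = trans (cong (wkT {C} {ρ ∷ Γ} {σ}) (code-closed Γ ρ)) (code-closed (ρ ∷ Γ) σ)

  prefix-code-zero : ∀ {c : Tm C Γ 𝐂} {β} → c ≡ code {C} {Γ} → Δ ⊩ prefix c β zero ≐ zero
  prefix-code-zero {β = β} refl = ≐t initSeg-rec (axiom (R₀-zero zero (initSeg-step β)))

  prefix-code-suc : ∀ {c : Tm C Γ 𝐂} {β n} → c ≡ code {C} {Γ} → Δ ⊩ prefix c β (suc · n) ≐ suc · (pairing · prefix c β n · (β · n))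
  prefix-code-suc {β = b} {n} refl = ≐t initSeg-rec (≐t (axiom (R₀-suc n zero (initSeg-step b)))
    (≐t (initSeg-step-eq {β = b} {R₀ · n · zero · initSeg-step b} {n})
      (suc-cong (≐t (pair-cong (≐s initSeg-rec) ≐r) (≐s (pairing-eq {a = initSeg b n} {b · n}))))))

  code-as-prefix : ∀ {c : Tm C Γ 𝐂} {s} → c ≡ code {C} {Γ} → Δ ⊩ c · s ≐ prefix c (at · s) (len · s)
  code-as-prefix {s = s} refl = code-at {s = s}

  code-codes : ∀ {Δ : List (Fm C Γ)} → Δ ⊩ Coding code pairing
  code-codes {Γ} = ∧I (∀I (prefix-code-zero {c = wkT code} (code-closed Γ 𝟏)))
    (∧I (∀I (∀I (prefix-code-suc {c = wkT (wkT code)} (code-closed² Γ 𝟏 o))))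
    (∧I (∀I (code-as-prefix {c = wkT code} (code-closed Γ (o *)))) pairing-pairs))

  -- The two segments are equal as sequences, and any functional `c` respects this.
  prefix-ext : ∀ {c β γ n} → Δ ⊩ ∀̇ o (v0 <̇ wkT n ⟶ wkT β · v0 ≐ wkT γ · v0) → Δ ⊩ prefix c β n ≐ prefix c γ n
  prefix-ext {c = c} {β} {γ} {n} q = inst {o ∷ 𝟏 ∷ 𝟏 ∷ 𝐂 ∷ []}
    {∀̇ o (v0 <̇ v1 ⟶ v3 · v0 ≐ v2 · v0) ⟶ prefix v3 v2 v0 ≐ prefix v3 v1 v0}
    (∀I (∀I (∀I (∀I (⟶I (Eq-arg v3 (∧I (≐t (axiom (len-seg v2 v0)) (≐s (axiom (len-seg v1 v0))))
      (∧E₂ (axiom (∀<-def _ _)) $ ∀I (⟶I (cut (<-resp ≐r (axiom (len-seg v3 v1)) h0)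
        (≐t (axiom (at-seg _ _ _) $ h0) (≐t (h2 ∙ v0 $ h0) (≐s (axiom (at-seg _ _ _) $ h0))))))))))))))
    (ε ▹ c ▹ β ▹ γ ▹ n) $ q

  module _ {c : Tm C Γ 𝐂} {p : Tm C Γ 𝐏} (H : Δ ⊩ Coding c p) where

    prefix-zero : ∀ β → Δ ⊩ prefix c β zero ≐ zero
    prefix-zero β = inst {𝟏 ∷ 𝐏 ∷ 𝐂 ∷ []} {Coding v2 v1 ⟶ prefix v2 v0 zero ≐ zero}
      (∀I (∀I (∀I (⟶I (∧E₁ h0 ∙ v0))))) (ε ▹ c ▹ p ▹ β) $ H

    prefix-suc : ∀ β n → Δ ⊩ prefix c β (suc · n) ≐ suc · (p · prefix c β n · (β · n))
    prefix-suc β n = inst {o ∷ 𝟏 ∷ 𝐏 ∷ 𝐂 ∷ []} {Coding v3 v2 ⟶ prefix v3 v1 (suc · v0) ≐ suc · (v2 · prefix v3 v1 v0 · (v1 · v0))}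
      (∀I (∀I (∀I (∀I (⟶I (∧E₁ (∧E₂ h0) ∙ v1 ∙ v0)))))) (ε ▹ c ▹ p ▹ β ▹ n) $ H

    code-prefix : ∀ s → Δ ⊩ c · s ≐ prefix c (at · s) (len · s)
    code-prefix s = inst {(o *) ∷ 𝐏 ∷ 𝐂 ∷ []} {Coding v2 v1 ⟶ v2 · v0 ≐ prefix v2 (at · v0) (len · v0)}
      (∀I (∀I (∀I (⟶I (∧E₁ (∧E₂ (∧E₂ h0)) ∙ v0))))) (ε ▹ c ▹ p ▹ s) $ H

  pairing-inj : ∀ {p a b c d} → Δ ⊩ Pairing p → Δ ⊩ p · a · b ≐ p · c · d → Δ ⊩ a ≐ c ∧ b ≐ d
  pairing-inj {p = p} {a} {b} {c} {d} P q = inst {o ∷ o ∷ o ∷ o ∷ 𝐏 ∷ []} {Pairing v4 ⟶ v4 · v3 · v2 ≐ v4 · v1 · v0 ⟶ v3 ≐ v1 ∧ v2 ≐ v0}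
    (∀I (∀I (∀I (∀I (∀I (⟶I (∧E₁ h0 ∙ v3 ∙ v2 ∙ v1 ∙ v0))))))) (ε ▹ p ▹ a ▹ b ▹ c ▹ d) $ P $ q

  coding-pairing : ∀ {c p} → Δ ⊩ Coding c p → Δ ⊩ Pairing p
  coding-pairing H = ∧E₂ (∧E₂ (∧E₂ H))

  prefix-inj : ∀ {c p β γ m n} → Δ ⊩ Coding c p → Δ ⊩ prefix c β (suc · m) ≐ prefix c γ (suc · n) →
               Δ ⊩ prefix c β m ≐ prefix c γ n ∧ β · m ≐ γ · n
  prefix-inj {c = c} {p} H q = pairing-inj {p = p} (coding-pairing {c = c} {p} H)
    (axiom (suc-inj _ _) $ ≐t (≐s (prefix-suc {c = c} {p} H _ _)) (≐t q (prefix-suc {c = c} {p} H _ _)))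

  -- Every further entry increases the code, by the successor together with the bound in `Pairing`.
  ≤-prefix : ∀ {c p β n} → Δ ⊩ Coding c p → Δ ⊩ n ≤̇ prefix c β n
  ≤-prefix {c = c} {p} {β} {n} H = inst {o ∷ 𝟏 ∷ 𝐏 ∷ 𝐂 ∷ []} {Coding v3 v2 ⟶ v0 ≤̇ prefix v3 v1 v0}
    (∀I (∀I (∀I (∀I (⟶I (ind {A = v0 ≤̇ prefix v4 v2 v0} z≤
      (≤-trans (suc-mono (≤-trans h0 (∧E₂ (coding-pairing {c = v4} {v3} h1) ∙ prefix v4 v2 v0 ∙ (v2 · v0))))
        (≤-resp ≐r (≐s (prefix-suc {c = v4} {v3} h1 v2 v0)) ≤-refl)) ∙ v0)))))) (ε ▹ c ▹ p ▹ β ▹ n) $ H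

  prefix-strip : ∀ {c p β γ m n} k → Δ ⊩ Coding c p → Δ ⊩ prefix c β (m +̇ k) ≐ prefix c γ (n +̇ k) →
                 Δ ⊩ prefix c β m ≐ prefix c γ n
  prefix-strip {c = c} {p} {β} {γ} {m} {n} k H q = inst {o ∷ o ∷ o ∷ 𝟏 ∷ 𝟏 ∷ 𝐏 ∷ 𝐂 ∷ []}
    {Coding v6 v5 ⟶ prefix v6 v4 (v2 +̇ v0) ≐ prefix v6 v3 (v1 +̇ v0) ⟶ prefix v6 v4 v2 ≐ prefix v6 v3 v1}
    (∀I (∀I (∀I (∀I (∀I (∀I (∀I (⟶I (ind {A = prefix v7 v5 (v3 +̇ v0) ≐ prefix v7 v4 (v2 +̇ v0) ⟶ prefix v7 v5 v3 ≐ prefix v7 v4 v2}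
      (⟶I (≐t (prefix-≐ (≐s (+-identityʳ _))) (≐t h0 (prefix-≐ (+-identityʳ _)))))
      (⟶I (h1 $ ∧E₁ (prefix-inj {c = v7} {v6} h2 (≐t (prefix-≐ (≐s (+-suc _ _))) (≐t h0 (prefix-≐ (+-suc _ _)))))))
      ∙ v0)))))))))
    (ε ▹ c ▹ p ▹ β ▹ γ ▹ m ▹ n ▹ k) $ H $ q
    where
    prefix-≐ : ∀ {Γ} {Δ : List (Fm C Γ)} {c β m n} → Δ ⊩ m ≐ n → Δ ⊩ prefix c β m ≐ prefix c β n
    prefix-≐ {c = c} {β} q = derivation (≈-refl ⊙ (≈-refl ⊙ equal q))

  prefix-≐ : ∀ {c β m n} → Δ ⊩ m ≐ n → Δ ⊩ prefix c β m ≐ prefix c β n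
  prefix-≐ q = derivation (≈-refl ⊙ (≈-refl ⊙ equal q))

  prefix-shorten : ∀ {c p β γ i n} → Δ ⊩ Coding c p → Δ ⊩ prefix c β n ≐ prefix c γ n → Δ ⊩ i ≤̇ n →
                   Δ ⊩ prefix c β i ≐ prefix c γ i
  prefix-shorten {c = c} {p} {i = i} {n} H q l = prefix-strip {p = p} (n ∸̇ i) H
    (≐t (prefix-≐ (≐s (≤-elim l))) (≐t q (prefix-≐ (≤-elim l))))

  prefix-entry : ∀ {c p β γ i n} → Δ ⊩ Coding c p → Δ ⊩ prefix c β n ≐ prefix c γ n → Δ ⊩ i <̇ n → Δ ⊩ β · i ≐ γ · i
  prefix-entry {c = c} {p} H q l = ∧E₂ (prefix-inj {c = c} {p} H (prefix-shorten {p = p} H q l))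

  -- If one sequence were longer, stripping as many last entries as the shorter one has would leave
  -- a successor on one side and 0, the code of the empty sequence, on the other.
  prefix-length : ∀ {c p β γ m n} → Δ ⊩ Coding c p → Δ ⊩ prefix c β m ≐ prefix c γ n → Δ ⊩ m ≐ n
  prefix-length {c = c} {p} {β} {γ} {m} {n} H q = inst {o ∷ o ∷ 𝟏 ∷ 𝟏 ∷ 𝐏 ∷ 𝐂 ∷ []}
    {Coding v5 v4 ⟶ prefix v5 v3 v1 ≐ prefix v5 v2 v0 ⟶ v1 ≐ v0}
    (∀I (∀I (∀I (∀I (∀I (∀I (⟶I (⟶I (∨E (∸-total v1 v0)
      (num-cases (v1 ∸̇ v0)
        (≐t h1 (≐t (+-cong ≐r h0) (+-identityʳ _)))
        (longer h3 (≐t h1 (+-cong ≐r h0)) h2))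
      (num-cases (v0 ∸̇ v1)
        (≐s (≐t h1 (≐t (+-cong ≐r h0) (+-identityʳ _))))
        (longer h3 (≐t h1 (+-cong ≐r h0)) (≐s h2)))))))))))) (ε ▹ c ▹ p ▹ β ▹ γ ▹ m ▹ n) $ H $ q
    where
    longer : ∀ {Γ} {Δ : List (Fm C (o ∷ o ∷ 𝟏 ∷ 𝟏 ∷ 𝐏 ∷ 𝐂 ∷ Γ))} {β γ m n d A} → Δ ⊩ Coding v5 v4 →
             Δ ⊩ m ≐ n +̇ (suc · d) → Δ ⊩ prefix v5 β m ≐ prefix v5 γ n → Δ ⊩ A
    longer {n = n} {d} H l q = absurd (≐t (≐s (prefix-suc {c = v5} {v4} H _ _))
      (≐t (prefix-strip {c = v5} {v4} {m = suc · d} {zero} n H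
            (≐t (prefix-≐ (≐t (+-comm _ _) (≐s l))) (≐t q (prefix-≐ (≐s (+-identityˡ _))))))
          (prefix-zero {c = v5} {v4} H _)))

  -- A family of functions covering all finite sequences

  distances : Δ ⊩ ∃̇ 𝐏 (IsDistance v0)
  distances = define (o ∷ o ∷ []) (distance v1 v0) (∃I v0 (∧I
    (∀I (∀I (⟶I (distance-zero⁻¹ (≐t (≐s (h1 ∙ v1 ∙ v0)) h0)))))
    (∀I (≐t (h0 ∙ v0 ∙ v0) (distance-zero ≐r)))))

  distance-≐ : ∀ {d : Tm C Γ 𝐏} {a b : Tm C Γ o} → Δ ⊩ IsDistance d → Δ ⊩ a ≐ b → Δ ⊩ d · a · b ≐ zero
  distance-≐ {d = d} {a} {b} D q = inst {o ∷ o ∷ 𝐏 ∷ []} {IsDistance v2 ⟶ v1 ≐ v0 ⟶ v2 · v1 · v0 ≐ zero}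
    (∀I (∀I (∀I (⟶I (⟶I (≐t (≐-cong (v3 · v0 · v1) h0) (∧E₂ h1 ∙ v0))))))) (ε ▹ d ▹ a ▹ b) $ D $ q

  ≐-distance : ∀ {d : Tm C Γ 𝐏} {a b : Tm C Γ o} → Δ ⊩ IsDistance d → Δ ⊩ d · a · b ≐ zero → Δ ⊩ a ≐ b
  ≐-distance {d = d} {a} {b} D q = inst {o ∷ o ∷ 𝐏 ∷ []} {IsDistance v2 ⟶ v2 · v1 · v0 ≐ zero ⟶ v1 ≐ v0}
    (∀I (∀I (∀I (⟶I (all₂ (∧E₁ h0) v1 v0))))) (ε ▹ d ▹ a ▹ b) $ D $ q

  -- The first projection is found by searching for an a such that the search for a b with p a b = c succeeds.
  project : ∀ {μ : Tm C Γ 𝟐} {p d : Tm C Γ 𝐏} {m : Tm C Γ (o ⇒ 𝐏)} {m₁ : Tm C Γ 𝐏} {f s : Tm C Γ 𝟏} → (∀ g n → Δ ⊩ g · n ≐ zero → Δ ⊩ g · (μ · g) ≐ zero) → (∀ a → Δ ⊩ d · a · a ≐ zero) →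
            (∀ c a b → Δ ⊩ m · c · a · b ≐ d · c · (p · a · b)) → (∀ c a → Δ ⊩ m₁ · c · a ≐ m · c · a · (μ · (m · c · a))) →
            (∀ c → Δ ⊩ f · c ≐ μ · (m₁ · c)) → (∀ c → Δ ⊩ s · c ≐ μ · (m · c · (f · c))) →
            ∀ a b → let c = p · a · b in Δ ⊩ d · c · (p · (f · c) · (s · c)) ≐ zero
  project {μ = μ} {p} {d} {m} {m₁} {f} {s} M D Em Em₁ Ef Es a b =
    d · c · (p · (f · c) · (s · c))       ≐⟨ ≐s (Em c (f · c) (s · c)) ⟩
    m · c · (f · c) · (s · c)             ≐⟨ Eq-arg (m · c · (f · c)) (Es c) ⟩
    m · c · (f · c) · (μ · (m · c · (f · c))) ≐⟨ ≐s (Em₁ c (f · c)) ⟩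
    m₁ · c · (f · c)                      ≐⟨ Eq-arg (m₁ · c) (Ef c) ⟩
    m₁ · c · (μ · (m₁ · c))               ≐⟨ M (m₁ · c) a (≐t (Em₁ c a) (M (m · c · a) b (≐t (Em c a b) (D c)))) ⟩
    zero ∎
    where c = p · a · b

  -- `Pairing` offers injectivity but no inverses; unbounded search with `μ` finds them.
  projections : Δ ⊩ ∀̇ 𝟐 (Searches v0 ⟶ ∀̇ 𝐏 (Pairing v0 ⟶ ∃̇ 𝟏 (∃̇ 𝟏 (Projections v2 v1 v0))))
  projections = ∀I (⟶I (∀I (⟶I
    (∃E distances
    (define (o ∷ o ∷ o ∷ []) (v3 · v2 · (v4 · v1 · v0))
    (define (o ∷ o ∷ []) (v2 · v1 · v0 · (v5 · (v2 · v1 · v0)))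
    (define (o ∷ []) (v5 · (v1 · v0))
    (define (o ∷ []) (v6 · (v3 · v0 · (v1 · v0)))
    (∃I v1 (∃I v0 (∀I (∀I
      (cut {A = v1 ≐ v3 · (v7 · v1 · v0) ∧ v0 ≐ v2 · (v7 · v1 · v0)}
        (pairing-inj {p = v7} {v1} {v0} {v3 · (v7 · v1 · v0)} {v2 · (v7 · v1 · v0)} h5
           (all₂ (∧E₁ h4) (v7 · v1 · v0) (v7 · (v3 · (v7 · v1 · v0)) · (v2 · (v7 · v1 · v0)))
            $ project {μ = v8} {v7} {v6} {v5} {v4} {v3} {v2}
                (λ g n q → all₂ h6 g n $ q) (λ a → ∧E₂ h4 ∙ a) (λ c a b → all₃ h3 c a b) (λ c a → all₂ h2 c a) (λ c → h1 ∙ c) (λ c → h0 ∙ c) v1 v0))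
      (∧I (≐s (∧E₁ h0)) (≐s (∧E₂ h0))))))))))))))))

  iterations : Δ ⊩ ∀̇ 𝟏 (∃̇ 𝐏 (Iterates v1 v0))
  iterations = ∀I
    (define (o ∷ o ∷ []) (v2 · v1)
    (define (o ∷ o ∷ []) (R₀ · v1 · v0 · v2)
    (∃I v0 (∧I
      (∀I (≐t (h0 ∙ zero ∙ v0) (axiom (R₀-zero v0 v2))))
      (∀I (∀I (≐t (h0 ∙ (suc · v1) ∙ v0) (≐t (axiom (R₀-suc v1 v0 v3))
        (≐t (h1 ∙ (R₀ · v1 · v0 · v3) ∙ v1) (Eq-arg v4 (≐s (h0 ∙ v1 ∙ v0))))))))))))

  -- Entries are pushed in order, so the last one is on top: the first projection pops it, the
  -- second one reads it.
  stackings : Δ ⊩ ∀̇ 𝐏 (∃̇ (𝟏 ⇒ o ⇒ o) (Stacks v1 v0))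
  stackings = ∀I
    (define (o ∷ o ∷ 𝟏 ∷ []) (v3 · v1 · (v2 · v0))
    (define (o ∷ 𝟏 ∷ []) (R₀ · v0 · zero · (v2 · v1))
    (∃I v0 (∀I (∀I (≐t (h0 ∙ v1 ∙ (suc · v0)) (≐t (axiom (R₀-suc v0 zero (v3 · v1)))
      (≐t (h1 ∙ v1 ∙ (R₀ · v0 · zero · (v3 · v1)) ∙ v0)
        (derivation (≈-refl {t = v4} ⊙ equal (≐s (h0 ∙ v1 ∙ v0)) ⊙ ≈-refl {t = v1 · v0}))))))))))

  iterate-shift : ∀ {f : Tm C Γ 𝟏} {i : Tm C Γ 𝐏} → Δ ⊩ Iterates f i → ∀ x j → Δ ⊩ i · (suc · j) · x ≐ i · j · (f · x)
  iterate-shift {f = f} {i} I x j = inst {o ∷ o ∷ 𝐏 ∷ 𝟏 ∷ []}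
    {Iterates v3 v2 ⟶ v2 · (suc · v0) · v1 ≐ v2 · v0 · (v3 · v1)}
    (∀I (∀I (∀I (∀I (⟶I (ind {A = v3 · (suc · v0) · v2 ≐ v3 · v0 · (v4 · v2)}
       (≐t (all₂ (∧E₂ h0) zero v1) (≐t (Eq-arg v3 (∧E₁ h0 ∙ v1)) (≐s (∧E₁ h0 ∙ (v3 · v1)))))
       (≐t (all₂ (∧E₂ h1) (suc · v0) v2) (≐t (Eq-arg v4 h0) (≐s (all₂ (∧E₂ h1) v0 (v4 · v2)))))
     ∙ v0)))))) (ε ▹ f ▹ i ▹ x ▹ j) $ I

  stack-tail : ∀ {p : Tm C Γ 𝐏} {f s : Tm C Γ 𝟏} {t : Tm C Γ (𝟏 ⇒ o ⇒ o)} → Δ ⊩ Projections p f s → Δ ⊩ Stacks p t →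
               ∀ γ n → Δ ⊩ f · (t · γ · (suc · n)) ≐ t · γ · n
  stack-tail {p = p} {f} {s} {t} P Σ γ n = inst {o ∷ 𝟏 ∷ (𝟏 ⇒ o ⇒ o) ∷ 𝟏 ∷ 𝟏 ∷ 𝐏 ∷ []}
    {Projections v5 v4 v3 ⟶ Stacks v5 v2 ⟶ v4 · (v2 · v1 · (suc · v0)) ≐ v2 · v1 · v0}
    (∀I (∀I (∀I (∀I (∀I (∀I (⟶I (⟶I (≐t (Eq-arg v4 (all₂ h0 v1 v0)) (∧E₁ (all₂ h1 (v2 · v1 · v0) (v1 · v0))))))))))))
    (ε ▹ p ▹ f ▹ s ▹ t ▹ γ ▹ n) $ P $ Σ

  stack-head : ∀ {p : Tm C Γ 𝐏} {f s : Tm C Γ 𝟏} {t : Tm C Γ (𝟏 ⇒ o ⇒ o)} → Δ ⊩ Projections p f s → Δ ⊩ Stacks p t →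
               ∀ γ n → Δ ⊩ s · (t · γ · (suc · n)) ≐ γ · n
  stack-head {p = p} {f} {s} {t} P Σ γ n = inst {o ∷ 𝟏 ∷ (𝟏 ⇒ o ⇒ o) ∷ 𝟏 ∷ 𝟏 ∷ 𝐏 ∷ []}
    {Projections v5 v4 v3 ⟶ Stacks v5 v2 ⟶ v3 · (v2 · v1 · (suc · v0)) ≐ v1 · v0}
    (∀I (∀I (∀I (∀I (∀I (∀I (⟶I (⟶I (≐t (Eq-arg v3 (all₂ h0 v1 v0)) (∧E₂ (all₂ h1 (v2 · v1 · v0) (v1 · v0))))))))))))
    (ε ▹ p ▹ f ▹ s ▹ t ▹ γ ▹ n) $ P $ Σ

  iterate-stack : ∀ {p : Tm C Γ 𝐏} {f s : Tm C Γ 𝟏} {i : Tm C Γ 𝐏} {t : Tm C Γ (𝟏 ⇒ o ⇒ o)} →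
                  Δ ⊩ Projections p f s → Δ ⊩ Iterates f i → Δ ⊩ Stacks p t → ∀ γ n j →
                  Δ ⊩ i · j · (t · γ · (n +̇ j)) ≐ t · γ · n
  iterate-stack {p = p} {f} {s} {i} {t} P I Σ γ n j = inst {o ∷ o ∷ 𝟏 ∷ (𝟏 ⇒ o ⇒ o) ∷ 𝐏 ∷ 𝟏 ∷ 𝟏 ∷ 𝐏 ∷ []}
    {Projections v7 v5 v6 ⟶ Iterates v5 v4 ⟶ Stacks v7 v3 ⟶ v4 · v0 · (v3 · v2 · (v1 +̇ v0)) ≐ v3 · v2 · v1}
    (∀I (∀I (∀I (∀I (∀I (∀I (∀I (∀I (⟶I (⟶I (⟶I (ind {A = v5 · v0 · (v4 · v3 · (v2 +̇ v0)) ≐ v4 · v3 · v2}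
       (≐t (∧E₁ h1 ∙ (v3 · v2 · (v1 +̇ zero))) (Eq-arg (v3 · v2) (+-identityʳ v1)))
       (≐t (iterate-shift {f = v6} {v5} h2 (v4 · v3 · (v2 +̇ (suc · v0))) v0)
        (≐t (Eq-arg (v5 · v0) (≐t (Eq-arg v6 (Eq-arg (v4 · v3) (+-suc v2 v0)))
              (stack-tail {p = v8} {v6} {v7} {v4} h3 h1 v3 (v2 +̇ v0))))
          h0))
     ∙ v0)))))))))))) (ε ▹ p ▹ s ▹ f ▹ i ▹ t ▹ γ ▹ n ▹ j) $ P $ I $ Σ

  covering-entry : ∀ {p : Tm C Γ 𝐏} {f s : Tm C Γ 𝟏} {i : Tm C Γ 𝐏} {t : Tm C Γ (𝟏 ⇒ o ⇒ o)} →
                   Δ ⊩ Projections p f s → Δ ⊩ Iterates f i → Δ ⊩ Stacks p t → ∀ γ n j → Δ ⊩ j <̇ n →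
                   Δ ⊩ f · (p · n · (t · γ · n)) ≐ n → Δ ⊩ s · (p · n · (t · γ · n)) ≐ t · γ · n →
                   let k = p · n · (t · γ · n) in Δ ⊩ s · (i · ((f · k) ∸̇ (suc · j)) · (s · k)) ≐ γ · j
  covering-entry {p = p} {f} {s} {i} {t} P I Σ γ n j l F H =
    s · (i · ((f · k) ∸̇ (suc · j)) · (s · k)) ≐⟨ Eq-arg s (derivation (≈-refl {t = i} ⊙ equal (∸-cong F ≐r) ⊙ equal H)) ⟩
    s · (i · d · (t · γ · n))                 ≐⟨ Eq-arg s (Eq-arg (i · d) (Eq-arg (t · γ) (≤-elim l))) ⟩
    s · (i · d · (t · γ · ((suc · j) +̇ d)))   ≐⟨ Eq-arg s (iterate-stack {p = p} {f} {s} {i} {t} P I Σ γ (suc · j) d) ⟩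
    s · (t · γ · (suc · j))                   ≐⟨ stack-head {p = p} {f} {s} {t} P Σ γ j ⟩
    γ · j                                     ∎
    where
    k = p · n · (t · γ · n)
    d = n ∸̇ (suc · j)

  covering : Δ ⊩ ∀̇ 𝐏 (∀̇ 𝟏 (∀̇ 𝟏 (Projections v2 v1 v0 ⟶ ∃̇ 𝐏 (Covers v0))))
  covering = ∀I (∀I (∀I (⟶I
    (∃E (iterations ∙ v1)
    (∃E (stackings ∙ v3)
    (define (o ∷ o ∷ []) (v4 · (v3 · ((v5 · v1) ∸̇ (suc · v0)) · (v4 · v1)))
    -- The index pairs the length n with the stack of the first n values. After n - (j + 1) pops the
    -- entry j is on top.
    (∃I v0 (∀I (∀I (∃I (v7 · v0 · (v3 · v1 · v0)) (∀I (⟶I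
      (≐t (all₂ h1 (v8 · v1 · (v4 · v2 · v1)) v0)
        (covering-entry {p = v8} {v7} {v6} {v5} {v4} h4 h3 h2 v2 v1 v0 h0
          (∧E₁ (all₂ h4 v1 (v4 · v2 · v1))) (∧E₂ (all₂ h4 v1 (v4 · v2 · v1)))))))))))))))))

  -- Uniform weak König's lemma

  -- A universal quantifier is the negation of a search for counterexamples: `f` vanishes at `m`
  -- when the function `p` for that `m` has no zero, and `q` vanishes when `f` has none.
  ∀∃-elim : ∀ {μ : Tm C Γ 𝟐} {f p : Tm C Γ 𝟏} {q m : Tm C Γ o} → Δ ⊩ f · m ≐ zero ⟶ f · (μ · f) ≐ zero →
            Δ ⊩ f · m ≐ not (p · (μ · p)) → Δ ⊩ q ≐ not (f · (μ · f)) →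
            Δ ⊩ q ≐ zero → Δ ⊩ p · (μ · p) ≐ zero
  ∀∃-elim M Ef Eq q≐0 = raa (not-zero⁻¹ (≐t (≐s (weaken Eq)) (weaken q≐0))
    $ (weaken M $ ≐t (weaken Ef) (not-zero h0)))

  seg-covered : ∀ {c : Tm C Γ 𝐂} {e : Tm C Γ 𝐏} {β : Tm C Γ 𝟏} {k n i : Tm C Γ o} →
                Δ ⊩ ∀̇ o (v0 <̇ wkT n ⟶ wkT e · wkT k · v0 ≐ wkT β · v0) → Δ ⊩ i ≤̇ n →
                Δ ⊩ prefix c (e · k) i ≐ prefix c β i
  seg-covered {c = c} {e} {β} {k} {n} {i} H l = inst {o ∷ o ∷ 𝟏 ∷ 𝟏 ∷ 𝐂 ∷ []}
    {∀̇ o (v0 <̇ v2 ⟶ v4 · v0 ≐ v3 · v0) ⟶ v0 ≤̇ v1 ⟶ prefix v4 v3 v0 ≐ prefix v4 v2 v0}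
    (∀I (∀I (∀I (∀I (∀I (⟶I (⟶I (prefix-ext (∀I (⟶I (h2 ∙ v0 $ ≤-trans h0 h1)))))))))))
    (ε ▹ c ▹ (e · k) ▹ β ▹ n ▹ i) $ H $ l

  extends? : (c : Tm C Γ 𝐂) (e d : Tm C Γ 𝐏) (t : Tm C Γ 𝟏) (x n m k : Tm C Γ o) → Tm C Γ o
  extends? c e d t x n m k = (d · (prefix c (e · k) n) · x) +̇ (d · (t · prefix c (e · k) m) · (suc · zero))

  index-of-reach : ∀ {c : Tm C Γ 𝐂} {e d : Tm C Γ 𝐏} {t : Tm C Γ 𝟏} {x n m : Tm C Γ o} →
    Δ ⊩ IsDistance d → Δ ⊩ Covers e → Δ ⊩ Reaches c t x n m →
    Δ ⊩ ∃̇ o (extends? (wkT c) (wkT e) (wkT d) (wkT t) (wkT x) (wkT n) (wkT m) v0 ≐ zero)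
  index-of-reach {c = c} {e} {d} {t} {x} {n} {m} D E X = inst {o ∷ o ∷ o ∷ 𝟏 ∷ 𝐏 ∷ 𝐏 ∷ 𝐂 ∷ []}
    {IsDistance v4 ⟶ Covers v5 ⟶ Reaches v6 v3 v2 v1 v0 ⟶ ∃̇ o (extends? v7 v6 v5 v4 v3 v2 v1 v0 ≐ zero)}
    (∀I (∀I (∀I (∀I (∀I (∀I (∀I (⟶I (⟶I (⟶I
      (∃E h0
      -- Both prefixes have to be covered; the sum of their lengths serves as a common bound.
      (∃E (all₂ h2 v0 (v2 +̇ v1))
      (∃I v0 (+-zero
        (distance-≐ {d = v6} {prefix v8 (v7 · v0) v3} {v4} h4
          (≐t (seg-covered {c = v8} {v7} {v1} {v0} {v3 +̇ v2} {v3} h0 m≤m+n) (∧E₁ h1)))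
        (distance-≐ {d = v6} {v5 · prefix v8 (v7 · v0) v2} {suc · zero} h4
          (≐t (Eq-arg v5 (seg-covered {c = v8} {v7} {v1} {v0} {v3 +̇ v2} {v2} h0 m≤n+m)) (∧E₂ h1)))))))))))))))))
    (ε ▹ c ▹ e ▹ d ▹ t ▹ x ▹ n ▹ m) $ D $ E $ X

  reach-tests : Δ ⊩ ∀̇ 𝐂 (∀̇ 𝐏 (Covers v0 ⟶ ∃̇ (𝟏 ⇒ o ⇒ o ⇒ o ⇒ 𝟏) (TestsReach v2 v0)))
  reach-tests = ∀I (∀I (⟶I
    (∃E distances
    (define (o ∷ o ∷ o ∷ o ∷ 𝟏 ∷ []) (extends? v7 v6 v5 v4 v3 v2 v1 v0)
    (∃I v0 (∀I (∀I (∀I (∀I (∧I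
      (⟶I (∃E h0 (∃I (v7 · v0)
        (cut {A = extends? v8 v7 v6 v4 v3 v2 v1 v0 ≐ zero}
          (≐t (≐s (all (o ∷ o ∷ o ∷ o ∷ 𝟏 ∷ []) h2 (ε ▹ v4 ▹ v3 ▹ v2 ▹ v1 ▹ v0))) h0)
        (∧I (≐-distance {d = v6} {prefix v8 (v7 · v0) v2} {v3} h4 (+-zeroˡ h0))
            (≐-distance {d = v6} {v4 · prefix v8 (v7 · v0) v1} {suc · zero} h4 (+-zeroʳ h0)))))))
      (⟶I (∃E (index-of-reach {c = v7} {v6} {v5} {v3} {v2} {v1} {v0} h2 h3 h0)
        (∃I v0 (≐t (all (o ∷ o ∷ o ∷ o ∷ 𝟏 ∷ []) h2 (ε ▹ v4 ▹ v3 ▹ v2 ▹ v1 ▹ v0)) h0))))))))))))))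

  -- One search for the inner quantifier and one for the outer turn a Π⁰₂ property, uniformly in its
  -- parameters, into the vanishing of a term.
  ∀∃-tests : Δ ⊩ ∀̇ 𝟐 (Searches v0 ⟶ ∀̇ (𝟏 ⇒ o ⇒ o ⇒ o ⇒ 𝟏) (∃̇ (𝟏 ⇒ 𝐏) (∀̇ 𝟏 (∀̇ o (∀̇ o
    (v3 · v2 · v1 · v0 ≐ zero ⟷ ∀̇ o (∃̇ o (v6 · v4 · v3 · v2 · v1 · v0 ≐ zero))))))))
  ∀∃-tests = ∀I (⟶I (∀I
    (define (o ∷ o ∷ o ∷ 𝟏 ∷ []) (not (v4 · v3 · v2 · v1 · v0 · (v5 · (v4 · v3 · v2 · v1 · v0))))
    (define (o ∷ o ∷ 𝟏 ∷ []) (not (v3 · v2 · v1 · v0 · (v5 · (v3 · v2 · v1 · v0))))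
    (∃I v0 (∀I (∀I (∀I (∧I
      (⟶I (∀I (let p = v6 · v3 · v2 · v1 · v0 ; f = v5 · v3 · v2 · v1 in ∃I (v7 · p)
        (∀∃-elim {μ = v7} {f} {p} {v4 · v3 · v2 · v1} {v0} (all₂ h3 f v0)
          (all (o ∷ o ∷ o ∷ 𝟏 ∷ []) h2 (ε ▹ v3 ▹ v2 ▹ v1 ▹ v0)) (all (o ∷ o ∷ 𝟏 ∷ []) h1 (ε ▹ v3 ▹ v2 ▹ v1)) h0))))
      (⟶I (≐t (all (o ∷ o ∷ 𝟏 ∷ []) h1 (ε ▹ v2 ▹ v1 ▹ v0)) (not-zero (⟶I
        (let f = v4 · v2 · v1 · v0 ; m = v6 · f ; p = v5 · v2 · v1 · v0 · m in
        not-zero⁻¹ {x = p · (v6 · p)} (≐t (≐s (all (o ∷ o ∷ o ∷ 𝟏 ∷ []) h3 (ε ▹ v2 ▹ v1 ▹ v0 ▹ m))) h0)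
        $ ∃E (h1 ∙ m) (all₂ h5 (wkT p) v0 $ h0)))))))))))))))

  extension-tests : Δ ⊩ ∀̇ 𝐂 (∀̇ 𝐏 (∀̇ 𝟐 (Covers v1 ⟶ Searches v0 ⟶ ∃̇ (𝟏 ⇒ 𝐏) (TestsExtensible v3 v0))))
  extension-tests = ∀I (∀I (∀I (⟶I (⟶I
    (∃E (all₂ reach-tests v2 v1 $ h1)
    (∃E ((∀∃-tests ∙ v1 $ h1) ∙ v0)
    (∃I v0 (∀I (∀I (∀I (∧I
      (⟶I (∀I (∧E₁ (all (o ∷ o ∷ o ∷ 𝟏 ∷ []) h2 (ε ▹ v3 ▹ v2 ▹ v1 ▹ v0)) $ (∧E₁ (all₃ h1 v3 v2 v1) $ h0) ∙ v0)))
      (⟶I (∧E₂ (all₃ h1 v2 v1 v0) $ ∀I (∧E₂ (all (o ∷ o ∷ o ∷ 𝟏 ∷ []) h2 (ε ▹ v3 ▹ v2 ▹ v1 ▹ v0)) $ (h0 ∙ v0)))))))))))))))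

  -- The closure condition of `Tree` concerns sequences; it is applied to `seg · β · m`, whose
  -- entries below `m` are those of `β`.
  tree-prefix : ∀ {c : Tm C Γ 𝐂} {t β : Tm C Γ 𝟏} {m i : Tm C Γ o} → Δ ⊩ Tree c t → Δ ⊩ prefix c β m ∈̇ t → Δ ⊩ i <̇ m →
                Δ ⊩ β · i ≤̇ suc · zero ∧ prefix c β i ∈̇ t
  tree-prefix {c = c} {t} {β} {m} {i} H q l = inst {o ∷ o ∷ 𝟏 ∷ 𝟏 ∷ 𝐂 ∷ []}
    {Tree v4 v3 ⟶ prefix v4 v2 v1 ∈̇ v3 ⟶ v0 <̇ v1 ⟶ v2 · v0 ≤̇ suc · zero ∧ prefix v4 v2 v0 ∈̇ v3}
    (∀I (∀I (∀I (∀I (∀I (⟶I (⟶I (⟶I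
      (cut {A = at · (seg · v2 · v1) · v0 ≤̇ suc · zero ∧ prefix v4 (at · (seg · v2 · v1)) v0 ∈̇ v3}
        ((∧E₁ (axiom (∀<-def (len · (seg · v2 · v1)) (at · (seg · v3 · v2) · v0 ≤̇ suc · zero ∧ prefix v5 (at · (seg · v3 · v2)) v0 ∈̇ v4)))
           $ (∧E₂ h2 ∙ (seg · v2 · v1) $ h1)) ∙ v0 $ <-resp ≐r (≐s (axiom (len-seg v2 v1))) h0)
      (∧I (≤-resp (axiom (at-seg v2 v1 v0) $ h1) ≐r (∧E₁ h0))
          (≐t (Eq-arg v3 (prefix-ext {c = v4} {v2} {at · (seg · v2 · v1)} {v0} (∀I (⟶I
                (≐s (axiom (at-seg v3 v2 v0) $ ≤-trans h0 (<⇒≤ h2))))))) (∧E₂ h0))))))))))))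
    (ε ▹ c ▹ t ▹ β ▹ m ▹ i) $ H $ q $ l

  child-prefix : ∀ {c : Tm C Γ 𝐂} {p : Tm C Γ 𝐏} {β : Tm C Γ 𝟏} {x n b : Tm C Γ o} → Δ ⊩ Coding c p →
                 Δ ⊩ prefix c β n ≐ x → Δ ⊩ β · n ≐ b → Δ ⊩ prefix c β (suc · n) ≐ suc · (p · x · b)
  child-prefix {c = c} {p} {β} {x} {n} {b} H q r = ≐t (prefix-suc {c = c} {p} H β n)
    (derivation (≈-refl {t = suc} ⊙ (≈-refl {t = p} ⊙ equal q ⊙ equal r)))

  ≤1-cases : ∀ {b : Tm C Γ o} → Δ ⊩ b ≤̇ suc · zero → Δ ⊩ b ≐ suc · pred b → Δ ⊩ b ≐ suc · zero
  ≤1-cases l q = ≤-antisym l (≤-resp ≐r (≐s q) (suc-mono z≤))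

  -- If the child with last entry 1 missed some length, then all sufficiently long extensions of `x`
  -- would continue with 0, and the child with last entry 0 would reach every length.
  extensible-child : ∀ {c : Tm C Γ 𝐂} {p : Tm C Γ 𝐏} {g : Tm C Γ (𝟏 ⇒ 𝐏)} {t : Tm C Γ 𝟏} {x n : Tm C Γ o} →
    Δ ⊩ Coding c p → Δ ⊩ TestsExtensible c g → Δ ⊩ Tree c t → Δ ⊩ g · t · x · n ≐ zero →
    Δ ⊩ ¬̇ (g · t · (suc · (p · x · zero)) · (suc · n) ≐ zero) → Δ ⊩ g · t · (suc · (p · x · (suc · zero))) · (suc · n) ≐ zero
  extensible-child {c = c} {p} {g} {t} {x} {n} Cd Te Tr G N = inst {o ∷ o ∷ 𝟏 ∷ (𝟏 ⇒ 𝐏) ∷ 𝐏 ∷ 𝐂 ∷ []}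
    {Coding v5 v4 ⟶ TestsExtensible v5 v3 ⟶ Tree v5 v2 ⟶ v3 · v2 · v1 · v0 ≐ zero
      ⟶ ¬̇ (v3 · v2 · (suc · (v4 · v1 · zero)) · (suc · v0) ≐ zero)
      ⟶ v3 · v2 · (suc · (v4 · v1 · (suc · zero))) · (suc · v0) ≐ zero}
    (∀I (∀I (∀I (∀I (∀I (∀I (⟶I (⟶I (⟶I (⟶I (⟶I
      (∧E₂ (all₃ h3 v2 (suc · (v4 · v1 · (suc · zero))) (suc · v0)) $ ∀I (raa
        (h1 $ (∧E₂ (all₃ h4 v3 (suc · (v5 · v2 · zero)) (suc · v1)) $ ∀I
          -- This length is greater than `n`, so that the entry at `n` is at most 1, and greater
          -- than both lengths to be reached, since `tree-prefix` asks for a strict inequality.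
          (∃E ((∧E₁ (all₃ h4 v4 v3 v2) $ h2) ∙ ((suc · v2) +̇ (v0 +̇ v1)))
            (num-cases (v0 · v3)
              (∃I v0 (∧I (child-prefix {c = v8} {v7} {v0} {v4} {v3} {zero} h7 (∧E₁ h1) h0)
                (∧E₂ (tree-prefix {c = v8} {v5} {v0} {(suc · v3) +̇ (v1 +̇ v2)} {v1} h5 (∧E₂ h1)
                   (≤-intro _ (≐t (suc-+ v3 (v1 +̇ v2)) (≐t (suc-cong (≐t (+-comm v3 (v1 +̇ v2)) (+-assoc v1 v2 v3))) (≐s (suc-+ v1 (v2 +̇ v3))))))))))
              (⊥E (h2 $ ∃I v0 (∧I (child-prefix {c = v8} {v7} {v0} {v4} {v3} {suc · zero} h7 (∧E₁ h1)
                  (≤1-cases (∧E₁ (tree-prefix {c = v8} {v5} {v0} {(suc · v3) +̇ (v1 +̇ v2)} {v3} h5 (∧E₂ h1) m≤m+n)) h0))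
                (∧E₂ (tree-prefix {c = v8} {v5} {v0} {(suc · v3) +̇ (v1 +̇ v2)} {v2} h5 (∧E₂ h1)
                   (≤-intro _ (≐t (suc-+ v3 (v1 +̇ v2)) (≐t (suc-cong (≐t (≐t (+-comm v3 (v1 +̇ v2)) (+-cong (+-comm v1 v2) ≐r)) (+-assoc v2 v1 v3))) (≐s (suc-+ v2 (v1 +̇ v3))))))))))))))))))))))))))))
    (ε ▹ c ▹ p ▹ g ▹ t ▹ x ▹ n) $ Cd $ Te $ Tr $ G $ N

  -- Path and nodes depend on each other. The recursion runs over nodes alone, with the next bit
  -- computed from the current node, and the path is read off afterwards.
  follower : Δ ⊩ ∀̇ (𝟏 ⇒ 𝐏) (∀̇ 𝐏 (∃̇ (𝟏 ⇒ 𝟏) (∃̇ (𝟏 ⇒ 𝟏) (Follows v3 v2 v1 v0))))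
  follower = ∀I (∀I
    (define (o ∷ o ∷ 𝟏 ∷ []) (ifz (v4 · v2 · (suc · (v3 · v1 · zero)) · (suc · v0)) zero (suc · zero))
    (define (o ∷ o ∷ 𝟏 ∷ []) (suc · (v4 · v1 · (v3 · v2 · v1 · v0)))
    (define (o ∷ 𝟏 ∷ []) (R₀ · v0 · zero · (v2 · v1))
    (define (o ∷ 𝟏 ∷ []) (v4 · v1 · (v2 · v1 · v0) · v0)
    (∃I v0 (∃I v1 (∧I
      (∀I (≐t (all₂ h1 v0 zero) (axiom (R₀-zero zero (v3 · v0)))))
      (∀I (∀I (∧I
        (v3 · v1 · (suc · v0)                                     ≐⟨ all₂ h1 v1 (suc · v0) ⟩
         R₀ · (suc · v0) · zero · (v4 · v1)                       ≐⟨ axiom (R₀-suc v0 zero (v4 · v1)) ⟩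
         v4 · v1 · (R₀ · v0 · zero · (v4 · v1)) · v0              ≐⟨ derivation (≈-refl {t = v4 · v1} ⊙ equal (≐s (all₂ h1 v1 v0)) ⊙ ≈-refl {t = v0}) ⟩
         v4 · v1 · (v3 · v1 · v0) · v0                            ≐⟨ all₃ h2 v1 (v3 · v1 · v0) v0 ⟩
         suc · (v6 · (v3 · v1 · v0) · (v5 · v1 · (v3 · v1 · v0) · v0)) ≐⟨ suc-cong (Eq-arg (v6 · (v3 · v1 · v0)) (≐s (all₂ h0 v1 v0))) ⟩
         suc · (v6 · (v3 · v1 · v0) · (v2 · v1 · v0))             ∎)
        (≐t (all₂ h0 v1 v0) (all₃ h3 v1 (v3 · v1 · v0) v0)))))))))))))

  module _ {c : Tm C Γ 𝐂} {p : Tm C Γ 𝐏} {g : Tm C Γ (𝟏 ⇒ 𝐏)} {Φ ν : Tm C Γ (𝟏 ⇒ 𝟏)} {t : Tm C Γ 𝟏} where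

    root-extensible : Δ ⊩ Coding c p → Δ ⊩ TestsExtensible c g → Δ ⊩ Infinite c t → Δ ⊩ g · t · zero · zero ≐ zero
    root-extensible Cd Te I = inst {𝟏 ∷ (𝟏 ⇒ 𝐏) ∷ 𝐏 ∷ 𝐂 ∷ []}
      {Coding v3 v2 ⟶ TestsExtensible v3 v1 ⟶ Infinite v3 v0 ⟶ v1 · v0 · zero · zero ≐ zero}
      (∀I (∀I (∀I (∀I (⟶I (⟶I (⟶I (∧E₂ (all₃ h1 v0 zero zero) $ ∀I
        (∃E (h0 ∙ v0) (∃I v0 (∧I (prefix-zero {c = v5} {v4} h3 v0) h0))))))))))) (ε ▹ c ▹ p ▹ g ▹ t) $ Cd $ Te $ I

    -- Through the test `g` the induction formula becomes quantifier-free, which `Extensible` is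
    -- not.
    extensible-node : ∀ {n} → Δ ⊩ Coding c p → Δ ⊩ TestsExtensible c g → Δ ⊩ Tree c t → Δ ⊩ Follows g p Φ ν →
      Δ ⊩ g · t · zero · zero ≐ zero → Δ ⊩ g · t · (ν · t · n) · n ≐ zero
    extensible-node {n = n} Cd Te Tr F R = inst {o ∷ 𝟏 ∷ (𝟏 ⇒ 𝟏) ∷ (𝟏 ⇒ 𝟏) ∷ (𝟏 ⇒ 𝐏) ∷ 𝐏 ∷ 𝐂 ∷ []}
      {Coding v6 v5 ⟶ TestsExtensible v6 v4 ⟶ Tree v6 v1 ⟶ Follows v4 v5 v3 v2 ⟶ v4 · v1 · zero · zero ≐ zero
        ⟶ v4 · v1 · (v2 · v1 · v0) · v0 ≐ zero}
      (∀I (∀I (∀I (∀I (∀I (∀I (∀I (⟶I (⟶I (⟶I (⟶I (⟶I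
        (ind {A = v5 · v2 · (v3 · v2 · v0) · v0 ≐ zero}
          (≐t (derivation (≈-refl {t = v4 · v1} ⊙ equal (∧E₁ h1 ∙ v1) ⊙ ≈-refl {t = zero})) h0)
          (let x = v3 · v2 · v0 ; y = v6 · x in
           ∨E (≐-dec (v5 · v2 · (suc · (y · zero)) · (suc · v0)) zero)
            (≐t (node (≐t (∧E₂ (all₂ (∧E₂ h3) v2 v0)) (ifz-zero h0)) (∧E₁ (all₂ (∧E₂ h3) v2 v0))) h0)
            (≐t (node (≐t (∧E₂ (all₂ (∧E₂ h3) v2 v0)) (ifz-nonzero h0)) (∧E₁ (all₂ (∧E₂ h3) v2 v0)))
              (extensible-child {c = v7} {v6} {v5} {v2} {x} {v0} h6 h5 h4 h1 h0)))
         ∙ v0)))))))))))))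
      (ε ▹ c ▹ p ▹ g ▹ Φ ▹ ν ▹ t ▹ n) $ Cd $ Te $ Tr $ F $ R
      where
      node : ∀ {Γ} {Δ : List (Fm C (o ∷ o ∷ 𝟏 ∷ (𝟏 ⇒ 𝟏) ∷ (𝟏 ⇒ 𝟏) ∷ (𝟏 ⇒ 𝐏) ∷ 𝐏 ∷ 𝐂 ∷ Γ))} {a b : Tm C _ o} →
             Δ ⊩ v4 · v2 · v0 ≐ b → Δ ⊩ a ≐ suc · (v6 · (v3 · v2 · v0) · (v4 · v2 · v0)) →
             Δ ⊩ v5 · v2 · a · (suc · v0) ≐ v5 · v2 · (suc · (v6 · (v3 · v2 · v0) · b)) · (suc · v0)
      node q r = derivation (≈-refl {t = v5 · v2} ⊙ equal (≐t r (suc-cong (Eq-arg (v6 · (v3 · v2 · v0)) q))) ⊙ ≈-refl {t = suc · v0})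

    prefix-node : ∀ {n} → Δ ⊩ Coding c p → Δ ⊩ Follows g p Φ ν → Δ ⊩ prefix c (Φ · t) n ≐ ν · t · n
    prefix-node {n = n} Cd F = inst {o ∷ 𝟏 ∷ (𝟏 ⇒ 𝟏) ∷ (𝟏 ⇒ 𝟏) ∷ (𝟏 ⇒ 𝐏) ∷ 𝐏 ∷ 𝐂 ∷ []}
      {Coding v6 v5 ⟶ Follows v4 v5 v3 v2 ⟶ prefix v6 (v3 · v1) v0 ≐ v2 · v1 · v0}
      (∀I (∀I (∀I (∀I (∀I (∀I (∀I (⟶I (⟶I
        (ind {A = prefix v7 (v4 · v2) v0 ≐ v3 · v2 · v0}
          (≐t (prefix-zero {c = v6} {v5} h1 (v3 · v1)) (≐s (∧E₁ h0 ∙ v1)))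
          (≐t (child-prefix {c = v7} {v6} {v4 · v2} {v3 · v2 · v0} {v0} {v4 · v2 · v0} h2 h0 ≐r)
              (≐s (∧E₁ (all₂ (∧E₂ h1) v2 v0))))
         ∙ v0))))))))))
      (ε ▹ c ▹ p ▹ g ▹ Φ ▹ ν ▹ t ▹ n) $ Cd $ F

    -- Among the extensions is one of length `n`, and that is `x` itself.
    extensible-in-tree : ∀ {x n} → Δ ⊩ TestsExtensible c g → Δ ⊩ g · t · x · n ≐ zero → Δ ⊩ x ∈̇ t
    extensible-in-tree {x = x} {n} Te G = inst {o ∷ o ∷ 𝟏 ∷ (𝟏 ⇒ 𝐏) ∷ 𝐂 ∷ []}
      {TestsExtensible v4 v3 ⟶ v3 · v2 · v1 · v0 ≐ zero ⟶ v1 ∈̇ v2}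
      (∀I (∀I (∀I (∀I (∀I (⟶I (⟶I (∃E ((∧E₁ (all₃ h1 v2 v1 v0) $ h0) ∙ v0)
        (≐t (Eq-arg v3 (≐s (∧E₁ h0))) (∧E₂ h0)))))))))) (ε ▹ c ▹ g ▹ t ▹ x ▹ n) $ Te $ G

  selection : Δ ⊩ ∀̇ 𝐂 (∀̇ 𝐏 (∀̇ (𝟏 ⇒ 𝐏) (Coding v2 v1 ⟶ TestsExtensible v2 v0 ⟶ ∃̇ (𝟏 ⇒ 𝟏) (Selects v3 v0))))
  selection = ∀I (∀I (∀I (⟶I (⟶I
    (∃E (all₂ follower v0 v1)
    (∃E h0
    (∃I v1 (∀I (⟶I (⟶I (∀I
      (≐t (Eq-arg v1 (prefix-node {c = v6} {v5} {v4} {v3} {v2} {v1} {n = v0} h5 h2))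
        (extensible-in-tree {c = v6} {v5} {v4} {v3} {v2} {v1} {n = v0} h4
          (extensible-node {c = v6} {v5} {v4} {v3} {v2} {v1} {n = v0} h5 h4 h1 h2
             (root-extensible {c = v6} {v5} {v4} {v3} {v2} {v1} h5 h4 h0)))))))))))))))

  -- Grilliot's trick

  bounded-search : Δ ⊩ ∃̇ (𝟏 ⇒ o ⇒ o) (SearchesBelow v0)
  bounded-search = ∃I search (∀I (∀I (∀I (⟶I (⟶I (search-finds {g = v2} {v0} {v1} h1 h0))))))

  -- The test is the sum of the values below the bound.
  vanishing-tests : Δ ⊩ ∃̇ (𝟏 ⇒ o ⇒ o) (TestsVanishing v0)
  vanishing-tests =
    define (o ∷ o ∷ 𝟏 ∷ []) (v1 +̇ (v2 · v0))
    (define (o ∷ 𝟏 ∷ []) (R₀ · v0 · zero · (v2 · v1))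
    (cut {A = ∀̇ 𝟏 (v1 · v0 · zero ≐ zero)} (∀I (≐t (all₂ h0 v0 zero) (axiom (R₀-zero zero (v2 · v0)))))
    (cut {A = ∀̇ 𝟏 (∀̇ o (v2 · v1 · (suc · v0) ≐ (v2 · v1 · v0) +̇ (v1 · v0)))}
      (∀I (∀I (
        v2 · v1 · (suc · v0)                             ≐⟨ all₂ h1 v1 (suc · v0) ⟩
        R₀ · (suc · v0) · zero · (v3 · v1)               ≐⟨ axiom (R₀-suc v0 zero (v3 · v1)) ⟩
        v3 · v1 · (R₀ · v0 · zero · (v3 · v1)) · v0      ≐⟨ all₃ h2 v1 (R₀ · v0 · zero · (v3 · v1)) v0 ⟩
        (R₀ · v0 · zero · (v3 · v1)) +̇ (v1 · v0)         ≐⟨ +-cong (≐s (all₂ h1 v1 v0)) ≐r ⟩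
        (v2 · v1 · v0) +̇ (v1 · v0)                       ∎)))
    (∃I v0 (∀I (∀I (∧I
      (⟶I (∀I (⟶I
        (ind {A = v1 <̇ v0 ⟶ v4 · v3 · v0 ≐ zero ⟶ v3 · v1 ≐ zero}
          (⟶I (≮zero h0))
          (⟶I (⟶I (cut {A = (v4 · v3 · v0) +̇ (v3 · v0) ≐ zero} (≐t (≐s (all₂ h5 v3 v0)) h0)
            (∨E (<-suc-cases h2)
              (h4 $ h0 $ +-zeroˡ h1)
              (≐t (Eq-arg v3 h0) (+-zeroʳ h1))))))
         ∙ v1 $ h0 $ h1))))
      (⟶I (ind {A = v0 ≤̇ v1 ⟶ v3 · v2 · v0 ≐ zero}
            (⟶I (h3 ∙ v1))
            (⟶I (≐t (all₂ h3 v2 v0) (+-zero (h1 $ <⇒≤ h0) (h2 ∙ v0 $ h0))))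
           ∙ v0 $ ≤-refl)))))))))

  or-zeroʳ : ∀ {x y : Tm C Γ o} → Δ ⊩ y ≐ zero → Δ ⊩ ifz x zero y ≐ zero
  or-zeroʳ {x = x} {y} q = inst {o ∷ o ∷ []} {v0 ≐ zero ⟶ ifz v1 zero v0 ≐ zero}
    (∀I (∀I (⟶I (num-cases v1 (ifz-zero h0) (≐t (ifz-suc h0) h1))))) (ε ▹ x ▹ y) $ q

  or-zero : ∀ {x y : Tm C Γ o} → Δ ⊩ ifz x zero y ≐ zero → Δ ⊩ x ≐ zero ∨ y ≐ zero
  or-zero {x = x} {y} q = inst {o ∷ o ∷ []} {ifz v1 zero v0 ≐ zero ⟶ v1 ≐ zero ∨ v0 ≐ zero}
    (∀I (∀I (⟶I (num-cases v1 (∨I₁ h0) (∨I₂ (≐t (≐s (ifz-suc h0)) h1)))))) (ε ▹ x ▹ y) $ q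

  not-≤1 : ∀ {x : Tm C Γ o} → Δ ⊩ not x ≤̇ suc · zero
  not-≤1 {x = x} = inst {o ∷ []} {not v0 ≤̇ suc · zero}
    (∀I (num-cases v0 (≤-resp (≐s (ifz-zero h0)) ≐r ≤-refl) (≤-resp (≐s (ifz-suc h0)) ≐r z≤))) (ε ▹ x)

  not-one : ∀ {x : Tm C Γ o} → Δ ⊩ not x ≐ suc · zero → Δ ⊩ x ≐ zero
  not-one {x = x} q = inst {o ∷ []} {not v0 ≐ suc · zero ⟶ v0 ≐ zero}
    (∀I (⟶I (num-cases v0 h0 (absurd (≐t (≐s h1) (ifz-suc h0)))))) (ε ▹ x) $ q

  on-branch : (c : Tm C Γ 𝐂) (d : Tm C Γ 𝐏) (σ : Tm C Γ (𝟏 ⇒ o ⇒ o)) (b : Tm C Γ o) (g : Tm C Γ 𝟏) (x n : Tm C Γ o) → Tm C Γ o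
  on-branch c d σ b g x n = (d · x · prefix c (K · b) n) +̇ (σ · g · n)

  on-branch-intro : ∀ {c : Tm C Γ 𝐂} {d : Tm C Γ 𝐏} {σ : Tm C Γ (𝟏 ⇒ o ⇒ o)} {b : Tm C Γ o} {g : Tm C Γ 𝟏} {x n : Tm C Γ o} →
    Δ ⊩ IsDistance d → Δ ⊩ TestsVanishing σ → Δ ⊩ x ≐ prefix c (K · b) n ∧ Vanishes g n → Δ ⊩ on-branch c d σ b g x n ≐ zero
  on-branch-intro {c = c} {d} {σ} {b} {g} {x} {n} D V N = inst {o ∷ o ∷ 𝟏 ∷ o ∷ (𝟏 ⇒ o ⇒ o) ∷ 𝐏 ∷ 𝐂 ∷ []}
    {IsDistance v5 ⟶ TestsVanishing v4 ⟶ v1 ≐ prefix v6 (K · v3) v0 ∧ Vanishes v2 v0 ⟶ on-branch v6 v5 v4 v3 v2 v1 v0 ≐ zero}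
    (∀I (∀I (∀I (∀I (∀I (∀I (∀I (⟶I (⟶I (⟶I (+-zero (distance-≐ {d = v5} h2 (∧E₁ h0)) (∧E₂ (all₂ h1 v2 v0) $ ∧E₂ h0))))))))))))
    (ε ▹ c ▹ d ▹ σ ▹ b ▹ g ▹ x ▹ n) $ D $ V $ N

  branch-intro : ∀ {c : Tm C Γ 𝐂} {d : Tm C Γ 𝐏} {σ : Tm C Γ (𝟏 ⇒ o ⇒ o)} {b : Tm C Γ o} {g : Tm C Γ 𝟏} {x n : Tm C Γ o} →
    Δ ⊩ IsDistance d → Δ ⊩ TestsVanishing σ → Δ ⊩ on-branch c d σ b g x n ≐ zero → Δ ⊩ Branch c b g x
  branch-intro {c = c} {d} {σ} {b} {g} {x} {n} D V N = inst {o ∷ o ∷ 𝟏 ∷ o ∷ (𝟏 ⇒ o ⇒ o) ∷ 𝐏 ∷ 𝐂 ∷ []}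
    {IsDistance v5 ⟶ TestsVanishing v4 ⟶ on-branch v6 v5 v4 v3 v2 v1 v0 ≐ zero ⟶ Branch v6 v3 v2 v1}
    (∀I (∀I (∀I (∀I (∀I (∀I (∀I (⟶I (⟶I (⟶I (∃I v0 (∧I
      (≐-distance {d = v5} {v1} {prefix v6 (K · v3) v0} h2 (+-zeroˡ h0)) (∧E₁ (all₂ h1 v2 v0) $ +-zeroʳ h0)))))))))))))
    (ε ▹ c ▹ d ▹ σ ▹ b ▹ g ▹ x ▹ n) $ D $ V $ N

  branch-length : ∀ {c : Tm C Γ 𝐂} {p : Tm C Γ 𝐏} {β : Tm C Γ 𝟏} {x n : Tm C Γ o} → Δ ⊩ Coding c p → Δ ⊩ x ≐ prefix c β n →
                  Δ ⊩ n <̇ suc · x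
  branch-length {c = c} {p} H q = suc-mono (≤-resp ≐r (≐s q) (≤-prefix {c = c} {p} H))

  -- `Branch` quantifies over the length of a node without a bound; since the length is at most the
  -- code `x`, a search below `suc · x` decides membership.
  two-branches : ∀ {c : Tm C Γ 𝐂} {p : Tm C Γ 𝐏} → Δ ⊩ Coding c p → Δ ⊩ ∃̇ (𝟏 ⇒ 𝟏 ⇒ 𝟏) (TwoBranches (wkT c) v0)
  two-branches {c = c} {p} H = inst {𝐏 ∷ 𝐂 ∷ []} {Coding v1 v0 ⟶ ∃̇ (𝟏 ⇒ 𝟏 ⇒ 𝟏) (TwoBranches v2 v0)} (∀I (∀I (⟶I
    (∃E distances (∃E vanishing-tests (∃E bounded-search
    -- A disjunction: `ifz x zero y` vanishes exactly if `x` or `y` does.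
    (define (o ∷ o ∷ 𝟏 ∷ 𝟏 ∷ []) (ifz (on-branch v8 v6 v5 zero v3 v1 v0) zero (on-branch v8 v6 v5 (suc · zero) v2 v1 v0))
    (define (o ∷ 𝟏 ∷ 𝟏 ∷ []) (not (v3 · v2 · v1 · v0 · (v4 · (v3 · v2 · v1 · v0) · (suc · v0))))
    (∃I v0 (∀I (∀I (∀I (∧I
      (let k = v4 · v2 · v1 · v0 ; n = v5 · k · (suc · v0) in ∧I
       (⟶I (∨E (or-zero {x = on-branch v9 v7 v6 zero v2 v0 n} {on-branch v9 v7 v6 (suc · zero) v1 v0 n}
                 (≐t (≐s (all (o ∷ o ∷ 𝟏 ∷ 𝟏 ∷ []) h2 (ε ▹ v2 ▹ v1 ▹ v0 ▹ n))) (not-one (≐t (≐s (all₃ h1 v2 v1 v0)) h0))))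
         (∨I₁ (branch-intro {c = v9} {v7} {v6} {zero} {v2} {v0} {n} h6 h5 h0))
         (∨I₂ (branch-intro {c = v9} {v7} {v6} {suc · zero} {v1} {v0} {n} h6 h5 h0))))
       (⟶I (≐t (all₃ h1 v2 v1 v0) (ifz-zero (∨E h0
         (∃E h0 (all₃ h5 (v5 · v3 · v2 · v1) (suc · v1) v0
            $ branch-length {c = v10} {v9} {K · zero} {v1} {v0} h8 (∧E₁ h0)
            $ ≐t (all (o ∷ o ∷ 𝟏 ∷ 𝟏 ∷ []) h4 (ε ▹ v3 ▹ v2 ▹ v1 ▹ v0)) (ifz-zero (on-branch-intro {c = v10} {v8} {v7} {zero} {v3} {v1} {v0} h7 h6 h0))))
         (∃E h0 (all₃ h5 (v5 · v3 · v2 · v1) (suc · v1) v0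
            $ branch-length {c = v10} {v9} {K · (suc · zero)} {v1} {v0} h8 (∧E₁ h0)
            $ ≐t (all (o ∷ o ∷ 𝟏 ∷ 𝟏 ∷ []) h4 (ε ▹ v3 ▹ v2 ▹ v1 ▹ v0)) (or-zeroʳ (on-branch-intro {c = v10} {v8} {v7} {suc · zero} {v2} {v1} {v0} h7 h6 h0)))))))))
      (≤-resp (≐s (all₃ h0 v2 v1 v0)) ≐r not-≤1))))))))))))))
    (ε ▹ c ▹ p) $ H

  branch-below : ∀ {c : Tm C Γ 𝐂} {p : Tm C Γ 𝐏} {b : Tm C Γ o} {g : Tm C Γ 𝟏} {s : Tm C Γ (o *)} {i : Tm C Γ o} →
    Δ ⊩ Coding c p → Δ ⊩ Branch c b g (c · s) → Δ ⊩ i <̇ len · s → Δ ⊩ at · s · i ≐ b ∧ Branch c b g (prefix c (at · s) i)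
  branch-below {c = c} {p} {b} {g} {s} {i} H N l = inst {o ∷ (o *) ∷ 𝟏 ∷ o ∷ 𝐏 ∷ 𝐂 ∷ []}
    {Coding v5 v4 ⟶ Branch v5 v3 v2 (v5 · v1) ⟶ v0 <̇ len · v1 ⟶ at · v1 · v0 ≐ v3 ∧ Branch v5 v3 v2 (prefix v5 (at · v1) v0)}
    (∀I (∀I (∀I (∀I (∀I (∀I (⟶I (⟶I (⟶I
      (∃E h1
      (cut {A = prefix v6 (at · v2) (len · v2) ≐ prefix v6 (K · v4) v0} (≐t (≐s (code-prefix {c = v6} {v5} h3 v2)) (∧E₁ h0))
      (cut {A = len · v2 ≐ v0} (prefix-length {c = v6} {v5} h4 h0)
      (cut {A = prefix v6 (at · v2) v0 ≐ prefix v6 (K · v4) v0} (≐t (prefix-≐ (≐s h0)) h1)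
      (cut {A = v1 <̇ v0} (<-resp ≐r h1 h4)
      (∧I (≐t (prefix-entry {c = v6} {v5} h7 h1 h0) (axiom (K-eq v4 v1)))
          (∃I v1 (∧I (prefix-shorten {c = v6} {v5} h7 h1 (<⇒≤ h0))
             (∀I (⟶I (∧E₂ h5 ∙ v0 $ ≤-trans h0 (<⇒≤ h1)))))))))))))))))))))
    (ε ▹ c ▹ p ▹ b ▹ g ▹ s ▹ i) $ H $ N $ l

  -- The length is `suc · x` so that the prefix has a first entry and the index `x` is among those
  -- where `g` vanishes.
  branch-of-path : ∀ {c : Tm C Γ 𝐂} {p : Tm C Γ 𝐏} {b : Tm C Γ o} {g α : Tm C Γ 𝟏} {x : Tm C Γ o} →
    Δ ⊩ Coding c p → Δ ⊩ Branch c b g (prefix c α (suc · x)) → Δ ⊩ α · zero ≐ b ∧ Vanishes g (suc · x)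
  branch-of-path {c = c} {p} {b} {g} {α} {x} H N = inst {o ∷ 𝟏 ∷ 𝟏 ∷ o ∷ 𝐏 ∷ 𝐂 ∷ []}
    {Coding v5 v4 ⟶ Branch v5 v3 v2 (prefix v5 v1 (suc · v0)) ⟶ v1 · zero ≐ v3 ∧ Vanishes v2 (suc · v0)}
    (∀I (∀I (∀I (∀I (∀I (∀I (⟶I (⟶I
      (∃E h0
      (cut {A = suc · v1 ≐ v0} (prefix-length {c = v6} {v5} h2 (∧E₁ h0))
      (∧I (≐t (prefix-entry {c = v6} {v5} h3 (≐t (∧E₁ h1) (prefix-≐ (≐s h0))) (suc-mono z≤)) (axiom (K-eq v4 zero)))
          (∀I (⟶I (∧E₂ h2 ∙ v0 $ <-resp ≐r h1 h0))))))))))))))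
    (ε ▹ c ▹ p ▹ b ▹ g ▹ α ▹ x) $ H $ N

  module _ {c : Tm C Γ 𝐂} {Θ : Tm C Γ (𝟏 ⇒ 𝟏 ⇒ 𝟏)} {g h : Tm C Γ 𝟏} where

    node-cases : ∀ {x : Tm C Γ o} → Δ ⊩ TwoBranches c Θ → Δ ⊩ x ∈̇ (Θ · g · h) → Δ ⊩ Branch c zero g x ∨ Branch c (suc · zero) h x
    node-cases {x = x} H q = inst {o ∷ 𝟏 ∷ 𝟏 ∷ (𝟏 ⇒ 𝟏 ⇒ 𝟏) ∷ 𝐂 ∷ []}
      {TwoBranches v4 v3 ⟶ v0 ∈̇ (v3 · v2 · v1) ⟶ Branch v4 zero v2 v0 ∨ Branch v4 (suc · zero) v1 v0}
      (∀I (∀I (∀I (∀I (∀I (⟶I (∧E₁ (∧E₁ (all₃ h0 v2 v1 v0))))))))) (ε ▹ c ▹ Θ ▹ g ▹ h ▹ x) $ H $ q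

    branch-node : ∀ {x : Tm C Γ o} → Δ ⊩ TwoBranches c Θ → Δ ⊩ Branch c zero g x ∨ Branch c (suc · zero) h x → Δ ⊩ x ∈̇ (Θ · g · h)
    branch-node {x = x} H q = inst {o ∷ 𝟏 ∷ 𝟏 ∷ (𝟏 ⇒ 𝟏 ⇒ 𝟏) ∷ 𝐂 ∷ []}
      {TwoBranches v4 v3 ⟶ Branch v4 zero v2 v0 ∨ Branch v4 (suc · zero) v1 v0 ⟶ v0 ∈̇ (v3 · v2 · v1)}
      (∀I (∀I (∀I (∀I (∀I (⟶I (∧E₂ (∧E₁ (all₃ h0 v2 v1 v0))))))))) (ε ▹ c ▹ Θ ▹ g ▹ h ▹ x) $ H $ q

    tree-of-branches : ∀ {p : Tm C Γ 𝐏} → Δ ⊩ Coding c p → Δ ⊩ TwoBranches c Θ → Δ ⊩ Tree c (Θ · g · h)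
    tree-of-branches {p = p} H B = inst {𝟏 ∷ 𝟏 ∷ (𝟏 ⇒ 𝟏 ⇒ 𝟏) ∷ 𝐏 ∷ 𝐂 ∷ []}
      {Coding v4 v3 ⟶ TwoBranches v4 v2 ⟶ Tree v4 (v2 · v1 · v0)}
      (∀I (∀I (∀I (∀I (∀I (⟶I (⟶I (∧I
        (∀I (∧E₂ (all₃ h0 v2 v1 v0)))
        (∀I (⟶I (∧E₂ (axiom (∀<-def (len · v0) (at · v1 · v0 ≤̇ suc · zero ∧ prefix v6 (at · v1) v0 ∈̇ (v4 · v3 · v2)))) $ ∀I (⟶I
          (∨E (∧E₁ (∧E₁ (all₃ h2 v3 v2 (v6 · v1))) $ h1)
            (cut {A = at · v1 · v0 ≐ zero ∧ Branch v6 zero v3 (prefix v6 (at · v1) v0)} (branch-below {c = v6} {v5} h4 h0 h1)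
              (∧I (≤-resp (≐s (∧E₁ h0)) ≐r z≤) (∧E₂ (∧E₁ (all₃ h4 v3 v2 (prefix v6 (at · v1) v0))) $ ∨I₁ (∧E₂ h0))))
            (cut {A = at · v1 · v0 ≐ suc · zero ∧ Branch v6 (suc · zero) v2 (prefix v6 (at · v1) v0)} (branch-below {c = v6} {v5} h4 h0 h1)
              (∧I (≤-resp (≐s (∧E₁ h0)) ≐r ≤-refl) (∧E₂ (∧E₁ (all₃ h4 v3 v2 (prefix v6 (at · v1) v0))) $ ∨I₂ (∧E₂ h0)))))))))))))))))
      (ε ▹ c ▹ p ▹ Θ ▹ g ▹ h) $ H $ B

  switches : Δ ⊩ ∀̇ o (∃̇ (𝟏 ⇒ 𝟏) (∃̇ (𝟏 ⇒ 𝟏) (Switch v2 v1 v0)))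
  switches = ∀I
    (define (o ∷ 𝟏 ∷ []) (ifz v2 (not (v1 · v0)) zero)
    (define (o ∷ 𝟏 ∷ []) (ifz v3 zero (not (v1 · v0)))
    (∃I v1 (∃I v0 (∀I (∀I (∧I (all₂ h1 v1 v0) (all₂ h0 v1 v0))))))))

  module _ {a : Tm C Γ o} {u v : Tm C Γ (𝟏 ⇒ 𝟏)} {g : Tm C Γ 𝟏} where

    -- Whatever `a` is, the tree is then extensionally the one with both branches uncut, and `Φ`
    -- cannot tell them apart.
    switch-constant : Δ ⊩ Switch a u v → Δ ⊩ ¬̇ (∃̇ o (wkT g · v0 ≐ zero)) →
                      Δ ⊩ Eq 𝟏 (u · g) (K · zero) ∧ Eq 𝟏 (v · g) (K · zero)
    switch-constant H N = inst {𝟏 ∷ (𝟏 ⇒ 𝟏) ∷ (𝟏 ⇒ 𝟏) ∷ o ∷ []}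
      {Switch v3 v2 v1 ⟶ ¬̇ (∃̇ o (v1 · v0 ≐ zero)) ⟶ Eq 𝟏 (v2 · v0) (K · zero) ∧ Eq 𝟏 (v1 · v0) (K · zero)}
      (∀I (∀I (∀I (∀I (⟶I (⟶I (∧I
        (∀I (cut {A = not (v1 · v0) ≐ zero} (not-zero (⟶I (h1 $ ∃I v0 h0)))
          (≐t (∧E₁ (all₂ h2 v1 v0)) (≐t (num-cases v4 (≐t (ifz-zero h0) h1) (ifz-suc h0)) (≐s (axiom (K-eq zero v0)))))))
        (∀I (cut {A = not (v1 · v0) ≐ zero} (not-zero (⟶I (h1 $ ∃I v0 h0)))
          (≐t (∧E₂ (all₂ h2 v1 v0)) (≐t (num-cases v4 (ifz-zero h0) (≐t (ifz-suc h0) h1)) (≐s (axiom (K-eq zero v0))))))))))))))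
      (ε ▹ a ▹ u ▹ v ▹ g) $ H $ N

    switch-infinite : ∀ {c : Tm C Γ 𝐂} {Θ : Tm C Γ (𝟏 ⇒ 𝟏 ⇒ 𝟏)} → Δ ⊩ Switch a u v → Δ ⊩ TwoBranches c Θ →
                      Δ ⊩ Infinite c (Θ · (u · g) · (v · g))
    switch-infinite {c = c} {Θ} H B = inst {𝟏 ∷ (𝟏 ⇒ 𝟏) ∷ (𝟏 ⇒ 𝟏) ∷ o ∷ (𝟏 ⇒ 𝟏 ⇒ 𝟏) ∷ 𝐂 ∷ []}
      {Switch v3 v2 v1 ⟶ TwoBranches v5 v4 ⟶ Infinite v5 (v4 · (v2 · v0) · (v1 · v0))}
      (∀I (∀I (∀I (∀I (∀I (∀I (⟶I (⟶I (∀I (num-cases v4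
        (∃I (K · (suc · zero)) (branch-node {c = v6} {v5} {v3 · v1} {v2 · v1} {x = prefix v6 (K · (suc · zero)) v0} h1
          (∨I₂ (∃I v0 (∧I ≐r (∀I (⟶I (≐t (∧E₂ (all₂ h3 v2 v0)) (ifz-zero h1)))))))))
        (∃I (K · zero) (branch-node {c = v6} {v5} {v3 · v1} {v2 · v1} {x = prefix v6 (K · zero) v0} h1
          (∨I₁ (∃I v0 (∧I ≐r (∀I (⟶I (≐t (∧E₁ (all₂ h3 v2 v0)) (ifz-suc h1)))))))))))))))))))
      (ε ▹ c ▹ Θ ▹ a ▹ u ▹ v ▹ g) $ H $ B

    -- A zero of g blocks the branch of a.
    switch-path : ∀ {c : Tm C Γ 𝐂} {p : Tm C Γ 𝐏} {Θ : Tm C Γ (𝟏 ⇒ 𝟏 ⇒ 𝟏)} {α : Tm C Γ 𝟏} {x : Tm C Γ o} →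
      Δ ⊩ Coding c p → Δ ⊩ Switch a u v → Δ ⊩ TwoBranches c Θ → Δ ⊩ Path c (Θ · (u · g) · (v · g)) α →
      Δ ⊩ g · x ≐ zero → Δ ⊩ ¬̇ (α · zero ≐ a)
    switch-path {c = c} {p} {Θ} {α} {x} Cd H B P Z = inst {o ∷ 𝟏 ∷ 𝟏 ∷ (𝟏 ⇒ 𝟏) ∷ (𝟏 ⇒ 𝟏) ∷ o ∷ (𝟏 ⇒ 𝟏 ⇒ 𝟏) ∷ 𝐏 ∷ 𝐂 ∷ []}
      {Coding v8 v7 ⟶ Switch v5 v4 v3 ⟶ TwoBranches v8 v6 ⟶ Path v8 (v6 · (v4 · v2) · (v3 · v2)) v1
        ⟶ v2 · v0 ≐ zero ⟶ ¬̇ (v1 · zero ≐ v5)}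
      (∀I (∀I (∀I (∀I (∀I (∀I (∀I (∀I (∀I (⟶I (⟶I (⟶I (⟶I (⟶I (⟶I
        (∨E (node-cases {c = v8} {v6} {v4 · v2} {v3 · v2} {x = prefix v8 v1 (suc · v0)} h3 (h2 ∙ (suc · v0)))
          (cut {A = v1 · zero ≐ zero ∧ Vanishes (v4 · v2) (suc · v0)} (branch-of-path {c = v8} {v7} {zero} {v4 · v2} {v1} {v0} h6 h0)
            (absurd (≐t (≐s (ifz-zero h3))
              (≐t (≐s (ifz-zero (≐t (≐s h2) (∧E₁ h0)))) (≐t (≐s (∧E₁ (all₂ h6 v2 v0))) (∧E₂ h0 ∙ v0 $ ≤-refl))))))
          (cut {A = v1 · zero ≐ suc · zero ∧ Vanishes (v3 · v2) (suc · v0)} (branch-of-path {c = v8} {v7} {suc · zero} {v3 · v2} {v1} {v0} h6 h0)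
            (absurd (≐t (≐s (ifz-zero h3))
              (≐t (≐s (ifz-suc (≐t (≐s h2) (∧E₁ h0)))) (≐t (≐s (∧E₂ (all₂ h6 v2 v0))) (∧E₂ h0 ∙ v0 $ ≤-refl))))))))))))))))))))))
      (ε ▹ c ▹ p ▹ Θ ▹ a ▹ u ▹ v ▹ g ▹ α ▹ x) $ Cd $ H $ B $ P $ Z

  select-path : ∀ {c : Tm C Γ 𝐂} {Φ : Tm C Γ (𝟏 ⇒ 𝟏)} {t : Tm C Γ 𝟏} → Δ ⊩ Selects c Φ → Δ ⊩ Tree c t → Δ ⊩ Infinite c t →
                Δ ⊩ Path c t (Φ · t)
  select-path {c = c} {Φ} {t} H T I = inst {𝟏 ∷ (𝟏 ⇒ 𝟏) ∷ 𝐂 ∷ []}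
    {Selects v2 v1 ⟶ Tree v2 v0 ⟶ Infinite v2 v0 ⟶ Path v2 v0 (v1 · v0)}
    (∀I (∀I (∀I (⟶I (h0 ∙ v0))))) (ε ▹ c ▹ Φ ▹ t) $ H $ T $ I

  module _ {c : Tm C Γ 𝐂} {Φ : Tm C Γ (𝟏 ⇒ 𝟏)} {Θ : Tm C Γ (𝟏 ⇒ 𝟏 ⇒ 𝟏)} {a : Tm C Γ o} {u v : Tm C Γ (𝟏 ⇒ 𝟏)} {d : Tm C Γ 𝐏}
           {φ : Tm C Γ 𝟐} {g : Tm C Γ 𝟏} where

    zero-decided : ∀ {p : Tm C Γ 𝐏} {x : Tm C Γ o} →
      Δ ⊩ Coding c p → Δ ⊩ Selects c Φ → Δ ⊩ TwoBranches c Θ → Δ ⊩ Switch a u v → Δ ⊩ IsDistance d →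
      Δ ⊩ φ · g ≐ not (d · (Φ · (Θ · (u · g) · (v · g)) · zero) · a) → Δ ⊩ g · x ≐ zero → Δ ⊩ φ · g ≐ zero
    zero-decided {p = p} {x} Cd Se B H D E Z = ≐t E (not-zero (⟶I
      (switch-path {a = a} {u} {v} {g} {c = c} {p} {Θ} {Φ · t} {x} (weaken Cd) (weaken H) (weaken B) (weaken
         (select-path {c = c} {Φ} {t} Se (tree-of-branches {c = c} {Θ} {u · g} {v · g} {p = p} Cd B)
           (switch-infinite {a = a} {u} {v} {g} {c = c} {Θ} H B)))
         (weaken Z)
       $ ≐-distance {d = d} {Φ · t · zero} {a} (weaken D) h0)))
      where t = Θ · (u · g) · (v · g)

    decided-zero : Δ ⊩ Switch a u v → Δ ⊩ IsDistance d → Δ ⊩ a ≐ Φ · (Θ · (K · zero) · (K · zero)) · zero →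
      Δ ⊩ φ · g ≐ not (d · (Φ · (Θ · (u · g) · (v · g)) · zero) · a) → Δ ⊩ φ · g ≐ zero → Δ ⊩ ∃̇ o (wkT g · v0 ≐ zero)
    decided-zero H D A E Z = raa (not-zero⁻¹ (weaken (≐t (≐s E) Z))
      $ distance-≐ {d = d} (weaken D) (≐t (derivation (≈-refl {t = Φ} ⊙ (≈-refl {t = Θ}
            ⊙ equal {s = u · g} {K · zero} (∧E₁ constant) ⊙ equal {s = v · g} {K · zero} (∧E₂ constant)) ⊙ ≈-refl {t = zero}))
          (≐s (weaken A))))
      where
      constant : ¬̇ (∃̇ o (wkT g · v0 ≐ zero)) ∷ _ ⊩ Eq 𝟏 (u · g) (K · zero) ∧ Eq 𝟏 (v · g) (K · zero)
      constant = switch-constant {a = a} {u} {v} {g} (weaken H) h0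

  grilliot : ∀ {c : Tm C Γ 𝐂} {p : Tm C Γ 𝐏} → Δ ⊩ Coding c p → Δ ⊩ ∃̇ (𝟏 ⇒ 𝟏) (Selects (wkT c) v0) → Δ ⊩ ∃̇ 𝟐 (DecidesZeros v0)
  grilliot {c = c} {p} H F = inst {𝐏 ∷ 𝐂 ∷ []} {Coding v1 v0 ⟶ ∃̇ (𝟏 ⇒ 𝟏) (Selects v2 v0) ⟶ ∃̇ 𝟐 (DecidesZeros v0)} (∀I (∀I (⟶I (⟶I (∃E h0
    (∃E (two-branches {c = v2} {v1} h2)
    (∃E {A = v0 ≐ v2 · (v1 · (K · zero) · (K · zero)) · zero} (∃I (v1 · (v0 · (K · zero) · (K · zero)) · zero) ≐r)
    (∃E (switches ∙ v0)
    (∃E h0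
    (∃E distances
    -- Zero exactly if the path selected in the switched tree does not start with `a`.
    (define (𝟏 ∷ []) (not (v1 · (v6 · (v5 · (v3 · v0) · (v2 · v0)) · zero) · v4))
    (∃I v0 (∀I (∧I
      (⟶I (∃E h0 (zero-decided {c = v10} {v8} {v7} {v6} {v5} {v4} {v3} {v2} {v1} {p = v9} {v0} h10 h8 h7 h4 h3 (h2 ∙ v1) h0)))
      (⟶I (decided-zero {c = v9} {v7} {v6} {v5} {v4} {v3} {v2} {v1} {v0} h3 h2 h5 (h1 ∙ v0) h0))))))))))))))))
    (ε ▹ c ▹ p) $ H $ F

  -- Writing `φ · g ≐ zero` for the existence of a zero makes the matrix quantifier-free, with `φ`
  -- as a parameter, as QF-AC demands.
  minimisation : Δ ⊩ ∃̇ 𝟐 (DecidesZeros v0) → Δ ⊩ ∃̇ 𝟐 (Searches v0)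
  minimisation p = ∃E p (∃E
    (axiom (qf-ac (v2 · v1 ≐ zero ⟶ v1 · v0 ≐ zero) _) $ ∀I
      (∨E (≐-dec (v1 · v0) zero)
        (∃E (∧E₂ (h1 ∙ v0) $ h0) (∃I v0 (⟶I h1)))
        (∃I zero (⟶I (⊥E (h1 $ h0))))))
    (∃I v0 (∀I (∀I (⟶I (h1 ∙ v1 $ (∧E₁ (h2 ∙ v1) $ ∃I v0 h0)))))))

  coverable : ∀ {p : Tm C Γ 𝐏} → Δ ⊩ Pairing p → Δ ⊩ ∃̇ 𝟐 (Searches v0) → Δ ⊩ ∃̇ 𝐏 (Covers v0)
  coverable {p = p} P M = inst {𝐏 ∷ []} {Pairing v0 ⟶ ∃̇ 𝟐 (Searches v0) ⟶ ∃̇ 𝐏 (Covers v0)}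
    (∀I (⟶I (⟶I (∃E h0 (∃E ((projections ∙ v0 $ h0) ∙ v1 $ h2) (∃E h0 (all₃ covering v3 v1 v0 $ h0)))))))
    (ε ▹ p) $ P $ M

  -- Identification with the principles as stated

  tree-code : ∀ {c : Tm C Γ 𝐂} {t : Tm C Γ 𝟏} → c ≡ code {C} {Γ} → Tree c t ≡ BinaryTree t
  tree-code {Γ} {t = t} refl = cong₂ (λ a b → ∀̇ o (wkT t · v0 ≤̇ suc · zero) ∧ ∀̇ (o *) (a · v0 ∈̇ wkT t ⟶
    ∀< (len · v0) (at · v1 · v0 ≤̇ suc · zero ∧ prefix b (at · v1) v0 ∈̇ wkT (wkT t))))
    (code-closed Γ (o *)) (code-closed² Γ (o *) o)

  infinite-code : ∀ {c : Tm C Γ 𝐂} {t : Tm C Γ 𝟏} → c ≡ code {C} {Γ} → Infinite c t ≡ ∀̇ o (∃̇ 𝟏 (initSeg v0 v1 ∈̇ wkT (wkT t)))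
  infinite-code {Γ} {t = t} refl = cong (λ a → ∀̇ o (∃̇ 𝟏 (prefix a v0 v1 ∈̇ wkT (wkT t)))) (code-closed² Γ o 𝟏)

  path-code : ∀ {c : Tm C Γ 𝐂} {t α : Tm C Γ 𝟏} → c ≡ code {C} {Γ} → Path c t α ≡ ∀̇ o (initSeg (wkT α) v0 ∈̇ wkT t)
  path-code {Γ} {t = t} {α} refl = cong (λ a → ∀̇ o (prefix a (wkT α) v0 ∈̇ wkT t)) (code-closed Γ o)

  selects-code : ∃̇ (𝟏 ⇒ 𝟏) (Selects (wkT {C} {[]} (code {C} {[]})) v0) ≡ UWKL {C}
  selects-code = cong₂ (λ A B → ∃̇ (𝟏 ⇒ 𝟏) (∀̇ 𝟏 (A ⟶ B)))
    (tree-code {t = v0} (code-closed² [] (𝟏 ⇒ 𝟏) 𝟏))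
    (cong₂ _⟶_ (infinite-code {t = v0} (code-closed² [] (𝟏 ⇒ 𝟏) 𝟏)) (path-code {t = v0} {v1 · v0} (code-closed² [] (𝟏 ⇒ 𝟏) 𝟏)))

  könig-code : WeakKönig (code {C} {[]}) ≡ WKL* {C}
  könig-code = cong₂ (λ A B → ∀ˢᵗ 𝟏 (A ⟶ B)) (tree-code {t = v0} (code-closed [] 𝟏))
    (cong₂ (λ a b → ∀ˢᵗ o (∃ˢᵗ 𝟏 (prefix a v0 v1 ∈̇ v2)) ⟶ ∃ˢᵗ 𝟏 (∀̇ o (prefix b v1 v0 ∈̇ v2)))
      (trans (cong (wkT {C} {o ∷ 𝟏 ∷ []} {𝟏}) (code-closed² [] 𝟏 o)) (code-closed (o ∷ 𝟏 ∷ []) 𝟏))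
      (trans (cong (wkT {C} {𝟏 ∷ 𝟏 ∷ []} {o}) (code-closed² [] 𝟏 𝟏)) (code-closed (𝟏 ∷ 𝟏 ∷ []) o)))

  selectable : ∀ {c : Tm C Γ 𝐂} {p : Tm C Γ 𝐏} → Δ ⊩ Coding c p → Δ ⊩ ∃̇ 𝟐 (Searches v0) → Δ ⊩ ∃̇ (𝟏 ⇒ 𝟏) (Selects (wkT c) v0)
  selectable {c = c} {p} H M = inst {𝐏 ∷ 𝐂 ∷ []} {Coding v1 v0 ⟶ ∃̇ 𝟐 (Searches v0) ⟶ ∃̇ (𝟏 ⇒ 𝟏) (Selects v2 v0)}
    (∀I (∀I (⟶I (⟶I
      (∃E (coverable {p = v0} (coding-pairing {c = v1} {v0} h1) h0)
      (∃E h1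
      (∃E (all₃ extension-tests v3 v1 v0 $ h1 $ h0)
        (all₃ selection v4 v3 v0 $ h4 $ h0))))))))
    (ε ▹ c ▹ p) $ H $ M

-- Standardness, transfer and the nonstandard principles

module Nonstandard {I : Set} (𝒮 : I → Specification) where
  open Internal (RCA₀Ω 𝒮) rca₀ω

  private variable
    Δ : List (Fm (Const 𝒮) Γ)

  st-app-⊩ : ∀ {σ τ} {f : Tm (Const 𝒮) Γ (σ ⇒ τ)} {x : Tm (Const 𝒮) Γ σ} → Δ ⊩ st f → Δ ⊩ st x → Δ ⊩ st (f · x)
  st-app-⊩ p q = ax (st-app _ _) $ p $ q

  -- Functions that have to be standard are given below as terms `subT (ε ▹ …) (lam …)`. A variable
  -- introduced by `define` would have a defining equation but no proof of standardness.
  st-subT : ∀ {Γ₀ τ} {θ : Sub (Const 𝒮) Γ₀ Γ} → (∀ {σ} (x : σ ∈ Γ₀) → Δ ⊩ st (θ x)) → (t : Tm (Const 𝒮) Γ₀ τ) → Δ ⊩ st (subT θ t)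
  st-subT e (var x) = e x
  st-subT e (con c) = ax (st-closed (con c))
  st-subT e (t · u) = st-app-⊩ (st-subT e t) (st-subT e u)
  st-subT e K    = ax (st-closed K)
  st-subT e S    = ax (st-closed S)
  st-subT e zero = ax (st-closed zero)
  st-subT e suc  = ax (st-closed suc)
  st-subT e R₀   = ax (st-closed R₀)
  st-subT e len  = ax (st-closed len)
  st-subT e at   = ax (st-closed at)
  st-subT e seg  = ax (st-closed seg)

  instantiate-lift : ∀ {τ} (A : Fm (Const 𝒮) (τ ∷ Γ)) → sub (single v0) (sub (lift shift) A) ≡ A
  instantiate-lift A = trans (sub-∘ _ _ A) (sub-id (λ { (here refl) → refl ; (there x) → refl }) A)

  transfer-∀ : ∀ {Δ : List (Fm (Const 𝒮) [])} {τ} (φ : Fm (Const 𝒮) (τ ∷ [])) → T (internal φ) → Δ ⊩ ∀ˢᵗ τ φ ⟶ ∀̇ τ φ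
  transfer-∀ {Δ} {τ} φ i = subst (λ A → Δ ⊩ ∀ˢᵗ τ A ⟶ ∀̇ τ A) (sub-id (λ { (here refl) → refl ; (there ()) }) φ) (ax (pf-tp τ φ i))

  -- PF-TP for the negation of `φ`, read contrapositively.
  transfer-∃ : ∀ {Δ : List (Fm (Const 𝒮) [])} {τ} (φ : Fm (Const 𝒮) (τ ∷ [])) → T (internal (¬̇ φ)) → Δ ⊩ ∃̇ τ φ → Δ ⊩ ∃ˢᵗ τ φ
  transfer-∃ {Δ} {τ} φ i p = raa (cut {A = ∀̇ τ (¬̇ φ)} none (∃E (weaken (weaken p)) (some h1 $ h0)))
    where
    none : ¬̇ (∃ˢᵗ τ φ) ∷ Δ ⊩ ∀̇ τ (¬̇ φ)
    none = transfer-∀ (¬̇ φ) i $ ∀I (⟶I (⟶I (h2 $ ∃I v0 (∧I h1 (subst (φ ∷ st v0 ∷ map wk (¬̇ (∃ˢᵗ τ φ) ∷ Δ) ⊩_) (sym (instantiate-lift φ)) h0)))))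
    some : ∀ {Δ} → Δ ⊩ ∀̇ τ (sub (lift shift) φ ⟶ ⊥̇) → Δ ⊩ φ ⟶ ⊥̇
    some {Δ} q = subst (λ A → Δ ⊩ A ⟶ ⊥̇) (instantiate-lift φ) (q ∙ v0)

  negation : Tm (Const 𝒮) Γ 𝟏 → Tm (Const 𝒮) Γ 𝟏
  negation f = subT (ε ▹ f) (lam (not (v1 · v0)))

  negation-eq : ∀ {f : Tm (Const 𝒮) Γ 𝟏} {n : Tm (Const 𝒮) Γ o} → Δ ⊩ negation f · n ≐ not (f · n)
  negation-eq {f = f} {n} = derivation (β-sub (ε ▹ f) (not (v1 · v0)) n)

  st-negation : ∀ {f : Tm (Const 𝒮) Γ 𝟏} → Δ ⊩ st f → Δ ⊩ st (negation f)
  st-negation {f = f} p = st-subT {θ = ε ▹ f} (λ { (here refl) → p }) (lam (not (v1 · v0)))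

  st-zero : Δ ⊩ st {Γ = Γ} zero
  st-zero = ax (st-closed zero)

  searches⇒trans : ∀ {Δ : List (Fm (Const 𝒮) [])} → Δ ⊩ ∃ˢᵗ 𝟐 (Searches v0) → Δ ⊩ Π⁰₁-TRANS
  searches⇒trans p = ∃E p (∀I (⟶I (⟶I (∀I (raa
    (let g = negation v1 ; m = v2 · g in
     not-zero⁻¹ {x = v1 · m} (≐t (≐s (negation-eq {f = v1})) (all₂ (∧E₂ h3) g v0 $ ≐t (negation-eq {f = v1}) (not-zero h0)))
     $ (h1 ∙ m $ st-app-⊩ (∧E₁ h3) (st-negation {f = v1} h2))))))))

  entry-search : ∀ {g h : Tm (Const 𝒮) Γ 𝟏} {s : Tm (Const 𝒮) Γ (o *)} {y : Tm (Const 𝒮) Γ o} →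
    Δ ⊩ ∀̇ o (wkT h · v0 ≐ wkT g · (at · wkT s · v0)) → Δ ⊩ Elem o y s → Δ ⊩ g · y ≐ zero →
    Δ ⊩ g · (at · s · (search · h · (len · s))) ≐ zero
  entry-search {g = g} {h} {s} {y} H E Z = inst {o ∷ (o *) ∷ 𝟏 ∷ 𝟏 ∷ []}
    {∀̇ o (v3 · v0 ≐ v4 · (at · v2 · v0)) ⟶ Elem o v0 v1 ⟶ v3 · v0 ≐ zero ⟶ v3 · (at · v1 · (search · v2 · (len · v1))) ≐ zero}
    (∀I (∀I (∀I (∀I (⟶I (⟶I (⟶I (∃E (∧E₁ (axiom (∃<-def (len · v1) (v1 ≐ at · v2 · v0))) $ h1)
      (≐t (≐s (h3 ∙ (search · v3 · (len · v2))))
        (search-finds {g = v3} {v0} {len · v2} (∧E₁ h0) (≐t (h3 ∙ v0) (≐t (Eq-arg v4 (≐s (∧E₂ h0))) h1))))))))))))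
    (ε ▹ g ▹ h ▹ s ▹ y) $ H $ E $ Z

  entries : Tm (Const 𝒮) Γ (𝟏 ⇒ o *) → Tm (Const 𝒮) Γ 𝟏 → Tm (Const 𝒮) Γ 𝟏
  entries F g = subT (ε ▹ F ▹ g) (lam (v1 · (at · (v2 · v1) · v0)))

  candidate : Tm (Const 𝒮) Γ (𝟏 ⇒ o *) → Tm (Const 𝒮) Γ 𝟏 → Tm (Const 𝒮) Γ o
  candidate F g = at · (F · g) · (search · entries F g · (len · (F · g)))

  -- The double negation normalises the value to 0 or 1, which the specification of `Ξ₀` requires
  -- beyond the equivalence in (∃²).
  decider : Tm (Const 𝒮) Γ (𝟏 ⇒ o *) → Tm (Const 𝒮) Γ 𝟐
  decider F = subT (ε ▹ F) (lam (not (not (v0 · candidate v1 v0))))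

  decider-eq : ∀ {F : Tm (Const 𝒮) Γ (𝟏 ⇒ o *)} {g : Tm (Const 𝒮) Γ 𝟏} → Δ ⊩ decider F · g ≐ not (not (g · candidate F g))
  decider-eq {F = F} {g} = derivation (β-sub (ε ▹ F) (not (not (v0 · candidate v1 v0))) g)

  st-candidate : ∀ {F : Tm (Const 𝒮) Γ (𝟏 ⇒ o *)} {g : Tm (Const 𝒮) Γ 𝟏} → Δ ⊩ st F → Δ ⊩ st g → Δ ⊩ st (candidate F g)
  st-candidate {F = F} {g} p q = st-subT {θ = ε ▹ F ▹ g} (λ { (here refl) → q ; (there (here refl)) → p }) (candidate v1 v0)

  not-not-cases : ∀ {x : Tm (Const 𝒮) Γ o} → Δ ⊩ not (not x) ≐ zero ∨ not (not x) ≐ suc · zero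
  not-not-cases {x = x} = inst {o ∷ []} {not (not v0) ≐ zero ∨ not (not v0) ≐ suc · zero}
    (∀I (num-cases (not v0) (∨I₂ (ifz-zero h0)) (∨I₁ (ifz-suc h0)))) (ε ▹ x)

  not-not-zero : ∀ {x : Tm (Const 𝒮) Γ o} → Δ ⊩ x ≐ zero → Δ ⊩ not (not x) ≐ zero
  not-not-zero q = ifz-suc {y = zero} (ifz-zero q)

  not-not-zero⁻¹ : ∀ {x : Tm (Const 𝒮) Γ o} → Δ ⊩ not (not x) ≐ zero → Δ ⊩ x ≐ zero
  not-not-zero⁻¹ {x = x} q = inst {o ∷ []} {not (not v0) ≐ zero ⟶ v0 ≐ zero}
    (∀I (⟶I (num-cases v0 h0 (absurd (≐t (≐s (ifz-zero (ifz-suc h0))) h1))))) (ε ▹ x) $ q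

  -- HAC_int needs an internal matrix, hence the reference to all zeros and not to standard ones. If
  -- `g` has no standard zero, Π⁰₁-TRANS for its negation shows that it has no zero whatsoever, and
  -- the default 0 works vacuously.
  standard-zero : ∀ {Δ : List (Fm (Const 𝒮) [])} → Δ ⊩ Π⁰₁-TRANS → Δ ⊩ ∀ˢᵗ 𝟏 (∃ˢᵗ o (∀̇ o (v2 · v0 ≐ zero ⟶ v2 · v1 ≐ zero)))
  standard-zero p = cut p (∀I (⟶I (∨E (em (∃ˢᵗ o (v1 · v0 ≐ zero)))
    (∃E h0 (∃I v0 (∧I (∧E₁ h0) (∀I (⟶I (∧E₂ h1))))))
    (∃I zero (∧I st-zero (∀I (⟶I (⊥E (not-zero⁻¹
      (≐t (≐s (negation-eq {f = v1})) ((h3 ∙ negation v1 $ st-negation {f = v1} h2 $ ∀I (⟶I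
        (≐t (negation-eq {f = v2}) (not-zero (⟶I (h3 $ ∃I v0 (∧I h1 h0)))))))
       ∙ v0)) $ h0)))))))))

  trans⇒E² : ∀ {Δ : List (Fm (Const 𝒮) [])} → Δ ⊩ Π⁰₁-TRANS → Δ ⊩ E²
  trans⇒E² {Δ} p = ∃E (ax (hac-int 𝟏 o (∀̇ o (v2 · v0 ≐ zero ⟶ v2 · v1 ≐ zero)) _) $ standard-zero p)
    (cut {A = ∀ˢᵗ 𝟏 (∃̇ o (v1 · v0 ≐ zero) ⟶ decider v1 · v0 ≐ zero)}
      (∀I (⟶I (⟶I (∃E h0 (∃E (∧E₂ h3 ∙ v1 $ h2)
        (≐t (decider-eq {F = v3} {v2}) (not-not-zero
          (entry-search {g = v2} {entries v3 v2} {v3 · v2} {v0} (∀I (derivation (β-sub (ε ▹ v4 ▹ v3) (v1 · (at · (v2 · v1) · v0)) v0)))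
            (∧E₁ h0) (∧E₂ h0 ∙ v1 $ h1)))))))))
    (cut {A = ∀ˢᵗ 𝟏 (decider v1 · v0 ≐ zero ⟶ ∃ˢᵗ o (v1 · v0 ≐ zero))}
      (∀I (⟶I (⟶I (∃I (candidate v1 v0) (∧I (st-candidate {F = v1} {v0} (∧E₁ h3) h1)
        (not-not-zero⁻¹ (≐t (≐s (decider-eq {F = v1} {v0})) h0)))))))
    -- The relativised specification speaks of standard zeros of standard functions; the two
    -- preceding facts supply its equivalence, and `not-not-cases` its clause on values.
    (cut {A = ∀ˢᵗ 𝟏 (Ξ · v0 ≐ decider v1 · v0)}
      (∧E₂ (ax (Ξ₀-spec nothing)) ∙ decider v0 $ st-subT {θ = ε ▹ v0} (λ { (here refl) → ∧E₁ h2 }) (decider v0) $ ∀I (⟶I (∧I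
        (∧I (⟶I (h3 ∙ v0 $ h1 $ ∃E h0 (∃I v0 (∧E₂ h0)))) (⟶I (h2 ∙ v0 $ h1 $ h0)))
        (∨E (not-not-cases {x = v0 · candidate v1 v0})
          (∨I₁ (≐t (decider-eq {F = v1} {v0}) h0))
          (∨I₂ (≐t (decider-eq {F = v1} {v0}) h0))))))
    -- The decider contains the functional from HAC_int as a parameter, which PF-TP forbids; the
    -- constant `Ξ` is allowed.
    (∃I Ξ (transfer-∀′ (∃̇ o (v1 · v0 ≐ zero) ⟷ Ξ · v0 ≐ zero) _ (∀I (⟶I (∧I
      (⟶I (≐t (h2 ∙ v0 $ h1) (h4 ∙ v0 $ h1 $ h0)))
      (⟶I (∃E (h3 ∙ v0 $ h1 $ ≐t (≐s (h2 ∙ v0 $ h1)) h0) (∃I v0 (∧E₂ h0))))))))))))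
    where
    Ξ : ∀ {Γ} → Tm (Const 𝒮) Γ 𝟐
    Ξ = con (Ξ₀ nothing)
    transfer-∀′ : ∀ {Δ : List (Fm (Const 𝒮) Γ)} {τ} (φ : Fm (Const 𝒮) (τ ∷ [])) → T (internal φ) →
                  Δ ⊩ ∀ˢᵗ τ (sub (lift closed) φ) → Δ ⊩ ∀̇ τ (sub (lift closed) φ)
    transfer-∀′ φ i q = ax (pf-tp _ φ i) $ q

  -- With the constant function 1 as second argument, the branch 111... is cut off at the root. Any
  -- path then runs along 000..., which exists only as far as `f` vanishes.
  transfer-along-branch : Δ ⊩ ∀̇ 𝐂 (∀̇ 𝐏 (∀̇ (𝟏 ⇒ 𝟏 ⇒ 𝟏) (Coding v2 v1 ⟶ TwoBranches v2 v0 ⟶ st v0 ⟶ WeakKönig v2 ⟶ Transfer)))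
  transfer-along-branch = ∀I (∀I (∀I (⟶I (⟶I (⟶I (⟶I (∀I (⟶I (⟶I
    (let t = v1 · v0 · b in
    ∃E (h2 ∙ t
        $ st-app-⊩ (st-app-⊩ h3 h1) (ax (st-closed (K · (suc · zero))))
        $ tree-of-branches {c = v3} {v1} {v0} {b} {p = v2} h5 h4
        $ ∀I (⟶I (∃I (K · zero) (∧I (ax (st-closed (K · zero)))
            (branch-node {c = v4} {v2} {v1} {b} {x = prefix v4 (K · zero) v0} h5 (∨I₁ (∃I v0 (∧I ≐r
              -- The length is standard, hence so are all indices below it, and there `f` is known
              -- to vanish.
              (∀I (⟶I (h2 ∙ v0 $ (ax (st-below v0 v1) $ <⇒≤ h0 $ h1))))))))))))
      (∀I (∨E (node-cases {c = v5} {v3} {v2} {b} {x = prefix v5 v1 (suc · v0)} h5 (∧E₂ h0 ∙ (suc · v0)))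
        (∧E₂ (branch-of-path {c = v5} {v4} {zero} {v2} {v1} {v0} h7 h0) ∙ v0 $ ≤-refl)
        (absurd (≐t (≐s (axiom (K-eq (suc · zero) v0)))
          (∧E₂ (branch-of-path {c = v5} {v4} {suc · zero} {b} {v1} {v0} h7 h0) ∙ v0 $ ≤-refl)))))))))))))))
    where
    b : ∀ {Γ} → Tm (Const 𝒮) Γ 𝟏
    b = K · (suc · zero)

  könig⇒transfer : ∀ {c : Tm (Const 𝒮) Γ 𝐂} {p : Tm (Const 𝒮) Γ 𝐏} → Δ ⊩ Coding c p → Δ ⊩ ∃ˢᵗ (𝟏 ⇒ 𝟏 ⇒ 𝟏) (TwoBranches (wkT c) v0) →
                   Δ ⊩ WeakKönig c → Δ ⊩ Transfer
  könig⇒transfer {c = c} {p} H B W = inst {𝐏 ∷ 𝐂 ∷ []}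
    {Coding v1 v0 ⟶ ∃ˢᵗ (𝟏 ⇒ 𝟏 ⇒ 𝟏) (TwoBranches v2 v0) ⟶ WeakKönig v1 ⟶ Transfer}
    (∀I (∀I (⟶I (⟶I (⟶I (∃E h1 (all₃ transfer-along-branch v2 v1 v0 $ h3 $ ∧E₂ h0 $ ∧E₁ h0 $ h1)))))))
    (ε ▹ c ▹ p) $ H $ B $ W

  level : (c : Tm (Const 𝒮) Γ 𝐂) (e : Tm (Const 𝒮) Γ 𝐏) (t : Tm (Const 𝒮) Γ 𝟏) (n : Tm (Const 𝒮) Γ o) → Tm (Const 𝒮) Γ 𝟏
  level c e t n = subT (ε ▹ c ▹ e ▹ t ▹ n) (lam (distance (v2 · prefix v4 (v3 · v0) v1) (suc · zero)))

  -- Zero at n exactly when t has a node of length n.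
  height : (c : Tm (Const 𝒮) Γ 𝐂) (e : Tm (Const 𝒮) Γ 𝐏) (t : Tm (Const 𝒮) Γ 𝟏) (μ : Tm (Const 𝒮) Γ 𝟐) → Tm (Const 𝒮) Γ 𝟏
  height c e t μ = subT (ε ▹ c ▹ e ▹ t ▹ μ) (lam (level v4 v3 v2 v0 · (v1 · level v4 v3 v2 v0)))

  level-eq : ∀ {c : Tm (Const 𝒮) Γ 𝐂} {e : Tm (Const 𝒮) Γ 𝐏} {t : Tm (Const 𝒮) Γ 𝟏} {n j : Tm (Const 𝒮) Γ o} →
             Δ ⊩ level c e t n · j ≐ distance (t · prefix c (e · j) n) (suc · zero)
  level-eq {c = c} {e} {t} {n} {j} = derivation (β-sub (ε ▹ c ▹ e ▹ t ▹ n) (distance (v2 · prefix v4 (v3 · v0) v1) (suc · zero)) j)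

  height-eq : ∀ {c : Tm (Const 𝒮) Γ 𝐂} {e : Tm (Const 𝒮) Γ 𝐏} {t : Tm (Const 𝒮) Γ 𝟏} {μ : Tm (Const 𝒮) Γ 𝟐} {n : Tm (Const 𝒮) Γ o} →
              Δ ⊩ height c e t μ · n ≐ level c e t n · (μ · level c e t n)
  height-eq {c = c} {e} {t} {μ} {n} = derivation (β-sub (ε ▹ c ▹ e ▹ t ▹ μ) (level v4 v3 v2 v0 · (v1 · level v4 v3 v2 v0)) n)

  module _ {c : Tm (Const 𝒮) Γ 𝐂} {e : Tm (Const 𝒮) Γ 𝐏} {t : Tm (Const 𝒮) Γ 𝟏} {μ : Tm (Const 𝒮) Γ 𝟐} where

    height-zero : ∀ {n} → Δ ⊩ Covers e → Δ ⊩ Searches μ → Δ ⊩ ∃̇ 𝟏 (prefix (wkT c) v0 (wkT n) ∈̇ wkT t) → Δ ⊩ height c e t μ · n ≐ zero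
    height-zero {n = n} Co Se X = inst {o ∷ 𝟐 ∷ 𝟏 ∷ 𝐏 ∷ 𝐂 ∷ []}
      {Covers v3 ⟶ Searches v1 ⟶ ∃̇ 𝟏 (prefix v5 v0 v1 ∈̇ v3) ⟶ height v4 v3 v2 v1 · v0 ≐ zero}
      (∀I (∀I (∀I (∀I (∀I (⟶I (⟶I (⟶I (∃E h0 (∃E (all₂ h3 v0 v1)
        (≐t (height-eq {c = v6} {v5} {v4} {v3} {v2}) (all₂ h3 (level v6 v5 v4 v2) v0 $
          ≐t (level-eq {c = v6} {v5} {v4} {v2} {v0}) (distance-zero
            (≐t (Eq-arg v4 (seg-covered {c = v6} {v5} {v1} {v0} {v2} {v2} h0 ≤-refl)) h1))))))))))))))
      (ε ▹ c ▹ e ▹ t ▹ μ ▹ n) $ Co $ Se $ X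

    infinite-of-height : Δ ⊩ ∀̇ o (height (wkT c) (wkT e) (wkT t) (wkT μ) · v0 ≐ zero) → Δ ⊩ Infinite c t
    infinite-of-height H = inst {𝟐 ∷ 𝟏 ∷ 𝐏 ∷ 𝐂 ∷ []}
      {∀̇ o (height v4 v3 v2 v1 · v0 ≐ zero) ⟶ Infinite v3 v1}
      (∀I (∀I (∀I (∀I (⟶I (∀I (∃I (v3 · (v1 · level v4 v3 v2 v0)) (distance-zero⁻¹
        (≐t (≐s (level-eq {c = v4} {v3} {v2} {v0} {v1 · level v4 v3 v2 v0}))
          (≐t (≐s (height-eq {c = v4} {v3} {v2} {v1} {v0})) (h0 ∙ v0)))))))))))
      (ε ▹ c ▹ e ▹ t ▹ μ) $ H

    st-height : Δ ⊩ st c → Δ ⊩ st e → Δ ⊩ st t → Δ ⊩ st μ → Δ ⊩ st (height c e t μ)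
    st-height p q r s = st-subT {θ = ε ▹ c ▹ e ▹ t ▹ μ}
      (λ { (here refl) → s ; (there (here refl)) → r ; (there (there (here refl))) → q ; (there (there (there (here refl)))) → p })
      (lam (level v4 v3 v2 v0 · (v1 · level v4 v3 v2 v0)))

  -- `Infinite` involves a function quantifier, to which Π⁰₁-TRANS does not apply. The standard
  -- function `height` expresses it by numerical equations, which pass from standard lengths to all
  -- lengths.
  selected-path : Δ ⊩ ∀̇ 𝐂 (∀̇ (𝟏 ⇒ 𝟏) (∀̇ 𝐏 (∀̇ 𝟐 (st v3 ⟶ st v2 ∧ Selects v3 v2 ⟶ st v1 ∧ Covers v1 ⟶
                   st v0 ∧ Searches v0 ⟶ Transfer ⟶ WeakKönig v3))))
  selected-path = ∀I (∀I (∀I (∀I (⟶I (⟶I (⟶I (⟶I (⟶I (∀I (⟶I (⟶I (⟶I (∃I (v3 · v0) (∧I (st-app-⊩ (∧E₁ h6) h2)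
    (select-path {c = v4} {v3} {v0} (∧E₂ h6) h1 (infinite-of-height {c = v4} {v2} {v0} {v1}
      (h3 ∙ height v4 v2 v0 v1 $ st-height {c = v4} {v2} {v0} {v1} h7 (∧E₁ h5) h2 (∧E₁ h4) $ ∀I (⟶I
        (height-zero {c = v5} {v3} {v1} {v2} {n = v0} (∧E₂ h6) (∧E₂ h5) (∃E (h1 ∙ v0 $ h0) (∃I v0 (∧E₂ h0))))))))))))))))))))))

  transfer⇒könig : ∀ {c : Tm (Const 𝒮) Γ 𝐂} → Δ ⊩ st c → Δ ⊩ ∃ˢᵗ (𝟏 ⇒ 𝟏) (Selects (wkT c) v0) → Δ ⊩ ∃ˢᵗ 𝐏 (Covers v0) →
                   Δ ⊩ ∃ˢᵗ 𝟐 (Searches v0) → Δ ⊩ Transfer → Δ ⊩ WeakKönig c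
  transfer⇒könig {c = c} z F E M T = inst {𝐂 ∷ []}
    {st v0 ⟶ ∃ˢᵗ (𝟏 ⇒ 𝟏) (Selects v1 v0) ⟶ ∃ˢᵗ 𝐏 (Covers v0) ⟶ ∃ˢᵗ 𝟐 (Searches v0) ⟶ Transfer ⟶ WeakKönig v0}
    (∀I (⟶I (⟶I (⟶I (⟶I (⟶I (∃E h3 (∃E h3 (∃E h3
      (all (𝟐 ∷ 𝐏 ∷ (𝟏 ⇒ 𝟏) ∷ 𝐂 ∷ []) selected-path (ε ▹ v3 ▹ v2 ▹ v1 ▹ v0) $ h7 $ h2 $ h1 $ h0 $ h3))))))))))
    (ε ▹ c) $ z $ F $ E $ M $ T

  -- The implications between the principles

  E²⇒searches : ∀ {Δ : List (Fm (Const 𝒮) [])} → Δ ⊩ E² → Δ ⊩ ∃ˢᵗ 𝟐 (Searches v0)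
  E²⇒searches p = transfer-∃ (Searches v0) _ (minimisation p)

  E²⇒trans : ∀ {Δ : List (Fm (Const 𝒮) [])} → Δ ⊩ E² → Δ ⊩ Π⁰₁-TRANS
  E²⇒trans p = searches⇒trans (E²⇒searches p)

  E²⇒UWKL : ∀ {Δ : List (Fm (Const 𝒮) [])} → Δ ⊩ E² → Δ ⊩ UWKL
  E²⇒UWKL {Δ} p = subst (Δ ⊩_) selects-code (selectable {c = code} {pairing} code-codes (minimisation p))

  UWKL⇒E² : ∀ {Δ : List (Fm (Const 𝒮) [])} → Δ ⊩ UWKL → Δ ⊩ E²
  UWKL⇒E² {Δ} p = grilliot {c = code} {pairing} code-codes (subst (Δ ⊩_) (sym selects-code) p)

  trans⇒WKL* : ∀ {Δ : List (Fm (Const 𝒮) [])} → Δ ⊩ Π⁰₁-TRANS → Δ ⊩ WKL*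
  trans⇒WKL* {Δ} p = subst (Δ ⊩_) könig-code (transfer⇒könig {c = code} (ax (st-closed code))
      (transfer-∃ (Selects (wkT {Const 𝒮} {[]} (code {Const 𝒮} {[]})) v0) _ (selectable {c = code} {pairing} code-codes (minimisation e)))
      (transfer-∃ (Covers v0) _ (coverable {p = pairing} pairing-pairs (minimisation e)))
      (E²⇒searches e) p)
    where e = trans⇒E² p

  WKL*⇒trans : ∀ {Δ : List (Fm (Const 𝒮) [])} → Δ ⊩ WKL* → Δ ⊩ Π⁰₁-TRANS
  WKL*⇒trans {Δ} p = könig⇒transfer {c = code} {pairing} code-codes
    (transfer-∃ (TwoBranches (wkT {Const 𝒮} {[]} (code {Const 𝒮} {[]})) v0) _ (two-branches {c = code} {pairing} code-codes))
    (subst (Δ ⊩_) (sym könig-code) p)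

  equivalences : [] ⊩ (E² ⟷ Π⁰₁-TRANS) ∧ (Π⁰₁-TRANS ⟷ WKL*) ∧ (WKL* ⟷ UWKL)
  equivalences = ∧I (∧I (⟶I (E²⇒trans h0)) (⟶I (trans⇒E² h0)))
    (∧I (∧I (⟶I (trans⇒WKL* h0)) (⟶I (WKL*⇒trans h0)))
        (∧I (⟶I (E²⇒UWKL (trans⇒E² (WKL*⇒trans h0)))) (⟶I (trans⇒WKL* (E²⇒trans (UWKL⇒E² h0))))))

  result : RCA₀Ω 𝒮 ⊢ (E² ⟷ Π⁰₁-TRANS) ∧ (Π⁰₁-TRANS ⟷ WKL*) ∧ (WKL* ⟷ UWKL)
  result = ⌊ equivalences ⌋

corollary3p2 : {I : Set} (𝒮 : I → Specification) →
    RCA₀Ω 𝒮 ⊢ (E² ⟷ Π⁰₁-TRANS) ∧ (Π⁰₁-TRANS ⟷ WKL*) ∧ (WKL* ⟷ UWKL)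
corollary3p2 𝒮 = Nonstandard.result 𝒮
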